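{- Let $\lambda$ be a JS-partition of type $\alpha$ with residue symbol $R_p(\lambda)=\left\{\begin{smallmatrix}x_1&\cdots&x_{k+1}\\ y_1&\cdots&y_{k+1}\end{smallmatrix}\right\}$ of length $k+1\ge1$. For $1\le j\le k+1$ let $\lambda[j]$ denote the partition whose residue symbol consists of the first $j$ columns of $R_p(\lambda)$ (so $\lambda[k+1]=\lambda$). Put $d_0=1$ if $(x_1,y_1)=(\alpha,\alpha+1)$ and $d_0=0$ otherwise. For $1\le i\le k$, with $(x',y')=(x_i,y_i)$ and $(x,y)=(x_{i+1},y_{i+1})$, define $t,t',s\in\{0,\dots,p-1\}$ by $t\equiv x-y+1$, $t'\equiv x'-y'+1$, $s\equiv y'-y\pmod p$, let $\varepsilon=0$ if $t=0$ and $1$ otherwise, $\varepsilon'=0$ if $t'=0$ and $1$ otherwise, and set $$d_i=\begin{cases}\left\lfloor\frac{t'+2s}{p}\right\rfloor & \text{if } \varepsilon'=\varepsilon=1,\\ \left\lfloor\frac{t'+s+p}{p}\right\rfloor & \text{if } \varepsilon'=1,\ \varepsilon=0,\\ \left\lfloor\frac{p-1+s-t}{p}\right\rfloor & \text{if } \varepsilon'=0,\end{cases}\qquad e_i=\begin{cases}1 & \text{if } |\lambda[i+1]_{(p)}|<|\lambda[i]_{(p)}|,\\ 0 & \text{otherwise.}\end{cases}$$ Then the $p$-weight of $\lambda$ is $w(\lambda)=\sum_{i=0}^{k}(k+1-i)d_i+\sum_{i=1}^{k}e_i$.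
   Context: Fix an integer $p\ge 2$. A partition is written $\lambda=(l_1^{a_1},\dots,l_t^{a_t})$ with $l_1>\dots>l_t>0$, $a_i\ge1$; it is $p$-regular if all $a_i\le p-1$. A $p$-regular $\lambda$ is a JS-partition if $l_i-l_{i+1}+a_i+a_{i+1}\equiv 0\pmod p$ for $1\le i<t$; its type is $l_1-a_1 \bmod p$. The $p$-core $\nu_{(p)}$ of a partition $\nu$ is obtained by repeatedly removing rim hooks of length $p$ until none remains; the $p$-weight is $w(\nu)=(|\nu|-|\nu_{(p)}|)/p$. Residue symbol: the rim of $\lambda$ is the set of nodes $(i,j)$ of the Young diagram with $(i+1,j+1)$ not in it, ordered from the end of the first row to the start of the last row. The $p$-rim is the union of $p$-segments: the first consists of the first $p$ nodes of the rim (or all of it), each next one consists of the first $p$ (or all remaining) rim nodes starting at the last node of the row just below the lowest row of the previous segment, until the last row is reached. Let $a_1$ = size of the $p$-rim of $\lambda^{(1)}=\lambda$, $r_1$ = its number of parts; removing the $p$-rim gives $\lambda^{(2)}$; iterate until $\lambda^{(m+1)}=\emptyset$, defining $a_j,r_j$ for $\lambda^{(j)}$. The residue symbol $R_p(\lambda)$ has columns $(x_j,y_j)$, $j=1,\dots,m$, with $x_j\equiv a_{m+1-j}-r_{m+1-j}$, $y_j\equiv 1-r_{m+1-j}\pmod p$; $m$ is its length. Deleting the last column of $R_p(\lambda)$ gives $R_p(\lambda^{(2)})$, so the first $j$ columns of $R_p(\lambda)$ form the residue symbol of $\lambda^{(m+1-j)}$. -}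

module Defs where

open import Data.Nat using (ℕ; zero; suc; _+_; _*_; _∸_; _≤_; _<_; _≥_; NonZero; _≟_; _≤?_; _<?_)
open import Data.Nat.DivMod using (_/_; _%_)
open import Data.Integer as ℤ using (ℤ; +_)
open import Data.Integer.DivMod using (_%ℕ_)
open import Data.Bool using (Bool; true; false; if_then_else_)
open import Data.Nat.ListAction using (sum)
open import Data.List using (List; []; _∷_; length; map; upTo; filter; reverse; zipWith)
open import Data.List.Relation.Unary.All using (All)
open import Data.List.Relation.Unary.Linked using (Linked)
open import Data.Maybe using (Maybe; just; nothing)
open import Data.Product using (_×_; _,_; proj₁; proj₂)
open import Relation.Nullary using (yes; no; ¬_)
open import Relation.Nullary.Decidable using (⌊_⌋)
open import Relation.Binary.PropositionalEquality using (_≡_)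

Partition : Set
Partition = List ℕ

IsPartition : Partition → Set
IsPartition ν = All (λ x → 0 < x) ν × Linked _≥_ ν

size : Partition → ℕ
size = sum

part : Partition → ℕ → ℕ
part []       _       = 0
part (x ∷ _)  zero    = x
part (_ ∷ xs) (suc i) = part xs i

dropZeros : List ℕ → List ℕ
dropZeros = filter (λ x → 0 <? x)

-- Exponential notation λ = (l₁^{a₁}, …, l_t^{a_t}) : list of pairs (lᵢ , aᵢ)

groups : Partition → List (ℕ × ℕ)
groups [] = []
groups (x ∷ xs) with groups xs
... | [] = (x , 1) ∷ []
... | (l , a) ∷ rest with x ≟ l
...   | yes _ = (l , suc a) ∷ rest
...   | no  _ = (x , 1) ∷ (l , a) ∷ rest

IsRegular : (p : ℕ) → Partition → Set
IsRegular p ν = All (λ g → proj₂ g ≤ p ∸ 1) (groups ν)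

module _ (p : ℕ) .{{_ : NonZero p}} where

  modp : ℤ → ℕ
  modp z = z %ℕ p

  JSChain : List (ℕ × ℕ) → Set
  JSChain [] = ⊤'
    where open import Data.Unit using () renaming (⊤ to ⊤')
  JSChain (_ ∷ []) = ⊤'
    where open import Data.Unit using () renaming (⊤ to ⊤')
  JSChain ((l , a) ∷ (l' , a') ∷ gs) =
    modp ((+ l ℤ.- + l') ℤ.+ + a ℤ.+ + a') ≡ 0 × JSChain ((l' , a') ∷ gs)

  IsJS : Partition → Set
  IsJS ν = IsRegular p ν × JSChain (groups ν)

  -- type of a JS-partition: l₁ - a₁ mod p  (0 for the empty partition, never used)
  jsType : Partition → ℕ
  jsType ν with groups ν
  ... | [] = 0
  ... | (l , a) ∷ _ = modp (+ l ℤ.- + a)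

  -- p-rim.
  -- Rim nodes of row i are the columns λ_{i+1},…,λ_i (1-indexed; all of
  -- row i for the last row); their number is:
  rimCounts : Partition → List ℕ
  rimCounts [] = []
  rimCounts (x ∷ []) = x ∷ []
  rimCounts (x ∷ y ∷ xs) = suc (x ∸ y) ∷ rimCounts (y ∷ xs)

  -- Walk the rim row by row, cutting it into p-segments: b = number of
  -- nodes still to be taken by the current segment.  When a segment ends
  -- in row i, the next one starts at the last node of row i+1.
  -- Output: number of p-rim nodes in each row (they are the rightmost ones).
  segTake : ℕ → List ℕ → List ℕ
  segTake b [] = []
  segTake b (c ∷ cs) with b ≤? c
  ... | yes _ = b ∷ segTake p cs
  ... | no  _ = c ∷ segTake (b ∸ c) cs

  pRimRows : Partition → List ℕ
  pRimRows ν = segTake p (rimCounts ν)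

  pRimSize : Partition → ℕ
  pRimSize ν = sum (pRimRows ν)

  pRimParts : Partition → ℕ
  pRimParts ν = length (dropZeros (pRimRows ν))

  removePRim : Partition → Partition
  removePRim ν = dropZeros (zipWith _∸_ ν (pRimRows ν))

  iter : ℕ → Partition → Partition
  iter zero ν = ν
  iter (suc j) ν = iter j (removePRim ν)

  -- list of (a_j , r_j) for j = 1,…,m, with fuel (|ν| suffices)
  rimData : ℕ → Partition → List (ℕ × ℕ)
  rimData _ [] = []
  rimData zero (_ ∷ _) = []
  rimData (suc f) ν@(_ ∷ _) = (pRimSize ν , pRimParts ν) ∷ rimData f (removePRim ν)

  residueSymbol : Partition → List (ℕ × ℕ)
  residueSymbol ν =
    map (λ ar → modp (+ proj₁ ar ℤ.- + proj₂ ar) , modp (+ 1 ℤ.- + proj₂ ar))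
        (reverse (rimData (size ν) ν))

  -- p-core by repeated removal of rim hooks of length p.
  -- The rim hook of the node (i , j) (0-indexed) has length = hook length
  -- arm + leg + 1; removing it turns rows i,…,i+leg-1 into λ_{r+1} - 1 and
  -- row i+leg into j.

  colLen : Partition → ℕ → ℕ
  colLen ν j = length (filter (λ x → j <? x) ν)

  leg : Partition → ℕ → ℕ → ℕ
  leg ν i j = colLen ν j ∸ suc i

  hookLength : Partition → ℕ → ℕ → ℕ
  hookLength ν i j = (part ν i ∸ suc j) + leg ν i j + 1

  removeHook : Partition → ℕ → ℕ → Partition
  removeHook ν i j = dropZeros (map newRow (upTo (length ν)))
    where
    L = leg ν i j
    newRow : ℕ → ℕ
    newRow r with r <? i | r <? i + L | r ≟ i + L
    ... | yes _ | _     | _     = part ν r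
    ... | no _  | yes _ | _     = part ν (suc r) ∸ 1
    ... | no _  | no _  | yes _ = j
    ... | no _  | no _  | no _  = part ν r

  findInRow : Partition → ℕ → List ℕ → Maybe (ℕ × ℕ)
  findInRow ν i [] = nothing
  findInRow ν i (j ∷ js) with hookLength ν i j ≟ p
  ... | yes _ = just (i , j)
  ... | no _  = findInRow ν i js

  findHook : Partition → Maybe (ℕ × ℕ)
  findHook ν = go (upTo (length ν))
    where
    go : List ℕ → Maybe (ℕ × ℕ)
    go [] = nothing
    go (i ∷ is) with findInRow ν i (upTo (part ν i))
    ... | just c  = just c
    ... | nothing = go is

  coreFuel : ℕ → Partition → Partition
  coreFuel zero ν = ν
  coreFuel (suc f) ν with findHook ν
  ... | nothing = ν
  ... | just (i , j) = coreFuel f (removeHook ν i j)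

  -- the p-core ν_(p)  (each removal lowers |ν| by p ≥ 1, so |ν| steps suffice)
  core : Partition → Partition
  core ν = coreFuel (size ν) ν

  weight : Partition → ℕ
  weight ν = (size ν ∸ size (core ν)) / p

  col : List (ℕ × ℕ) → ℕ → ℕ × ℕ
  col [] _ = (0 , 0)
  col (c ∷ _) (suc zero) = c
  col (_ ∷ cs) (suc (suc i)) = col cs (suc i)
  col _ zero = (0 , 0)

  -- λ[j] = partition whose residue symbol is the first j columns of R_p(λ),
  -- i.e. λ^{(m+1-j)} where m is the length of R_p(λ)
  truncP : Partition → ℕ → Partition
  truncP ν j = iter (length (residueSymbol ν) ∸ j) ν

  d₀ : ℕ → List (ℕ × ℕ) → ℕ
  d₀ α R with proj₁ (col R 1) ≟ α | proj₂ (col R 1) ≟ (α + 1) % p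
  ... | yes _ | yes _ = 1
  ... | _     | _     = 0

  dPair : ℕ × ℕ → ℕ × ℕ → ℕ
  dPair (x' , y') (x , y) with t' ≟ 0 | t ≟ 0
    where
    t  = modp ((+ x ℤ.- + y) ℤ.+ + 1)
    t' = modp ((+ x' ℤ.- + y') ℤ.+ + 1)
  ... | no _  | no _  = (t' + 2 * s) / p
    where
    t' = modp ((+ x' ℤ.- + y') ℤ.+ + 1)
    s  = modp (+ y' ℤ.- + y)
  ... | no _  | yes _ = (t' + s + p) / p
    where
    t' = modp ((+ x' ℤ.- + y') ℤ.+ + 1)
    s  = modp (+ y' ℤ.- + y)
  ... | yes _ | _     = ((p ∸ 1) + s ∸ t) / p
    where
    t  = modp ((+ x ℤ.- + y) ℤ.+ + 1)
    s  = modp (+ y' ℤ.- + y)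

  dCoef : Partition → ℕ → ℕ
  dCoef ν zero = d₀ (jsType ν) (residueSymbol ν)
  dCoef ν (suc i) = dPair (col (residueSymbol ν) (suc i)) (col (residueSymbol ν) (suc (suc i)))

  eCoef : Partition → ℕ → ℕ
  eCoef ν i =
    if ⌊ size (core (truncP ν (suc i))) <? size (core (truncP ν i)) ⌋ then 1 else 0

  weightFormula : Partition → ℕ → ℕ
  weightFormula ν k =
    sum (map (λ i → (suc k ∸ i) * dCoef ν i) (upTo (suc k)))
    + sum (map (λ i → eCoef ν (suc i)) (upTo k))

{-# OPTIONS --safe #-}
module Submission where

-- Read the bead positions (first-column hook lengths) of a JS-partition λ of type α with n parts
-- from the top group down, each group from its lowest bead up: modulo p they are α + n, α + n + 1, …,
-- α + 2n − 1.  Hence the p-core depends only on α and n, and with S m = Σ_{i<m} (i mod p) its size is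
-- S (α + 2n) − S n − S (α + n).  Removing the p-rim keeps λ a JS-partition of the same type α, so if z
-- parts are lost the change of the core size is explicit; together with the rim size A this gives
-- w(λ) = w(λ⁽²⁾) + ⌊A / p⌋ + e.  Finally ⌊A / p⌋ − ⌊A′ / p⌋, for the rim sizes A and A′ of λ and λ⁽²⁾,
-- is the number dᵢ (with t ≡ A, t′ ≡ A′ and s = z), so ⌊A / p⌋ is a partial sum of the dᵢ.

open import Defs
open import Data.Bool using (if_then_else_)
open import Data.Integer as ℤ using (-[1+_]) renaming (+_ to int)
import Data.Integer.Properties as ℤ
open import Data.Integer.DivMod using (_/ℕ_; a≡a%ℕn+[a/ℕn]*n; n%ℕd<d)
import Data.Integer.Tactic.RingSolver as ℤ-Solver
open import Data.List
  using (List; []; _∷_; length; map; filter; upTo; applyUpTo; _++_; replicate; zipWith; reverse)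
open import Data.List.Properties
  using (map-upTo; map-++; length-applyUpTo; length-++; length-filter; filter-accept; filter-reject;
         filter-all; unfold-reverse)
open import Data.List.Membership.Propositional using (_∈_)
open import Data.List.Membership.Propositional.Properties using (∈-upTo⁺; ∈-upTo⁻)
open import Data.List.Relation.Unary.Any using (here; there)
open import Data.List.Relation.Unary.All using (All; []; _∷_)
open import Data.List.Relation.Unary.Linked using (Linked; []; [-]; _∷_)
open import Data.Maybe using (Maybe; just; nothing)
open import Data.Nat
open import Data.Nat.Divisibility using (divides-refl)
open import Data.Nat.DivMod
open import Data.Nat.ListAction using (sum)
open import Data.Nat.Properties
open import Data.Nat.Tactic.RingSolver using (solve-∀)
open import Data.Product using (∃; ∃₂; _×_; _,_; proj₁; proj₂)
open import Data.Sum using (_⊎_; inj₁; inj₂)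
open import Data.Empty using (⊥; ⊥-elim)
open import Function using (_∘_)
open import Relation.Binary.Definitions using (tri<; tri≈; tri>)
open import Relation.Binary.PropositionalEquality
open import Relation.Nullary using (¬_; yes; no; contradiction)
open import Relation.Nullary.Decidable using (⌊_⌋)

-- Finite sums

-- Two points carry the proof. Cores: every full `p`-segment adds `p` to `A`, so the way in which
-- the last segment ends decides both `A` modulo `p` and the relation between `z` and the type. This
-- leaves four cases (`End`), and in each of them `A % p` plus the core size of λ⁽²⁾ equals the core
-- size of λ plus `δ * p` with `δ ≤ 1`. The carry `δ` is the number e: as `A % p < p`, the core of λ
-- is the smaller one exactly when `δ` is 1. Rims: the segments of λ and of λ⁽²⁾ need not match. A
-- group with one row vanishes when its segment is removed; the first segment of λ⁽²⁾ then starts at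
-- a group further down, which may have grown and may run into groups that the next segment of λ has
-- cut. A plain induction on the segments of λ therefore fails, and the comparison of `A` with `A′`
-- (`Rel-rim`) is proved together with a second one, in which a group lies on top of the remains
-- (`Rel-below`).

sumTo : (ℕ → ℕ) → ℕ → ℕ
sumTo f n = sum (applyUpTo f n)

+-interchange : ∀ a b c d → a + b + (c + d) ≡ a + c + (b + d)
+-interchange = solve-∀

sumTo-cong : ∀ {f g} n → (∀ {r} → r < n → f r ≡ g r) → sumTo f n ≡ sumTo g n
sumTo-cong zero    eq = refl
sumTo-cong (suc n) eq = cong₂ _+_ (eq z<s) (sumTo-cong n (eq ∘ s<s))

sumTo-+ : ∀ f g n → sumTo (λ r → f r + g r) n ≡ sumTo f n + sumTo g n
sumTo-+ f g zero    = refl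
sumTo-+ f g (suc n) rewrite sumTo-+ (f ∘ suc) (g ∘ suc) n =
  +-interchange (f 0) (g 0) (sumTo (f ∘ suc) n) (sumTo (g ∘ suc) n)

sumTo-*ˡ : ∀ c f n → sumTo (λ r → c * f r) n ≡ c * sumTo f n
sumTo-*ˡ c f zero    = sym (*-zeroʳ c)
sumTo-*ˡ c f (suc n) rewrite sumTo-*ˡ c (f ∘ suc) n = sym (*-distribˡ-+ c (f 0) _)

sumTo-zero : ∀ {f} n → (∀ {r} → r < n → f r ≡ 0) → sumTo f n ≡ 0
sumTo-zero zero    eq = refl
sumTo-zero (suc n) eq = cong₂ _+_ (eq z<s) (sumTo-zero n (eq ∘ s<s))

sumTo-snoc : ∀ f n → sumTo f (suc n) ≡ sumTo f n + f n
sumTo-snoc f zero    = +-comm (f 0) 0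
sumTo-snoc f (suc n) = trans (cong (f 0 +_) (sumTo-snoc (f ∘ suc) n)) (sym (+-assoc (f 0) _ _))

sumTo-split : ∀ f m n → sumTo f (m + n) ≡ sumTo f m + sumTo (λ r → f (m + r)) n
sumTo-split f zero    n = refl
sumTo-split f (suc m) n =
  trans (cong (f 0 +_) (sumTo-split (f ∘ suc) m n)) (sym (+-assoc (f 0) _ _))

sumTo-rev : ∀ f n → sumTo (λ r → f (n ∸ suc r)) n ≡ sumTo f n
sumTo-rev f zero    = refl
sumTo-rev f (suc n) =
  trans (cong (f n +_) (sumTo-rev f n)) (trans (+-comm (f n) _) (sym (sumTo-snoc f n)))

sumTo-swap : ∀ (f : ℕ → ℕ → ℕ) n m →
  sumTo (λ r → sumTo (f r) m) n ≡ sumTo (λ x → sumTo (λ r → f r x) n) m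
sumTo-swap f zero    m = sym (sumTo-zero m λ _ → refl)
sumTo-swap f (suc n) m =
  trans (cong (sumTo (f 0) m +_) (sumTo-swap (f ∘ suc) n m)) (sym (sumTo-+ (f 0) _ m))

sumTo-pos : ∀ f n {r} → r < n → f r ≤ sumTo f n
sumTo-pos f (suc n) {zero}  _       = m≤m+n _ _
sumTo-pos f (suc n) {suc r} (s<s q) = ≤-trans (sumTo-pos (f ∘ suc) n q) (m≤n+m _ _)

-- h′ arises from h by deleting the entry at i and inserting v so that it ends up at i + L.
sumTo-move : ∀ (h h′ : ℕ → ℕ) N i L {v} → i + L < N →
  (∀ {r} → r < i → h′ r ≡ h r) →
  (∀ {r} → i ≤ r → r < i + L → h′ r ≡ h (suc r)) →
  h′ (i + L) ≡ v →
  (∀ {r} → i + L < r → h′ r ≡ h r) →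
  sumTo h′ N + h i ≡ sumTo h N + v
sumTo-move h h′ (suc N) zero zero {v} _ _ _ at above
  rewrite at | sumTo-cong {h′ ∘ suc} {h ∘ suc} N (λ _ → above z<s) =
  shuffle v _ (h 0)
  where
  shuffle : ∀ v s x → v + s + x ≡ x + s + v
  shuffle = solve-∀
sumTo-move h h′ (suc N) zero (suc L) {v} (s<s L<N) _ mid at above = begin
  h′ 0 + sumTo (h′ ∘ suc) N + h 0
    ≡⟨ cong (λ x → x + sumTo (h′ ∘ suc) N + h 0) (mid z≤n z<s) ⟩
  h 1 + sumTo (h′ ∘ suc) N + h 0
    ≡⟨ shuffle (h 1) _ _ ⟩
  h 0 + (sumTo (h′ ∘ suc) N + h 1)
    ≡⟨ cong (h 0 +_) (sumTo-move (h ∘ suc) (h′ ∘ suc) N 0 L L<N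
         (λ ()) (λ _ q → mid z≤n (s<s q)) at (above ∘ s<s)) ⟩
  h 0 + (sumTo (h ∘ suc) N + v)
    ≡⟨ +-assoc (h 0) _ v ⟨
  h 0 + sumTo (h ∘ suc) N + v ∎
  where
  open ≡-Reasoning
  shuffle : ∀ a b c → a + b + c ≡ c + (b + a)
  shuffle = solve-∀
sumTo-move h h′ (suc N) (suc i) L {v} (s<s q) below mid at above = begin
  h′ 0 + sumTo (h′ ∘ suc) N + h (suc i)
    ≡⟨ +-assoc (h′ 0) _ _ ⟩
  h′ 0 + (sumTo (h′ ∘ suc) N + h (suc i))
    ≡⟨ cong₂ _+_ (below z<s) (sumTo-move (h ∘ suc) (h′ ∘ suc) N i L q
         (below ∘ s<s) (λ a b → mid (s≤s a) (s<s b)) at (above ∘ s<s)) ⟩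
  h 0 + (sumTo (h ∘ suc) N + v)
    ≡⟨ +-assoc (h 0) _ v ⟨
  h 0 + sumTo (h ∘ suc) N + v ∎
  where open ≡-Reasoning

-- Multiplicities of values

δ : ℕ → ℕ → ℕ
δ zero    zero    = 1
δ zero    (suc _) = 0
δ (suc _) zero    = 0
δ (suc x) (suc y) = δ x y

δ-refl : ∀ x → δ x x ≡ 1
δ-refl zero    = refl
δ-refl (suc x) = δ-refl x

δ-≢ : ∀ {x y} → x ≢ y → δ x y ≡ 0
δ-≢ {zero}  {zero}  ne = contradiction refl ne
δ-≢ {zero}  {suc y} ne = refl
δ-≢ {suc x} {zero}  ne = refl
δ-≢ {suc x} {suc y} ne = δ-≢ (ne ∘ cong suc)

sumTo-δ : ∀ (F : ℕ → ℕ) {b M} → b < M → sumTo (λ x → F x * δ b x) M ≡ F b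
sumTo-δ F {zero} {suc M} _
  rewrite sumTo-zero {λ x → F (suc x) * 0} M (λ {r} _ → *-zeroʳ (F (suc r))) =
  trans (+-identityʳ _) (*-identityʳ (F 0))
sumTo-δ F {suc b} {suc M} (s<s q)
  rewrite *-zeroʳ (F 0) = sumTo-δ (F ∘ suc) q

mult : (ℕ → ℕ) → ℕ → ℕ → ℕ
mult β N x = sumTo (λ r → δ (β r) x) N

-- Double counting: each `F (β r)` is spread over all possible values `x`, and the two sums are
-- exchanged.
sumTo-by-mult : ∀ (F β : ℕ → ℕ) N M → (∀ {r} → r < N → β r < M) →
  sumTo (λ r → F (β r)) N ≡ sumTo (λ x → F x * mult β N x) M
sumTo-by-mult F β N M bound = begin
  sumTo (λ r → F (β r)) N
    ≡⟨ sumTo-cong N (λ r<N → sym (sumTo-δ F (bound r<N))) ⟩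
  sumTo (λ r → sumTo (λ x → F x * δ (β r) x) M) N
    ≡⟨ sumTo-swap (λ r x → F x * δ (β r) x) N M ⟩
  sumTo (λ x → sumTo (λ r → F x * δ (β r) x) N) M
    ≡⟨ sumTo-cong M (λ {x} _ → sumTo-*ˡ (F x) (λ r → δ (β r) x) N) ⟩
  sumTo (λ x → F x * mult β N x) M ∎
  where open ≡-Reasoning

mult-≥1 : ∀ β {N r} → r < N → 1 ≤ mult β N (β r)
mult-≥1 β {N} {r} r<N =
  ≤-trans (≤-reflexive (sym (δ-refl (β r)))) (sumTo-pos (λ s → δ (β s) (β r)) N r<N)

mult-∃ : ∀ β N {x} → 0 < mult β N x → ∃ λ r → r < N × β r ≡ x
mult-∃ β (suc N) {x} q with β 0 ≟ x
... | yes eq = 0 , z<s , eq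
... | no ne rewrite δ-≢ ne with mult-∃ (β ∘ suc) N q
...   | r , r<N , eq = suc r , s<s r<N , eq

InjectiveBelow : (ℕ → ℕ) → ℕ → Set
InjectiveBelow β N = ∀ {r s} → r < N → s < N → β r ≡ β s → r ≡ s

mult-≤1 : ∀ β N {x} → InjectiveBelow β N → mult β N x ≤ 1
mult-≤1 β zero        inj = z≤n
mult-≤1 β (suc N) {x} inj with β 0 ≟ x
... | yes refl rewrite δ-refl (β 0)
    | sumTo-zero {λ r → δ (β (suc r)) (β 0)} N
        (λ r<N → δ-≢ λ eq → 0≢1+n (sym (inj (s<s r<N) z<s eq))) = ≤-refl
... | no ne rewrite δ-≢ ne =
  mult-≤1 (β ∘ suc) N λ r<N s<N eq → suc-injective (inj (s<s r<N) (s<s s<N) eq)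

-- A descending sequence of zeros and ones is a run of ones followed by zeros, so its sum is the
-- length of the run. It is applied to one runner of the abacus, with `u j` the number of beads on
-- level `j`.
descending-01-unique : ∀ (u v : ℕ → ℕ) K →
  (∀ j → u j ≤ 1) → (∀ j → v j ≤ 1) →
  (∀ j → u (suc j) ≤ u j) → (∀ j → v (suc j) ≤ v j) →
  sumTo u K ≡ sumTo v K → ∀ {j} → j < K → u j ≡ v j
descending-01-unique u v (suc K) u≤1 v≤1 u↓ v↓ eq {j} j<K
  with u 0 in u0 | v 0 in v0
... | 0 | 0 = trans (vanishes u u0 u↓ j) (sym (vanishes v v0 v↓ j))
  where
  vanishes : ∀ (w : ℕ → ℕ) → w 0 ≡ 0 → (∀ j → w (suc j) ≤ w j) → ∀ j → w j ≡ 0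
  vanishes w w0 w↓ zero    = w0
  vanishes w w0 w↓ (suc j) = n≤0⇒n≡0 (subst (w (suc j) ≤_) (vanishes w w0 w↓ j) (w↓ j))
... | 0 | suc v′ = contradiction
  (trans (sym eq) (sumTo-zero K λ {r} _ → vanishes r)) (λ ())
  where
  vanishes : ∀ j → u (suc j) ≡ 0
  vanishes zero    = n≤0⇒n≡0 (subst (u 1 ≤_) u0 (u↓ 0))
  vanishes (suc j) = n≤0⇒n≡0 (subst (u (suc (suc j)) ≤_) (vanishes j) (u↓ (suc j)))
... | suc u′ | 0 = contradiction
  (trans eq (sumTo-zero K λ {r} _ → vanishes r)) (λ ())
  where
  vanishes : ∀ j → v (suc j) ≡ 0
  vanishes zero    = n≤0⇒n≡0 (subst (v 1 ≤_) v0 (v↓ 0))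
  vanishes (suc j) = n≤0⇒n≡0 (subst (v (suc (suc j)) ≤_) (vanishes j) (v↓ (suc j)))
... | suc u′ | suc v′
  with refl ← n≤0⇒n≡0 (s≤s⁻¹ (subst (_≤ 1) u0 (u≤1 0)))
     | refl ← n≤0⇒n≡0 (s≤s⁻¹ (subst (_≤ 1) v0 (v≤1 0)))
  with j
... | zero  = trans u0 (sym v0)
... | suc i = descending-01-unique (u ∘ suc) (v ∘ suc) K (u≤1 ∘ suc) (v≤1 ∘ suc)
                (u↓ ∘ suc) (v↓ ∘ suc) (suc-injective eq) (s<s⁻¹ j<K)

-- Flush abaci

module Abacus (p : ℕ) .{{_ : NonZero p}} where

  divMod-unique : ∀ {i} j → i < p → (i + j * p) % p ≡ i × (i + j * p) / p ≡ j
  divMod-unique {i} j i<p =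
    trans ([m+kn]%n≡m%n i j p) (m<n⇒m%n≡m i<p) ,
    (begin
      (i + j * p) / p       ≡⟨ +-distrib-/-∣ʳ i (divides-refl j) ⟩
      i / p + j * p / p     ≡⟨ cong₂ _+_ (m<n⇒m/n≡0 i<p) (m*n/n≡m j p) ⟩
      j                     ∎)
    where
    open ≡-Reasoning

  -- Bead positions of an abacus with N beads, all pushed up.
  record Flush (β : ℕ → ℕ) (N : ℕ) : Set where
    field
      injective : InjectiveBelow β N
      above     : ∀ {r} → r < N → p ≤ β r → ∃ λ s → s < N × β s + p ≡ β r

  open Flush

  -- A bead at `b` sits on runner `b % p` at level `b / p`, and `K` levels hold all beads; counting
  -- a runner level by level is therefore counting residues.
  runner-count : ∀ β N K {i} → i < p → (∀ {r} → r < N → β r < K * p) →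
    sumTo (λ j → mult β N (i + j * p)) K ≡ sumTo (λ r → δ (β r % p) i) N
  runner-count β N K {i} i<p bound =
    trans (sym (sumTo-swap (λ r j → δ (β r) (i + j * p)) N K))
          (sumTo-cong N (λ r<N → on-runner (bound r<N)))
    where
    on-runner : ∀ {b} → b < K * p → sumTo (λ j → δ b (i + j * p)) K ≡ δ (b % p) i
    on-runner {b} b<Kp with b % p ≟ i
    ... | no ne = trans
      (sumTo-zero K λ {j} _ → δ-≢ {b} λ { refl → ne (proj₁ (divMod-unique j i<p)) })
      (sym (δ-≢ ne))
    ... | yes refl = begin
      sumTo (λ j → δ b (b % p + j * p)) K
        ≡⟨ sumTo-cong K (λ {j} _ → level j) ⟩
      sumTo (λ j → 1 * δ (b / p) j) K
        ≡⟨ sumTo-δ (λ _ → 1) (m<n*o⇒m/o<n {b} {K} b<Kp) ⟩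
      1
        ≡⟨ δ-refl (b % p) ⟨
      δ (b % p) (b % p) ∎
      where
      open ≡-Reasoning
      level : ∀ j → δ b (b % p + j * p) ≡ 1 * δ (b / p) j
      level j rewrite *-identityˡ (δ (b / p) j) with b / p ≟ j
      ... | yes refl rewrite sym (m≡m%n+[m/n]*n b p) = trans (δ-refl b) (sym (δ-refl (b / p)))
      ... | no ne = trans
        (δ-≢ λ eq → ne (trans (cong (_/ p) eq) (proj₂ (divMod-unique j i<p))))
        (sym (δ-≢ ne))

  -- A runner without gaps: a bead at `x + p` forces one at `x`, and injectivity keeps
  -- multiplicities at most 1.
  mult-descends : ∀ {β N} → Flush β N → ∀ x → mult β N (x + p) ≤ mult β N x
  mult-descends {β} {N} fl x with mult β N (x + p) in eq
  ... | zero  = z≤n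
  ... | suc k with mult-∃ β N (subst (0 <_) (sym eq) z<s)
  ...   | r , r<N , βr≡x+p
      with above fl r<N (subst (p ≤_) (sym βr≡x+p) (m≤n+m p x))
  ...     | s , s<N , βs+p≡βr
        with refl ← +-cancelʳ-≡ p (β s) x (trans βs+p≡βr βr≡x+p) =
    ≤-trans (subst (_≤ 1) eq (mult-≤1 β N (injective fl))) (mult-≥1 β s<N)

  -- The hypothesis for all `F` encodes equality of the multisets of residues; an indicator function
  -- for `F` yields equally many beads on each runner, and flush runners with equally many beads
  -- coincide. This is the uniqueness of the `p`-core in a form that ignores the order of the beads.
  flush-sum-unique : ∀ {β γ N M} → Flush β N → Flush γ M →
    (∀ F → sumTo (λ r → F (β r % p)) N ≡ sumTo (λ r → F (γ r % p)) M) →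
    sumTo β N ≡ sumTo γ M
  flush-sum-unique {β} {γ} {N} {M} flβ flγ same = begin
    sumTo β N                          ≡⟨ sumTo-by-mult (λ x → x) β N (K * p) boundβ ⟩
    sumTo (λ x → x * mult β N x) (K * p) ≡⟨ sumTo-cong (K * p) (λ {x} x<Kp → cong (x *_) (mult-agree x<Kp)) ⟩
    sumTo (λ x → x * mult γ M x) (K * p) ≡⟨ sumTo-by-mult (λ x → x) γ M (K * p) boundγ ⟨
    sumTo γ M                          ∎
    where
    open ≡-Reasoning
    -- Larger than every single position, so `K` levels hold all beads of both abaci.
    K = suc (sumTo β N + sumTo γ M)
    K≤K*p : K ≤ K * p
    K≤K*p = m≤m*n K p
    boundβ : ∀ {r} → r < N → β r < K * p
    boundβ r<N = ≤-trans (s≤s (≤-trans (sumTo-pos β N r<N) (m≤m+n _ _))) K≤K*p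
    boundγ : ∀ {r} → r < M → γ r < K * p
    boundγ r<M = ≤-trans (s≤s (≤-trans (sumTo-pos γ M r<M) (m≤n+m _ _))) K≤K*p
    down : ∀ {δ N} → Flush δ N → ∀ i j → mult δ N (i + suc j * p) ≤ mult δ N (i + j * p)
    down {δ} {N} fl i j =
      subst (λ x → mult δ N x ≤ mult δ N (i + j * p)) (shift i p (j * p)) (mult-descends fl (i + j * p))
      where
      shift : ∀ i p q → i + q + p ≡ i + (p + q)
      shift = solve-∀
    mult-agree : ∀ {x} → x < K * p → mult β N x ≡ mult γ M x
    mult-agree {x} x<Kp = subst (λ y → mult β N y ≡ mult γ M y) (sym (m≡m%n+[m/n]*n x p))
      (descending-01-unique (λ j → mult β N (x % p + j * p)) (λ j → mult γ M (x % p + j * p)) K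
        (λ _ → mult-≤1 β N (injective flβ)) (λ _ → mult-≤1 γ M (injective flγ))
        (down flβ (x % p)) (down flγ (x % p))
        (trans (runner-count β N K (m%n<n x p) boundβ)
          (trans (same (λ y → δ y (x % p))) (sym (runner-count γ M K (m%n<n x p) boundγ))))
        (m<n*o⇒m/o<n {x} {K} x<Kp))

-- Hook removal on the abacus

Descending : (ℕ → ℕ) → Set
Descending f = ∀ r → f (suc r) ≤ f r

linked-tail : ∀ {x xs} → Linked _≥_ (x ∷ xs) → Linked _≥_ xs
linked-tail [-]      = []
linked-tail (_ ∷ lk) = lk

linked-cons : ∀ {x xs} → part xs 0 ≤ x → Linked _≥_ xs → Linked _≥_ (x ∷ xs)
linked-cons {xs = []}     _ _  = [-]
linked-cons {xs = y ∷ ys} q lk = q ∷ lk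

part-descending : ∀ {ν} → Linked _≥_ ν → Descending (part ν)
part-descending []       r       = z≤n
part-descending [-]      r       = z≤n
part-descending (q ∷ _)  zero    = q
part-descending (_ ∷ lk) (suc r) = part-descending lk r

part-≤-head : ∀ {x xs} → Linked _≥_ (x ∷ xs) → ∀ r → part xs r ≤ x
part-≤-head lk zero    = part-descending lk 0
part-≤-head lk (suc r) = ≤-trans (part-descending (linked-tail lk) r) (part-≤-head lk r)

part-beyond : ∀ ν {r} → length ν ≤ r → part ν r ≡ 0
part-beyond []      _       = refl
part-beyond (x ∷ ν) (s≤s q) = part-beyond ν q

part-pos : ∀ ν {r} → 0 < part ν r → r < length ν
part-pos (x ∷ ν) {zero}  q = z<s
part-pos (x ∷ ν) {suc r} q = s<s (part-pos ν q)

size-sumTo : ∀ ν {N} → length ν ≤ N → size ν ≡ sumTo (part ν) N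
size-sumTo []      {N}     _       = sym (sumTo-zero N λ _ → refl)
size-sumTo (x ∷ ν) {suc N} (s≤s q) = cong (x +_) (size-sumTo ν q)

module _ where
  private
    zeros : ∀ f → Descending f → f 0 ≡ 0 → ∀ r → f r ≡ 0
    zeros f f↓ f0 zero    = f0
    zeros f f↓ f0 (suc r) = n≤0⇒n≡0 (subst (f (suc r) ≤_) (zeros f f↓ f0 r) (f↓ r))

    dropZeros-zeros : ∀ f n → (∀ r → f r ≡ 0) → dropZeros (applyUpTo f n) ≡ []
    dropZeros-zeros f zero    eq = refl
    dropZeros-zeros f (suc n) eq rewrite eq 0 = dropZeros-zeros (f ∘ suc) n (eq ∘ suc)

  -- The zeros of a descending sequence form its tail, so dropping them moves no other entry, and
  -- past the new end `part` is 0 anyway.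
  dropZeros-part : ∀ f n → Descending f → ∀ {r} → r < n →
    part (dropZeros (applyUpTo f n)) r ≡ f r
  dropZeros-part f (suc n) f↓ {r} r<n with f 0 in f0
  ... | zero rewrite dropZeros-zeros (f ∘ suc) n (zeros f f↓ f0 ∘ suc) = sym (zeros f f↓ f0 r)
  ... | suc x with r | r<n
  ...   | zero  | _       = sym f0
  ...   | suc s | s<s s<n = dropZeros-part (f ∘ suc) n (f↓ ∘ suc) s<n

  dropZeros-length : ∀ xs → length (dropZeros xs) ≤ length xs
  dropZeros-length []           = z≤n
  dropZeros-length (zero ∷ xs)  = m≤n⇒m≤1+n (dropZeros-length xs)
  dropZeros-length (suc x ∷ xs) = s≤s (dropZeros-length xs)

  dropZeros-isPartition : ∀ f n → Descending f → IsPartition (dropZeros (applyUpTo f n))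
  dropZeros-isPartition f zero    f↓ = [] , []
  dropZeros-isPartition f (suc n) f↓ with f 0 in f0
  ... | zero rewrite dropZeros-zeros (f ∘ suc) n (zeros f f↓ f0 ∘ suc) = [] , []
  ... | suc x with dropZeros-isPartition (f ∘ suc) n (f↓ ∘ suc)
  ...   | pos , lk = z<s ∷ pos , linked-cons (head≤ n) lk
    where
    head≤ : ∀ n → part (dropZeros (applyUpTo (f ∘ suc) n)) 0 ≤ suc x
    head≤ zero    = z≤n
    head≤ (suc n) = subst₂ _≤_ (sym (dropZeros-part (f ∘ suc) (suc n) (f↓ ∘ suc) z<s)) f0 (f↓ 0)

module Core (p : ℕ) .{{_ : NonZero p}} where

  open Abacus p

  IsHook : Partition → ℕ → ℕ → Set
  IsHook ν i j = i < length ν × j < part ν i × hookLength p ν i j ≡ p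

  NoHook : Partition → Set
  NoHook ν = ∀ {i j} → ¬ IsHook ν i j

  findInRow-just : ∀ ν i js {c} → findInRow p ν i js ≡ just c →
    ∃ λ j → c ≡ (i , j) × j ∈ js × hookLength p ν i j ≡ p
  findInRow-just ν i (j ∷ js) eq with hookLength p ν i j ≟ p
  findInRow-just ν i (j ∷ js) refl | yes h = j , refl , here refl , h
  findInRow-just ν i (j ∷ js) eq | no _ with findInRow-just ν i js eq
  ... | k , e , k∈ , h = k , e , there k∈ , h

  findInRow-nothing : ∀ ν i js → findInRow p ν i js ≡ nothing →
    ∀ {j} → j ∈ js → hookLength p ν i j ≢ p
  findInRow-nothing ν i (j ∷ js) eq j∈ with hookLength p ν i j ≟ p
  findInRow-nothing ν i (j ∷ js) () j∈ | yes _
  findInRow-nothing ν i (j ∷ js) eq (here refl) | no h = h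
  findInRow-nothing ν i (j ∷ js) eq (there k∈)  | no _ = findInRow-nothing ν i js eq k∈

  -- The local functions of findHook and removeHook have no names; unification supplies them.
  mutual
    findHookIn : Partition → List ℕ → Maybe (ℕ × ℕ)
    findHookIn = _

    findHook-unfold : ∀ ν → findHook p ν ≡ findHookIn ν (upTo (length ν))
    findHook-unfold ν with upTo (length ν)
    ... | is = refl

  mutual
    newRow : Partition → ℕ → ℕ → ℕ → ℕ
    newRow = _

    removeHook-unfold : ∀ ν i j →
      removeHook p ν i j ≡ dropZeros (map (newRow ν i j) (upTo (length ν)))
    removeHook-unfold ν i j = refl

  findHookIn-just : ∀ ν is {i j} → findHookIn ν is ≡ just (i , j) →
    i ∈ is × j < part ν i × hookLength p ν i j ≡ p
  findHookIn-just ν (i ∷ is) eq with findInRow p ν i (upTo (part ν i)) in row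
  findHookIn-just ν (i ∷ is) refl | just c with findInRow-just ν i (upTo (part ν i)) row
  ... | j , refl , j∈ , h = here refl , ∈-upTo⁻ j∈ , h
  findHookIn-just ν (i ∷ is) eq | nothing with findHookIn-just ν is eq
  ... | k∈ , rest = there k∈ , rest

  findHookIn-nothing : ∀ ν is → findHookIn ν is ≡ nothing →
    ∀ {i j} → i ∈ is → j < part ν i → hookLength p ν i j ≢ p
  findHookIn-nothing ν (i ∷ is) eq i∈ q with findInRow p ν i (upTo (part ν i)) in row
  findHookIn-nothing ν (i ∷ is) () i∈ q | just _
  findHookIn-nothing ν (i ∷ is) eq (here refl) q | nothing =
    findInRow-nothing ν i (upTo (part ν i)) row (∈-upTo⁺ q)
  findHookIn-nothing ν (i ∷ is) eq (there i∈) q | nothing = findHookIn-nothing ν is eq i∈ q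

  findHook-just : ∀ ν {i j} → findHook p ν ≡ just (i , j) → IsHook ν i j
  findHook-just ν eq with findHookIn-just ν (upTo (length ν)) (trans (sym (findHook-unfold ν)) eq)
  ... | i∈ , q , h = ∈-upTo⁻ i∈ , q , h

  findHook-nothing : ∀ ν → findHook p ν ≡ nothing → NoHook ν
  findHook-nothing ν eq (i< , q , h) =
    findHookIn-nothing ν (upTo (length ν)) (trans (sym (findHook-unfold ν)) eq) (∈-upTo⁺ i<) q h

  colLen-accept : ∀ {x ν j} → j < x → colLen p (x ∷ ν) j ≡ suc (colLen p ν j)
  colLen-accept {j = j} q = cong length (filter-accept (j <?_) q)

  colLen-reject : ∀ {x ν j} → j ≮ x → colLen p (x ∷ ν) j ≡ colLen p ν j
  colLen-reject {j = j} q = cong length (filter-reject (j <?_) q)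

  colLen-< : ∀ {ν j} → Linked _≥_ ν → ∀ r → r < colLen p ν j → j < part ν r
  colLen-< {x ∷ ν} {j} lk r q with j <? x
  ... | no j≮x = contradiction
    (<-≤-trans (colLen-< (linked-tail lk) r (subst (r <_) (colLen-reject j≮x) q)) (part-≤-head lk r))
    j≮x
  colLen-< {x ∷ ν} {j} lk zero    q | yes j<x = j<x
  colLen-< {x ∷ ν} {j} lk (suc r) q | yes j<x =
    colLen-< (linked-tail lk) r (s<s⁻¹ (subst (suc r <_) (colLen-accept j<x) q))

  colLen-> : ∀ {ν j} → Linked _≥_ ν → ∀ r → j < part ν r → r < colLen p ν j
  colLen-> {x ∷ ν} {j} lk r q with j <? x
  colLen-> {x ∷ ν} {j} lk zero    q | no j≮x = contradiction q j≮x
  colLen-> {x ∷ ν} {j} lk (suc r) q | no j≮x = contradiction (<-≤-trans q (part-≤-head lk r)) j≮x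
  colLen-> {x ∷ ν} {j} lk zero    q | yes j<x = subst (0 <_) (sym (colLen-accept j<x)) z<s
  colLen-> {x ∷ ν} {j} lk (suc r) q | yes j<x =
    subst (suc r <_) (sym (colLen-accept j<x)) (s<s (colLen-> (linked-tail lk) r q))

  newRow-below : ∀ ν {i j r} → r < i → newRow ν i j r ≡ part ν r
  newRow-below ν {i} {j} {r} q with r <? i | r <? i + leg p ν i j | r ≟ i + leg p ν i j
  ... | yes _ | _ | _ = refl
  ... | no ¬q | _ | _ = contradiction q ¬q

  newRow-middle : ∀ ν {i j r} → i ≤ r → r < i + leg p ν i j → newRow ν i j r ≡ part ν (suc r) ∸ 1
  newRow-middle ν {i} {j} {r} i≤r q with r <? i | r <? i + leg p ν i j | r ≟ i + leg p ν i j
  ... | yes r<i | _ | _ = contradiction r<i (≤⇒≯ i≤r)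
  ... | no _ | yes _ | _ = refl
  ... | no _ | no ¬q | _ = contradiction q ¬q

  newRow-foot : ∀ ν i j → newRow ν i j (i + leg p ν i j) ≡ j
  newRow-foot ν i j with i + leg p ν i j <? i | i + leg p ν i j <? i + leg p ν i j
                           | i + leg p ν i j ≟ i + leg p ν i j
  ... | yes q | _ | _ = contradiction q (≤⇒≯ (m≤m+n i _))
  ... | no _ | yes q | _ = contradiction q (<-irrefl refl)
  ... | no _ | no _ | yes _ = refl
  ... | no _ | no _ | no ne = contradiction refl ne

  newRow-above : ∀ ν {i j r} → i + leg p ν i j < r → newRow ν i j r ≡ part ν r
  newRow-above ν {i} {j} {r} q with r <? i | r <? i + leg p ν i j | r ≟ i + leg p ν i j
  ... | yes _ | _ | _ = refl
  ... | no _ | yes q′ | _ = contradiction q′ (<-asym q)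
  ... | no _ | no _ | yes refl = contradiction q (<-irrefl refl)
  ... | no _ | no _ | no _ = refl

  -- For `N` the number of parts these are the first-column hook lengths. A larger `N` pads with
  -- zero parts, so that a partition and its core, which may have fewer parts, are compared on
  -- equally many beads.
  beads : ℕ → (ℕ → ℕ) → ℕ → ℕ
  beads N f r = f r + (N ∸ suc r)

  colLen-≤-length : ∀ ν j → colLen p ν j ≤ length ν
  colLen-≤-length ν j = length-filter (j <?_) ν

  module Removal {ν i j N} (lk : Linked _≥_ ν) (ν≤N : length ν ≤ N) (hook : IsHook ν i j) where

    private
      j<νi = proj₁ (proj₂ hook)
      h≡p  = proj₂ (proj₂ hook)
      L    = leg p ν i j

    foot : suc i + L ≡ colLen p ν j
    foot = m+[n∸m]≡n (colLen-> lk i j<νi)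

    foot<length : i + L < length ν
    foot<length = ≤-trans (≤-reflexive foot) (colLen-≤-length ν j)

    foot<N : i + L < N
    foot<N = <-≤-trans foot<length ν≤N

    right-of-j : ∀ {r} → r ≤ i + L → j < part ν r
    right-of-j {r} q = colLen-< lk r (≤-trans (s≤s q) (≤-reflexive foot))

    below-foot : part ν (suc (i + L)) ≤ j
    below-foot = ≮⇒≥ λ q → <-irrefl refl
      (<-≤-trans (colLen-> lk _ q) (≤-reflexive (sym foot)))

    row : ℕ → ℕ
    row = newRow ν i j

    at-or-below : ∀ {r} → i ≤ r → row (suc r) ≤ row r
    at-or-below {r} i≤r with <-cmp r (i + L)
    ... | tri< r<f _ _ = ≤-trans (next (m≤n⇒m<n∨m≡n r<f)) (≤-reflexive (sym (newRow-middle ν i≤r r<f)))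
      where
      next : suc r < i + L ⊎ suc r ≡ i + L → row (suc r) ≤ part ν (suc r) ∸ 1
      next (inj₁ q)  = ≤-trans (≤-reflexive (newRow-middle ν (m≤n⇒m≤1+n i≤r) q))
        (∸-monoˡ-≤ 1 (part-descending lk (suc r)))
      next (inj₂ eq) = ≤-trans (≤-reflexive (trans (cong row eq) (newRow-foot ν i j)))
        (∸-monoˡ-≤ 1 (right-of-j (≤-reflexive eq)))
    ... | tri≈ _ refl _ = ≤-trans (≤-reflexive (newRow-above ν ≤-refl))
      (≤-trans below-foot (≤-reflexive (sym (newRow-foot ν i j))))
    ... | tri> _ _ f<r = subst₂ _≤_ (sym (newRow-above ν (m<n⇒m<1+n f<r))) (sym (newRow-above ν f<r))
      (part-descending lk r)

    row-desc : Descending row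
    row-desc r with <-cmp r i
    ... | tri< r<i _ _ = ≤-trans (next (m≤n⇒m<n∨m≡n r<i)) (≤-reflexive (sym (newRow-below ν r<i)))
      where
      next : suc r < i ⊎ suc r ≡ i → row (suc r) ≤ part ν r
      next (inj₁ sr<i) = ≤-trans (≤-reflexive (newRow-below ν sr<i)) (part-descending lk r)
      next (inj₂ refl) with m≤n⇒m<n∨m≡n (m≤m+n (suc r) L)
      ... | inj₁ q = ≤-trans (≤-reflexive (newRow-middle ν ≤-refl q))
        (≤-trans (m∸n≤m _ 1) (≤-trans (part-descending lk (suc r)) (part-descending lk r)))
      ... | inj₂ eq = ≤-trans (≤-reflexive (trans (cong row eq) (newRow-foot ν i j)))
        (<⇒≤ (right-of-j (m≤n⇒m≤1+n (m≤m+n r L))))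
    ... | tri≈ _ r≡i _ = at-or-below (≤-reflexive (sym r≡i))
    ... | tri> _ _ i<r = at-or-below (<⇒≤ i<r)

    new : Partition
    new = removeHook p ν i j

    private
      new≡ : new ≡ dropZeros (applyUpTo row (length ν))
      new≡ = trans (removeHook-unfold ν i j) (cong dropZeros (map-upTo row (length ν)))

    new-isPartition : IsPartition new
    new-isPartition = subst IsPartition (sym new≡) (dropZeros-isPartition row (length ν) row-desc)

    new-length : length new ≤ length ν
    new-length = subst (λ xs → length xs ≤ length ν) (sym new≡)
      (≤-trans (dropZeros-length (applyUpTo row (length ν))) (≤-reflexive (length-applyUpTo row (length ν))))

    new-part : ∀ r → part new r ≡ row r
    new-part r with r <? length ν
    ... | yes q = trans (cong (λ xs → part xs r) new≡) (dropZeros-part row (length ν) row-desc q)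
    ... | no ¬q = trans (part-beyond new (≤-trans new-length (≮⇒≥ ¬q)))
      (sym (trans (newRow-above ν (<-≤-trans foot<length (≮⇒≥ ¬q))) (part-beyond ν (≮⇒≥ ¬q))))

    target : ℕ
    target = j + (N ∸ suc (i + L))

    -- The two positions differ by arm plus leg plus one, which is the hook length.
    source : beads N (part ν) i ≡ target + p
    source = begin
      part ν i + (N ∸ suc i)
        ≡⟨ cong₂ _+_ (sym (m+[n∸m]≡n j<νi))
             (trans (cong (_∸ suc i) (sym (m+[n∸m]≡n foot<N)))
                    (trans (cong (_∸ suc i) (cong suc (+-assoc i L _))) (m+n∸m≡n (suc i) _))) ⟩
      suc j + d + (L + k)
        ≡⟨ shuffle j d L k ⟩
      j + k + (d + L + 1)
        ≡⟨ cong (j + k +_) h≡p ⟩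
      j + k + p ∎
      where
      open ≡-Reasoning
      d = part ν i ∸ suc j
      k = N ∸ suc (i + L)
      shuffle : ∀ j d L k → suc j + d + (L + k) ≡ j + k + (d + L + 1)
      shuffle = solve-∀

    -- Removing a hook slides one bead from `target + p` to `target`. The beads between row `i` and
    -- the foot keep their positions and merely move up one row: the part drops by 1 and the row
    -- term grows by 1.
    sum-beads : ∀ (F : ℕ → ℕ) →
      sumTo (λ r → F (beads N (part new) r)) N + F (target + p) ≡
      sumTo (λ r → F (beads N (part ν) r)) N + F target
    sum-beads F = subst (λ b → sumTo (λ r → F (beads N (part new) r)) N + F b ≡
                               sumTo (λ r → F (beads N (part ν) r)) N + F target) source
      (sumTo-move (λ r → F (beads N (part ν) r)) (λ r → F (beads N (part new) r)) N i L foot<N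
        (λ {r} q → cong (λ x → F (x + (N ∸ suc r))) (trans (new-part r) (newRow-below ν q)))
        (λ {r} i≤r r<f → cong F (shifted i≤r r<f))
        (cong (λ x → F (x + (N ∸ suc (i + L)))) (trans (new-part (i + L)) (newRow-foot ν i j)))
        (λ {r} q → cong (λ x → F (x + (N ∸ suc r))) (trans (new-part r) (newRow-above ν q))))
      where
      shifted : ∀ {r} → i ≤ r → r < i + L → beads N (part new) r ≡ beads N (part ν) (suc r)
      shifted {r} i≤r r<f = begin
        part new r + (N ∸ suc r)
          ≡⟨ cong₂ _+_ (trans (new-part r) (newRow-middle ν i≤r r<f))
                       (+-∸-assoc 1 {N} {suc (suc r)} (≤-trans (s≤s r<f) foot<N)) ⟩
        part ν (suc r) ∸ 1 + suc (N ∸ suc (suc r))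
          ≡⟨ +-suc _ _ ⟩
        suc (part ν (suc r) ∸ 1) + (N ∸ suc (suc r))
          ≡⟨ cong (_+ (N ∸ suc (suc r))) (m+[n∸m]≡n (≤-trans (s≤s z≤n) (right-of-j r<f))) ⟩
        part ν (suc r) + (N ∸ suc (suc r)) ∎
        where open ≡-Reasoning

    sum-residues : ∀ (F : ℕ → ℕ) →
      sumTo (λ r → F (beads N (part new) r % p)) N ≡ sumTo (λ r → F (beads N (part ν) r % p)) N
    sum-residues F = +-cancelʳ-≡ (F (target % p)) _ _
      (trans (cong (λ x → sumTo (λ r → F (beads N (part new) r % p)) N + F x) (sym ([m+n]%n≡m%n target p)))
             (sum-beads (λ b → F (b % p))))

  sum-bead-positions : ∀ ν {N} → length ν ≤ N →
    sumTo (beads N (part ν)) N ≡ size ν + sumTo (λ r → r) N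
  sum-bead-positions ν {N} ν≤N = trans (sumTo-+ (part ν) (λ r → N ∸ suc r) N)
    (cong₂ _+_ (sym (size-sumTo ν ν≤N)) (sumTo-rev (λ r → r) N))

  removeHook-size : ∀ {ν i j} → Linked _≥_ ν → IsHook ν i j → size ν ≡ size (removeHook p ν i j) + p
  removeHook-size {ν} lk hook = +-cancelʳ-≡ (sumTo (λ r → r) N + target) _ _ (begin
    size ν + (T + target)
      ≡⟨ +-assoc (size ν) T target ⟨
    size ν + T + target
      ≡⟨ cong (_+ target) (sum-bead-positions ν ≤-refl) ⟨
    sumTo (beads N (part ν)) N + target
      ≡⟨ sum-beads (λ b → b) ⟨
    sumTo (beads N (part new)) N + (target + p)
      ≡⟨ cong (_+ (target + p)) (sum-bead-positions new new-length) ⟩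
    size new + T + (target + p)
      ≡⟨ shuffle (size new) T target p ⟩
    size new + p + (T + target) ∎)
    where
    N = length ν
    T = sumTo (λ r → r) N
    open Removal lk ≤-refl hook
    open ≡-Reasoning
    shuffle : ∀ s T x p → s + T + (x + p) ≡ s + p + (T + x)
    shuffle = solve-∀

  -- All that is kept of the search in `coreFuel`: which hooks were chosen is forgotten. The field
  -- `residues` is the invariant of hook removal, with the number `N` of beads fixed throughout.
  record CoreOf (N : ℕ) (ν κ : Partition) : Set where
    field
      isPartition : IsPartition κ
      length≤     : length κ ≤ N
      noHook      : NoHook κ
      hooks       : ∃ λ w → size ν ≡ w * p + size κ
      residues    : ∀ (F : ℕ → ℕ) → sumTo (λ r → F (beads N (part ν) r % p)) N
                                  ≡ sumTo (λ r → F (beads N (part κ) r % p)) N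

  empty-noHook : NoHook []
  empty-noHook (() , _)

  coreFuel-spec : ∀ f {ν N} → IsPartition ν → length ν ≤ N → size ν ≤ f → CoreOf N ν (coreFuel p f ν)
  coreFuel-spec zero {[]} pt ν≤N _ = record
    { isPartition = pt ; length≤ = ν≤N ; noHook = empty-noHook ; hooks = 0 , refl ; residues = λ _ → refl }
  coreFuel-spec zero {x ∷ ν} (x>0 ∷ _ , _) _ q =
    contradiction (≤-trans x>0 (≤-trans (m≤m+n x _) q)) λ ()
  coreFuel-spec (suc f) {ν} {N} pt@(_ , lk) ν≤N q with findHook p ν in found
  ... | nothing = record
    { isPartition = pt ; length≤ = ν≤N ; noHook = findHook-nothing ν found
    ; hooks = 0 , refl ; residues = λ _ → refl }
  ... | just (i , j) = record
    { isPartition = CoreOf.isPartition rec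
    ; length≤     = CoreOf.length≤ rec
    ; noHook      = CoreOf.noHook rec
    ; hooks       = let w , eq = CoreOf.hooks rec in
                    suc w , trans shrink (trans (+-comm _ p) (trans (cong (p +_) eq) (sym (+-assoc p (w * p) _))))
    ; residues    = λ F → trans (sym (sum-residues F)) (CoreOf.residues rec F) }
    where
    hook = findHook-just ν found
    open Removal lk ν≤N hook
    shrink : size ν ≡ size new + p
    shrink = removeHook-size lk hook
    rec = coreFuel-spec f new-isPartition (≤-trans new-length ν≤N)
      (s≤s⁻¹ (≤-trans (≤-trans (m<m+n (size new) (>-nonZero⁻¹ p)) (≤-reflexive (sym shrink))) q))

  core-spec : ∀ {ν} → IsPartition ν → CoreOf (length ν) ν (core p ν)
  core-spec {ν} pt = coreFuel-spec (size ν) pt ≤-refl ≤-refl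

  module _ {κ N} (lk : Linked _≥_ κ) (κ≤N : length κ ≤ N) where

    beads-decrease : ∀ {r} → suc r < N → beads N (part κ) (suc r) < beads N (part κ) r
    beads-decrease {r} q = <-≤-trans
      (+-monoʳ-< (part κ (suc r)) (∸-monoʳ-< (n<1+n (suc r)) q))
      (+-monoˡ-≤ (N ∸ suc r) (part-descending lk r))

    beads-antitone : ∀ {r s} → r < s → s < N → beads N (part κ) s < beads N (part κ) r
    beads-antitone {r} {suc s} r<s s<N with m≤n⇒m<n∨m≡n (s≤s⁻¹ r<s)
    ... | inj₁ q    = <-trans (beads-decrease s<N) (beads-antitone q (<-trans (n<1+n s) s<N))
    ... | inj₂ refl = beads-decrease s<N

    beads-injective : InjectiveBelow (beads N (part κ)) N
    beads-injective {r} {s} r<N s<N eq with <-cmp r s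
    ... | tri< q _ _ = contradiction (sym eq) (<⇒≢ (beads-antitone q s<N))
    ... | tri≈ _ e _ = e
    ... | tri> _ _ q = contradiction eq (<⇒≢ (beads-antitone q r<N))

    -- Walking down from row r, the first row s whose bead lies below the target x = β r − p would
    -- close a hook of length p.
    noHook-above : NoHook κ → ∀ {r} → r < N → p ≤ beads N (part κ) r →
      ∃ λ s → s < N × beads N (part κ) s + p ≡ beads N (part κ) r
    noHook-above none {r} r<N p≤β = walk (N ∸ suc r) r ≤-refl (m+[n∸m]≡n r<N) x<β
      where
      x = beads N (part κ) r ∸ p
      x+p : x + p ≡ beads N (part κ) r
      x+p = m∸n+n≡m p≤β
      x<β : x < beads N (part κ) r
      x<β = subst (x <_) x+p (m<m+n x (>-nonZero⁻¹ p))

      close : ∀ s → r ≤ s → s < N → x < beads N (part κ) s → N ∸ suc s ≤ x →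
        part κ (suc s) + (N ∸ suc s) ≤ x → ⊥
      close s r≤s s<N x<βs gap next = none (part-pos κ (m<n⇒0<n jr) , jr , hook)
        where
        open ≡-Reasoning
        k = N ∸ suc s
        -- The column in which the hook ends: the bead of row `s` lies above `x`, so `j < part κ s`,
        -- while `next` gives `part κ (suc s) ≤ j`. Column `j` thus ends in row `s`, and the hook at
        -- `(r , j)` measures the distance from bead `r` to `x`, that is `p`.
        j = x ∸ k
        j+k : j + k ≡ x
        j+k = m∸n+n≡m gap
        js : j < part κ s
        js = +-cancelʳ-< k j (part κ s) (subst (_< part κ s + k) (sym j+k) x<βs)
        antitone : ∀ {a b} → a ≤ b → part κ b ≤ part κ a
        antitone {a} {zero}  z≤n = ≤-refl
        antitone {a} {suc b} a≤sb with m≤n⇒m<n∨m≡n a≤sb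
        ... | inj₁ q    = ≤-trans (part-descending lk b) (antitone (s≤s⁻¹ q))
        ... | inj₂ refl = ≤-refl
        jr : j < part κ r
        jr = <-≤-trans js (antitone r≤s)
        col≡ : colLen p κ j ≡ suc s
        col≡ = ≤-antisym
          (≮⇒≥ λ q → <⇒≱ (colLen-< lk (suc s) q)
            (+-cancelʳ-≤ k (part κ (suc s)) j (subst (part κ (suc s) + k ≤_) (sym j+k) next)))
          (colLen-> lk s js)
        d = part κ r ∸ suc j
        L = s ∸ r
        hook : d + (colLen p κ j ∸ suc r) + 1 ≡ p
        hook = trans (cong (λ c → d + (c ∸ suc r) + 1) col≡) (+-cancelʳ-≡ x _ _ (begin
          d + L + 1 + x
            ≡⟨ cong (d + L + 1 +_) j+k ⟨
          d + L + 1 + (j + k)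
            ≡⟨ shuffle d L j k ⟩
          suc j + d + (L + k)
            ≡⟨ cong₂ _+_ (m+[n∸m]≡n jr) (sym levels) ⟩
          part κ r + (N ∸ suc r)
            ≡⟨ x+p ⟨
          x + p
            ≡⟨ +-comm x p ⟩
          p + x ∎))
          where
          shuffle : ∀ d L j k → d + L + 1 + (j + k) ≡ suc j + d + (L + k)
          shuffle = solve-∀
          levels : N ∸ suc r ≡ L + k
          levels = begin
            N ∸ suc r
              ≡⟨ cong (_∸ suc r) (m+[n∸m]≡n s<N) ⟨
            s + k ∸ r
              ≡⟨ cong (λ y → y + k ∸ r) (m+[n∸m]≡n r≤s) ⟨
            r + L + k ∸ r
              ≡⟨ cong (_∸ r) (+-assoc r L k) ⟩
            r + (L + k) ∸ r
              ≡⟨ m+n∸m≡n r (L + k) ⟩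
            L + k ∎

      walk : ∀ n s → r ≤ s → suc s + n ≡ N → x < beads N (part κ) s →
        ∃ λ t → t < N × beads N (part κ) t + p ≡ beads N (part κ) r
      -- Row `s` is the last of the `N` rows: there is no next bead, and the part below it counts as
      -- 0.
      walk zero s r≤s eq x<βs rewrite +-identityʳ s = ⊥-elim (close s r≤s (≤-reflexive eq) x<βs
        (subst (_≤ x) (sym k≡0) z≤n)
        (subst (_≤ x) (sym (cong₂ _+_ (part-beyond κ (≤-trans κ≤N (≤-reflexive (sym eq)))) k≡0)) z≤n))
        where
        k≡0 : N ∸ suc s ≡ 0
        k≡0 = m≤n⇒m∸n≡0 (≤-reflexive (sym eq))
      walk (suc n) s r≤s eq x<βs with <-cmp x (beads N (part κ) (suc s))
      ... | tri< q _ _ = walk n (suc s) (m≤n⇒m≤1+n r≤s) (trans (sym (+-suc (suc s) n)) eq) q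
      ... | tri≈ _ e _ = suc s , ss<N , trans (cong (_+ p) (sym e)) x+p
        where
        ss<N : suc s < N
        ss<N = ≤-trans (≤-trans (m≤m+n (suc (suc s)) n) (≤-reflexive (sym (+-suc (suc s) n)))) (≤-reflexive eq)
      ... | tri> _ _ q = ⊥-elim (close s r≤s (<-trans (n<1+n s) ss<N) x<βs
        (≤-trans (≤-reflexive k≡) (≤-trans (s≤s (m≤n+m _ _)) q))
        (≤-trans (≤-reflexive (trans (cong (part κ (suc s) +_) k≡) (+-suc _ _))) q))
        where
        ss<N : suc s < N
        ss<N = ≤-trans (≤-trans (m≤m+n (suc (suc s)) n) (≤-reflexive (sym (+-suc (suc s) n)))) (≤-reflexive eq)
        k≡ : N ∸ suc s ≡ suc (N ∸ suc (suc s))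
        k≡ = +-∸-assoc 1 ss<N

    noHook-flush : NoHook κ → Flush (beads N (part κ)) N
    noHook-flush none = record { injective = beads-injective ; above = noHook-above none }

-- Sizes of p-cores

module Residues (p : ℕ) .{{_ : NonZero p}} where

  open Abacus p
  open Core p

  infix 4 _≈_
  _≈_ : ℕ → ℕ → Set
  x ≈ y = x % p ≡ y % p

  0%p : 0 % p ≡ 0
  0%p = m<n⇒m%n≡m (>-nonZero⁻¹ p)

  ≈-intro : ∀ {x y} i j → x + i * p ≡ y + j * p → x ≈ y
  ≈-intro {x} {y} i j eq =
    trans (sym ([m+kn]%n≡m%n x i p)) (trans (cong (_% p) eq) ([m+kn]%n≡m%n y j p))

  -- Multiples of `p` on both sides avoid subtraction in ℕ.
  ≈-elim : ∀ {x y} → x ≈ y → ∃₂ λ i j → x + i * p ≡ y + j * p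
  ≈-elim {x} {y} eq = y / p , x / p , (begin
    x + y / p * p                   ≡⟨ cong (_+ y / p * p) (m≡m%n+[m/n]*n x p) ⟩
    x % p + x / p * p + y / p * p   ≡⟨ cong (λ r → r + x / p * p + y / p * p) eq ⟩
    y % p + x / p * p + y / p * p   ≡⟨ shuffle (y % p) _ _ ⟩
    y % p + y / p * p + x / p * p   ≡⟨ cong (_+ x / p * p) (m≡m%n+[m/n]*n y p) ⟨
    y + x / p * p                   ∎)
    where
    open ≡-Reasoning
    shuffle : ∀ a b c → a + b + c ≡ a + c + b
    shuffle = solve-∀

  ≈-+ʳ : ∀ {x y} z → x ≈ y → x + z ≈ y + z
  ≈-+ʳ {x} {y} z eq with ≈-elim eq
  ... | i , j , e = ≈-intro i j (trans (shuffle x z _) (trans (cong (_+ z) e) (sym (shuffle y z _))))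
    where
    shuffle : ∀ a b c → a + b + c ≡ a + c + b
    shuffle = solve-∀

  ≈-cancelʳ : ∀ {x y} z → x + z ≈ y + z → x ≈ y
  ≈-cancelʳ {x} {y} z eq with ≈-elim eq
  ... | i , j , e = ≈-intro i j (+-cancelʳ-≡ z _ _ (trans (shuffle x _ z) (trans e (shuffle y z _))))
    where
    shuffle : ∀ a b c → a + b + c ≡ a + c + b
    shuffle = solve-∀

  ≈-+ˡ : ∀ z {x y} → x ≈ y → z + x ≈ z + y
  ≈-+ˡ z {x} {y} eq = subst₂ _≈_ (+-comm x z) (+-comm y z) (≈-+ʳ z eq)

  ≈-pred : ∀ {x y} → suc x ≈ suc y → x ≈ y
  ≈-pred {x} {y} eq = ≈-cancelʳ 1 (subst₂ _≈_ (+-comm 1 x) (+-comm 1 y) eq)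

  ≈-> : ∀ {x y} → x ≈ y → y < x → ∃ λ q → x ≡ y + suc q * p
  ≈-> {x} {y} eq y<x with ≈-elim eq
  ... | i , j , e with j ≤? i
  ...   | yes j≤i = contradiction (+-mono-<-≤ y<x (*-monoˡ-≤ p j≤i)) (<-irrefl (sym e))
  ...   | no j≰i with m<n⇒m<1+n (≰⇒> j≰i) | m+[n∸m]≡n (≰⇒> j≰i)
  ...     | _ | si+q≡j = j ∸ suc i , +-cancelʳ-≡ (i * p) _ _ (trans e (begin
    y + j * p                    ≡⟨ cong (λ k → y + k * p) si+q≡j ⟨
    y + (suc i + q) * p          ≡⟨ shuffle y i q p ⟩
    y + suc q * p + i * p        ∎))
    where
    open ≡-Reasoning
    q = j ∸ suc i
    shuffle : ∀ y i q p → y + (suc i + q) * p ≡ y + suc q * p + i * p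
    shuffle = solve-∀

  S : ℕ → ℕ
  S = sumTo (_% p)

  S-suc : ∀ n → S (suc n) ≡ S n + n % p
  S-suc = sumTo-snoc (_% p)

  S-+p : ∀ n → S (p + n) ≡ S p + S n
  S-+p n = trans (sumTo-split (_% p) p n)
    (cong (S p +_) (sumTo-cong n λ {r} _ → trans (cong (_% p) (+-comm p r)) ([m+n]%n≡m%n r p)))

  S-multiple : ∀ k → S (k * p) ≡ k * S p
  S-multiple zero    = refl
  S-multiple (suc k) = trans (S-+p (k * p)) (cong (S p +_) (S-multiple k))

  -- The two remainders plus one form a positive multiple of `p` below `2 * p`.
  complement-% : ∀ {u v} k → suc (u + v) ≡ k * p → u % p + v % p ≡ p ∸ 1
  complement-% {u} {v} (suc k) eq = suc-injective (trans (sym r≡) (sym (m+[n∸m]≡n (>-nonZero⁻¹ p))))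
    where
    r = suc (u % p + v % p)
    r≤ : r ≤ p + (p ∸ 1)
    r≤ = ≤-trans (+-monoʳ-≤ (suc (u % p)) (m<n⇒m≤n∸1 (m%n<n v p))) (+-monoˡ-≤ (p ∸ 1) (m%n<n u p))
      where
      m<n⇒m≤n∸1 : ∀ {m n} → m < n → m ≤ n ∸ 1
      m<n⇒m≤n∸1 (s≤s q) = q
    r≈0 : r ≈ 0
    r≈0 = ≈-intro (u / p + v / p) (suc k) (trans
      (trans (shuffle (u % p) (v % p) (u / p) (v / p) p)
             (cong₂ (λ a b → suc (a + b)) (sym (m≡m%n+[m/n]*n u p)) (sym (m≡m%n+[m/n]*n v p)))) eq)
      where
      shuffle : ∀ a b c d p → suc (a + b) + (c + d) * p ≡ suc (a + c * p + (b + d * p))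
      shuffle = solve-∀
    r≡ : p ≡ r
    r≡ with ≈-> r≈0 z<s
    ... | zero  , e = sym (trans e (+-identityʳ p))
    ... | suc q , e = contradiction (≤-trans (≤-reflexive (sym e)) r≤) (<⇒≱ (begin-strict
      p + (p ∸ 1)       <⟨ +-monoʳ-< p (≤-reflexive (m+[n∸m]≡n (>-nonZero⁻¹ p))) ⟩
      p + p             ≤⟨ +-monoʳ-≤ p (m≤m+n p (q * p)) ⟩
      p + (p + q * p)   ∎))
      where open ≤-Reasoning

  -- The summands of `S (k * p)` from index `u` on, read backwards, are `p ∸ 1` minus the summands
  -- of `S v`, by `complement-%`.
  S-reflect : ∀ {u v} k → u + v ≡ k * p → S u + v * (p ∸ 1) ≡ k * S p + S v
  S-reflect {u} {zero} k eq = trans (+-identityʳ (S u))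
    (trans (cong S (trans (sym (+-identityʳ u)) eq)) (trans (S-multiple k) (sym (+-identityʳ _))))
  S-reflect {u} {suc v} k eq = +-cancelˡ-≡ (u % p) _ _ (begin
    u % p + (S u + suc v * (p ∸ 1))
      ≡⟨ shuffle₁ (u % p) (S u) (p ∸ 1) (v * (p ∸ 1)) ⟩
    S u + u % p + v * (p ∸ 1) + (p ∸ 1)
      ≡⟨ cong₂ _+_ (trans (cong (_+ v * (p ∸ 1)) (sym (S-suc u)))
                          (S-reflect {suc u} {v} k (trans (sym (+-suc u v)) eq)))
                   (sym (complement-% {u} {v} k (trans (sym (+-suc u v)) eq))) ⟩
    k * S p + S v + (u % p + v % p)
      ≡⟨ shuffle₂ (k * S p) (S v) (u % p) (v % p) ⟩
    u % p + (k * S p + (S v + v % p))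
      ≡⟨ cong (λ s → u % p + (k * S p + s)) (S-suc v) ⟨
    u % p + (k * S p + S (suc v)) ∎)
    where
    open ≡-Reasoning
    shuffle₁ : ∀ a s m w → a + (s + (m + w)) ≡ s + a + w + m
    shuffle₁ = solve-∀
    shuffle₂ : ∀ k s a b → k + s + (a + b) ≡ a + (k + (s + b))
    shuffle₂ = solve-∀

  -- c is the size of the p-core whose first-column hook lengths are congruent to s, s + 1, …, s + n − 1.
  CoreSize : ℕ → ℕ → ℕ → Set
  CoreSize c n s = c + (S n + S s) ≡ S (n + s)

  CoreSize-unique : ∀ {c c′ n s} → CoreSize c n s → CoreSize c′ n s → c ≡ c′
  CoreSize-unique {n = n} {s} eq eq′ = +-cancelʳ-≡ (S n + S s) _ _ (trans eq (sym eq′))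

  +-% : ∀ n s → ∃ λ δ → δ ≤ 1 × n % p + s % p ≡ (n + s) % p + δ * p
  +-% n s = r / p , s≤s⁻¹ (m<n*o⇒m/o<n {r} {2} r<2p) , (begin
    r                         ≡⟨ m≡m%n+[m/n]*n r p ⟩
    r % p + r / p * p         ≡⟨ cong (_+ r / p * p) (sym (%-distribˡ-+ n s p)) ⟩
    (n + s) % p + r / p * p   ∎)
    where
    open ≡-Reasoning
    r = n % p + s % p
    r<2p : r < 2 * p
    r<2p = <-≤-trans (+-mono-< (m%n<n n p) (m%n<n s p)) (≤-reflexive (cong (p +_) (sym (+-identityʳ p))))

  -- Subtracting the two equations leaves `(n + s) % p + suc (n + s) % p` less `n % p + s % p`. The
  -- `δ` is the carry in the sum of the last two remainders.
  CoreSize-step : ∀ {c c′ n s} → CoreSize c (suc n) (suc s) → CoreSize c′ n s →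
    ∃ λ δ → δ ≤ 1 × suc (n + s) % p + c′ ≡ c + δ * p
  CoreSize-step {c} {c′} {n} {s} eq eq′ with +-% n s
  ... | δ , δ≤1 , carry = δ , δ≤1 , +-cancelʳ-≡ ((n + s) % p + (S n + S s)) _ _ (begin
    suc (n + s) % p + c′ + ((n + s) % p + (S n + S s))
      ≡⟨ shuffle₁ (suc (n + s) % p) c′ ((n + s) % p) (S n + S s) ⟩
    c′ + (S n + S s) + (n + s) % p + suc (n + s) % p
      ≡⟨ cong (λ x → x + (n + s) % p + suc (n + s) % p) eq′ ⟩
    S (n + s) + (n + s) % p + suc (n + s) % p
      ≡⟨ cong (_+ suc (n + s) % p) (S-suc (n + s)) ⟨
    S (suc (n + s)) + suc (n + s) % p
      ≡⟨ S-suc (suc (n + s)) ⟨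
    S (suc (suc (n + s)))
      ≡⟨ cong (S ∘ suc) (+-suc n s) ⟨
    S (suc n + suc s)
      ≡⟨ eq ⟨
    c + (S (suc n) + S (suc s))
      ≡⟨ cong₂ (λ a b → c + (a + b)) (S-suc n) (S-suc s) ⟩
    c + (S n + n % p + (S s + s % p))
      ≡⟨ shuffle₂ c (S n) (n % p) (S s) (s % p) ⟩
    c + (n % p + s % p + (S n + S s))
      ≡⟨ cong (λ x → c + (x + (S n + S s))) carry ⟩
    c + ((n + s) % p + δ * p + (S n + S s))
      ≡⟨ shuffle₃ c ((n + s) % p) (δ * p) (S n + S s) ⟩
    c + δ * p + ((n + s) % p + (S n + S s)) ∎)
    where
    open ≡-Reasoning
    shuffle₁ : ∀ a b c d → a + b + (c + d) ≡ b + d + c + a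
    shuffle₁ = solve-∀
    shuffle₂ : ∀ c a b d e → c + (a + b + (d + e)) ≡ c + (b + e + (a + d))
    shuffle₂ = solve-∀
    shuffle₃ : ∀ a b c d → a + (b + c + d) ≡ a + c + (b + d)
    shuffle₃ = solve-∀

  -- Modulo `p` this is the symmetry that sends `(n , s)` to `(−s , −n)`. `S-reflect` is applied to
  -- `n′`, to `s′` and to their sum; the linear terms and the copies of `S p` then cancel.
  CoreSize-reflect : ∀ {c n s n′ s′} k → n′ + s ≡ k * p → s′ + n ≡ k * p →
    CoreSize c n s → CoreSize c n′ s′
  CoreSize-reflect {c} {n} {s} {n′} {s′} k en es eq = +-cancelʳ-≡ ((n + s) * m) _ _ (begin
    c + (S n′ + S s′) + (n + s) * m
      ≡⟨ shuffle₁ c (S n′) (S s′) n s m ⟩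
    c + (S n′ + s * m + (S s′ + n * m))
      ≡⟨ cong₂ (λ x y → c + (x + y)) (S-reflect {n′} {s} k en) (S-reflect {s′} {n} k es) ⟩
    c + (k * S p + S s + (k * S p + S n))
      ≡⟨ shuffle₂ c k (S p) (S s) (S n) ⟩
    (k + k) * S p + (c + (S n + S s))
      ≡⟨ cong ((k + k) * S p +_) eq ⟩
    (k + k) * S p + S (n + s)
      ≡⟨ S-reflect {n′ + s′} {n + s} (k + k) double ⟨
    S (n′ + s′) + (n + s) * m ∎)
    where
    open ≡-Reasoning
    m = p ∸ 1
    double : n′ + s′ + (n + s) ≡ (k + k) * p
    double = trans (shuffle n′ s′ n s) (trans (cong₂ _+_ en es) (sym (*-distribʳ-+ p k k)))
      where
      shuffle : ∀ a b c d → a + b + (c + d) ≡ a + d + (b + c)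
      shuffle = solve-∀
    shuffle₁ : ∀ c a b n s m → c + (a + b) + (n + s) * m ≡ c + (a + s * m + (b + n * m))
    shuffle₁ = solve-∀
    shuffle₂ : ∀ c k t s n → c + (k * t + s + (k * t + n)) ≡ (k + k) * t + (c + (n + s))
    shuffle₂ = solve-∀

  module _ (c n : ℕ) where

    -- Consecutive residues visit all runners in turn, so the bead number `i`, of residue `c + i`,
    -- has `i / p` beads before it on its runner and is pushed up to level `i / p`.
    filled : ℕ → ℕ
    filled i = (c + i) % p + i / p * p

    filled-% : ∀ i → filled i % p ≡ (c + i) % p
    filled-% i = proj₁ (divMod-unique (i / p) (m%n<n (c + i) p))

    filled-/ : ∀ i → filled i / p ≡ i / p
    filled-/ i = proj₂ (divMod-unique (i / p) (m%n<n (c + i) p))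

    filled-flush : Flush filled n
    filled-flush = record { injective = λ _ _ → injective ; above = above }
      where
      injective : ∀ {i j} → filled i ≡ filled j → i ≡ j
      injective {i} {j} eq = trans (m≡m%n+[m/n]*n i p)
        (trans (cong₂ (λ r q → r + q * p) same% same/) (sym (m≡m%n+[m/n]*n j p)))
        where
        same/ : i / p ≡ j / p
        same/ = trans (sym (filled-/ i)) (trans (cong (_/ p) eq) (filled-/ j))
        same% : i ≈ j
        same% = ≈-cancelʳ c (subst₂ _≈_ (+-comm c i) (+-comm c j)
          (trans (sym (filled-% i)) (trans (cong (_% p) eq) (filled-% j))))
      above : ∀ {i} → i < n → p ≤ filled i → ∃ λ j → j < n × filled j + p ≡ filled i
      above {i} i<n p≤ = i ∸ p , ≤-<-trans (m∸n≤m i p) i<n , (begin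
        (c + j) % p + j / p * p + p
          ≡⟨ +-assoc ((c + j) % p) _ p ⟩
        (c + j) % p + (j / p * p + p)
          ≡⟨ cong₂ _+_ (sym res) (trans (+-comm _ p) (cong (_* p) (sym lev))) ⟩
        (c + i) % p + i / p * p ∎)
        where
        open ≡-Reasoning
        p≤i : p ≤ i
        p≤i with p ≤? i
        ... | yes q = q
        ... | no ¬q = contradiction p≤ (<⇒≱ (≤-<-trans
            (≤-reflexive (trans (cong (λ x → (c + i) % p + x * p) (m<n⇒m/n≡0 (≰⇒> ¬q))) (+-identityʳ _)))
            (m%n<n (c + i) p)))
        j = i ∸ p
        j+p : j + p ≡ i
        j+p = m∸n+n≡m p≤i
        res : c + i ≈ c + j
        res = trans (cong (λ x → (c + x) % p) (sym j+p))
          (trans (cong (_% p) (sym (+-assoc c j p))) ([m+n]%n≡m%n (c + j) p))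
        lev : i / p ≡ suc (j / p)
        lev = m/n≡1+[m∸n]/n p≤i

    -- The level part `E` occurs in the sum of the positions and in the sum of the indices, so only
    -- remainders survive: `S (c + n)` less `S c` on one side, `S n` on the other.
    filled-sum : ∀ {size} → sumTo filled n ≡ size + sumTo (λ r → r) n → CoreSize size n c
    filled-sum {size} eq = +-cancelʳ-≡ E _ _ (begin
      size + (S n + S c) + E
        ≡⟨ shuffle size (S n) (S c) E ⟩
      size + (S n + E) + S c
        ≡⟨ cong (λ x → size + x + S c) (trans (sumTo-cong n λ {r} _ → m≡m%n+[m/n]*n r p) (sumTo-+ (_% p) _ n)) ⟨
      size + sumTo (λ r → r) n + S c
        ≡⟨ cong (_+ S c) eq ⟨
      sumTo filled n + S c
        ≡⟨ cong (_+ S c) (sumTo-+ (λ i → (c + i) % p) _ n) ⟩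
      sumTo (λ i → (c + i) % p) n + E + S c
        ≡⟨ shuffle′ (sumTo (λ i → (c + i) % p) n) E (S c) ⟩
      S c + sumTo (λ i → (c + i) % p) n + E
        ≡⟨ cong (_+ E) (sumTo-split (_% p) c n) ⟨
      S (c + n) + E
        ≡⟨ cong (λ x → S x + E) (+-comm c n) ⟩
      S (n + c) + E ∎)
      where
      open ≡-Reasoning
      E = sumTo (λ r → r / p * p) n
      shuffle : ∀ a b c d → a + (b + c) + d ≡ a + (b + d) + c
      shuffle = solve-∀
      shuffle′ : ∀ a b c → a + b + c ≡ c + a + b
      shuffle′ = solve-∀

  core-size : ∀ {ν} c → IsPartition ν →
    (∀ F → sumTo (λ r → F (beads (length ν) (part ν) r % p)) (length ν)
         ≡ sumTo (λ i → F ((c + i) % p)) (length ν)) →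
    CoreSize (size (core p ν)) (length ν) c
  core-size {ν} c pt residues = filled-sum c n (begin
    sumTo (filled c n) n
      ≡⟨ flush-sum-unique (filled-flush c n) (noHook-flush (proj₂ K.isPartition) K.length≤ K.noHook)
           (λ F → trans (sumTo-cong n λ {i} _ → cong F (filled-% c n i)) (trans (sym (residues F)) (K.residues F))) ⟩
    sumTo (beads n (part κ)) n
      ≡⟨ sum-bead-positions κ K.length≤ ⟩
    size κ + sumTo (λ r → r) n ∎)
    where
    open ≡-Reasoning
    n = length ν
    κ = core p ν
    module K = CoreOf (core-spec pt)

-- JS-partitions and their p-rims

Groups : Set
Groups = List (ℕ × ℕ)

expand : Groups → Partition
expand []             = []
expand ((l , a) ∷ gs) = replicate a l ++ expand gs

-- The rim in the last row of a group reaches down to the column given by the next part, and to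
-- column 1 if there is none; the default 1 lets one inequality cover both situations.
head₁ : Partition → ℕ
head₁ []      = 1
head₁ (x ∷ _) = x

part-replicate-< : ∀ {l} a ν {r} → r < a → part (replicate a l ++ ν) r ≡ l
part-replicate-< (suc a) ν {zero}  _       = refl
part-replicate-< (suc a) ν {suc r} (s<s q) = part-replicate-< a ν q

part-replicate-+ : ∀ {l} a ν r → part (replicate a l ++ ν) (a + r) ≡ part ν r
part-replicate-+ zero    ν r = refl
part-replicate-+ (suc a) ν r = part-replicate-+ a ν r

length-replicate-++ : ∀ {l} a (ν : Partition) → length (replicate a l ++ ν) ≡ a + length ν
length-replicate-++ zero    ν = refl
length-replicate-++ (suc a) ν = cong suc (length-replicate-++ a ν)

size-replicate-++ : ∀ {l} a ν → size (replicate a l ++ ν) ≡ a * l + size ν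
size-replicate-++ zero    ν = refl
size-replicate-++ {l} (suc a) ν = trans (cong (l +_) (size-replicate-++ a ν)) (sym (+-assoc l (a * l) _))

module Chains (p : ℕ) .{{_ : NonZero p}} where

  open Core p using (beads)
  open Residues p

  -- Groups of a JS-partition of type c all of whose parts are < u.  Consecutive groups satisfy
  -- l + a + a′ ≈ l′, so the tail is again such a list, of type l + a.
  data JS : ℕ → ℕ → Groups → Set where
    []   : ∀ {u c} → JS u c []
    cons : ∀ {u c l a gs} → suc l < u → suc a < p → c + suc a ≈ suc l →
           JS (suc l) (suc l + suc a) gs → JS u c ((suc l , suc a) ∷ gs)

  JS-weaken : ∀ {u u′ c c′ gs} → u ≤ u′ → c ≈ c′ → JS u c gs → JS u′ c′ gs
  JS-weaken u≤u′ c≈c′ [] = []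
  JS-weaken u≤u′ c≈c′ (cons {a = a} l<u a<p c≈l js) =
    cons (<-≤-trans l<u u≤u′) a<p (trans (≈-+ʳ (suc a) (sym c≈c′)) c≈l) js

  JS-rebound : ∀ {u u′ c gs} → head₁ (expand gs) < u′ → JS u c gs → JS u′ c gs
  JS-rebound q [] = []
  JS-rebound q (cons l<u a<p c≈l js) = cons q a<p c≈l js

  JS-bound : ∀ {u c gs} → JS (suc u) c gs → part (expand gs) 0 ≤ u
  JS-bound []               = z≤n
  JS-bound (cons l<u _ _ _) = s≤s⁻¹ l<u

  private
    replicate-isPartition : ∀ {l ν} a → IsPartition ν → part ν 0 ≤ suc l →
      IsPartition (replicate a (suc l) ++ ν) × part (replicate a (suc l) ++ ν) 0 ≤ suc l
    replicate-isPartition zero    pt h = pt , h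
    replicate-isPartition (suc a) pt h with replicate-isPartition a pt h
    ... | (pos , lk) , h′ = (z<s ∷ pos , linked-cons h′ lk) , ≤-refl

  JS-isPartition : ∀ {u c gs} → JS u c gs → IsPartition (expand gs)
  JS-isPartition [] = [] , []
  JS-isPartition (cons {a = a} _ _ _ js) =
    proj₁ (replicate-isPartition (suc a) (JS-isPartition js) (m≤n⇒m≤1+n (JS-bound js)))

  -- With `n` parts below the top group, its lowest bead is `suc l + n ≈ c + N`. The tail has type
  -- `suc l + A`, so its residues start at `suc l + A + n ≈ c + N + A`, just where those of the top
  -- group stop.
  JS-residues : ∀ {u c gs} → JS u c gs → let ν = expand gs; n = length ν in ∀ (F : ℕ → ℕ) →
    sumTo (λ r → F (beads n (part ν) r % p)) n ≡ sumTo (λ i → F ((c + n + i) % p)) n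
  JS-residues [] F = refl
  JS-residues {c = c} (cons {l = l} {a} {gs} _ _ c≈l js) F =
     subst (λ M → sumTo (G M ν) M ≡ sumTo (λ i → F ((c + M + i) % p)) M)
        (sym (length-replicate-++ A μ)) (begin
    sumTo (G N ν) N
      ≡⟨ sumTo-split (G N ν) A n ⟩
    sumTo (G N ν) A + sumTo (λ r → G N ν (A + r)) n
      ≡⟨ cong₂ _+_ top bottom ⟩
    sumTo (λ i → F ((c + N + i) % p)) A + sumTo (λ i → F ((c + N + (A + i)) % p)) n
      ≡⟨ sumTo-split (λ i → F ((c + N + i) % p)) A n ⟨
    sumTo (λ i → F ((c + N + i) % p)) N ∎)
    where
    open ≡-Reasoning
    A = suc a
    μ = expand gs
    ν = replicate A (suc l) ++ μ
    n = length μ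
    N = A + n
    G : ℕ → Partition → ℕ → ℕ
    G N ν r = F (beads N (part ν) r % p)
    start : suc l + n ≈ c + N
    start = trans (≈-+ʳ n (sym c≈l)) (cong (_% p) (+-assoc c A n))
    level : ∀ {r} → r < A → beads N (part ν) r ≡ suc l + n + (A ∸ suc r)
    level {r} r<A = begin
      part ν r + (N ∸ suc r)       ≡⟨ cong₂ _+_ (part-replicate-< A μ r<A) (cong (_∸ suc r) (+-comm A n)) ⟩
      suc l + (n + A ∸ suc r)      ≡⟨ cong (suc l +_) (+-∸-assoc n r<A) ⟩
      suc l + (n + (A ∸ suc r))    ≡⟨ +-assoc (suc l) n (A ∸ suc r) ⟨
      suc l + n + (A ∸ suc r)      ∎
    top : sumTo (G N ν) A ≡ sumTo (λ i → F ((c + N + i) % p)) A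
    top = begin
      sumTo (G N ν) A
        ≡⟨ sumTo-cong A (λ q → cong (λ x → F (x % p)) (level q)) ⟩
      sumTo (λ r → F ((suc l + n + (A ∸ suc r)) % p)) A
        ≡⟨ sumTo-rev (λ i → F ((suc l + n + i) % p)) A ⟩
      sumTo (λ i → F ((suc l + n + i) % p)) A
        ≡⟨ sumTo-cong A (λ {i} _ → cong F (≈-+ʳ i start)) ⟩
      sumTo (λ i → F ((c + N + i) % p)) A ∎
    bottom : sumTo (λ r → G N ν (A + r)) n ≡ sumTo (λ i → F ((c + N + (A + i)) % p)) n
    bottom = begin
      sumTo (λ r → G N ν (A + r)) n
        ≡⟨ sumTo-cong n (λ {r} _ → cong (λ x → F (x % p)) (cong₂ _+_ (part-replicate-+ A μ r)
             (trans (cong (N ∸_) (sym (+-suc A r))) ([m+n]∸[m+o]≡n∸o A n (suc r))))) ⟩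
      sumTo (G n μ) n
        ≡⟨ JS-residues js F ⟩
      sumTo (λ i → F ((suc l + A + n + i) % p)) n
        ≡⟨ sumTo-cong n (λ {i} _ → cong F (trans (cong (_% p) (shuffle (suc l) A n i))
             (≈-+ʳ (A + i) start))) ⟩
      sumTo (λ i → F ((c + N + (A + i)) % p)) n ∎
      where
      shuffle : ∀ l a n i → l + a + n + i ≡ l + n + (a + i)
      shuffle = solve-∀

  JS-core-size : ∀ {u c gs} → JS u c gs →
    CoreSize (size (core p (expand gs))) (length (expand gs)) (c + length (expand gs))
  JS-core-size {c = c} {gs} js = core-size (c + length (expand gs)) (JS-isPartition js) (JS-residues js)

  -- Rows of the p-rim of a list of groups

  rimCount : ℕ → Partition → ℕ
  rimCount l []      = l
  rimCount l (y ∷ _) = suc (l ∸ y)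

  rimCounts-block : ∀ l a ν →
    rimCounts p (replicate (suc a) l ++ ν) ≡ replicate a 1 ++ rimCount l ν ∷ rimCounts p ν
  rimCounts-block l zero    []      = refl
  rimCounts-block l zero    (y ∷ ν) = refl
  rimCounts-block l (suc a) ν       = cong₂ _∷_ (cong suc (n∸n≡0 l)) (rimCounts-block l a ν)

  segTake-≤ : ∀ {b c} cs → b ≤ c → segTake p b (c ∷ cs) ≡ b ∷ segTake p p cs
  segTake-≤ {b} {c} cs q with b ≤? c
  ... | yes _ = refl
  ... | no ¬q = contradiction q ¬q

  segTake-> : ∀ {b c} cs → c < b → segTake p b (c ∷ cs) ≡ c ∷ segTake p (b ∸ c) cs
  segTake-> {b} {c} cs q with b ≤? c
  ... | yes ¬q = contradiction q (≤⇒≯ ¬q)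
  ... | no _   = refl

  segTake-ones : ∀ {b} a cs → a < b →
    segTake p b (replicate a 1 ++ cs) ≡ replicate a 1 ++ segTake p (b ∸ a) cs
  segTake-ones zero cs _ = refl
  segTake-ones {suc b} (suc a) cs (s<s q) =
    trans (segTake-> (replicate a 1 ++ cs) (s<s (≤-<-trans z≤n q))) (cong (1 ∷_) (segTake-ones a cs q))

  private
    rows-block : ∀ l a ν → suc a < p →
      pRimRows p (replicate (suc a) l ++ ν) ≡ replicate a 1 ++ segTake p (p ∸ a) (rimCount l ν ∷ rimCounts p ν)
    rows-block l a ν a<p =
      trans (cong (segTake p p) (rimCounts-block l a ν)) (segTake-ones a _ (<-trans (n<1+n a) a<p))

  -- The upper `a` rows of the group have one rim node each, and by the inequality the last row
  -- offers the remaining `p ∸ a`. The segment ends there, and `ν` starts with a fresh one.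
  rows-split : ∀ {l a ν} → suc a < p → p + head₁ ν ≤ l + suc a →
    pRimRows p (replicate (suc a) l ++ ν) ≡ replicate a 1 ++ (p ∸ a) ∷ pRimRows p ν
  rows-split {l} {a} {ν} a<p q =
    trans (rows-block l a ν a<p) (cong (replicate a 1 ++_) (segTake-≤ _ (enough ν q)))
    where
    enough : ∀ ν → p + head₁ ν ≤ l + suc a → p ∸ a ≤ rimCount l ν
    enough [] q = m≤n+o⇒m∸n≤o p a (s≤s⁻¹ (subst₂ _≤_ (+-comm p 1) (trans (+-suc l a) (cong suc (+-comm l a))) q))
    enough (y ∷ ν) q = m≤n+o⇒m∸n≤o p a (subst (p ≤_) (+-suc-comm a (l ∸ y))
      (+-cancelʳ-≤ y p _ (≤-trans q (≤-reflexive
        (trans (cong (_+ suc a) (sym (m∸n+n≡m y≤l))) (shuffle (l ∸ y) y (suc a)))))))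
      where
      +-suc-comm : ∀ a x → x + suc a ≡ a + suc x
      +-suc-comm = solve-∀
      shuffle : ∀ x y a → x + y + a ≡ x + a + y
      shuffle = solve-∀
      y≤l : y ≤ l
      y≤l = +-cancelʳ-≤ (suc a) y l (≤-trans (+-monoʳ-≤ y (<⇒≤ a<p)) (≤-trans (≤-reflexive (+-comm y p)) q))

  rows-last : ∀ {l a} → suc a < p → l + a < p →
    pRimRows p (replicate (suc a) l ++ []) ≡ replicate a 1 ++ l ∷ []
  rows-last {l} {a} a<p q =
    trans (rows-block l a [] a<p) (cong (replicate a 1 ++_) (segTake-> [] (m+n<o⇒m<o∸n l q)))
    where
    m+n<o⇒m<o∸n : ∀ l → l + a < p → l < p ∸ a
    m+n<o⇒m<o∸n l q = m+n≤o⇒m≤o∸n (suc l) q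

  rows-of-last : ∀ {l a} → suc a < p → 2 + l + a ≤ p →
    pRimRows p (replicate (suc a) (2 + l) ++ []) ≡ replicate a 1 ++ (2 + l) ∷ []
  rows-of-last {l} {a} a<p q with m≤n⇒m<n∨m≡n q
  ... | inj₁ q′ = rows-last {2 + l} a<p q′
  ... | inj₂ eq = trans (rows-split {2 + l} a<p (≤-reflexive (trans (cong (_+ 1) (sym eq)) (shuffle l a))))
    (cong (λ r → replicate a 1 ++ r ∷ []) (trans (cong (_∸ a) (sym eq)) (m+n∸n≡m (2 + l) a)))
    where
    shuffle : ∀ l a → 2 + l + a + 1 ≡ 2 + l + suc a
    shuffle = solve-∀

  -- The equation amounts to `p ≡ a + (suc (l ∸ l₂) + suc a₂)`: the segment uses up the rim in the
  -- first group and then takes one node in each row of the second, so that it stops in the last of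
  -- these rows however long the rim is there.
  rows-merge : ∀ {l a l₂ a₂ ν} → suc a < p → l₂ < l → 0 < l₂ → l + suc a + suc a₂ ≡ l₂ + p →
    part ν 0 ≤ l₂ →
    pRimRows p (replicate (suc a) l ++ replicate (suc a₂) l₂ ++ ν) ≡
    replicate a 1 ++ suc (l ∸ l₂) ∷ replicate (suc a₂) 1 ++ pRimRows p ν
  rows-merge {l} {a} {l₂} {a₂} {ν} a<p l₂<l l₂>0 eq ν≤l₂ = begin
    pRimRows p (replicate (suc a) l ++ μ)
      ≡⟨ rows-block l a μ a<p ⟩
    replicate a 1 ++ segTake p (p ∸ a) (suc (l ∸ l₂) ∷ rimCounts p μ)
      ≡⟨ cong (replicate a 1 ++_) (segTake-> _ (≤-trans (s≤s (m≤m+n _ a₂)) (≤-reflexive (sym p∸a)))) ⟩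
    replicate a 1 ++ suc (l ∸ l₂) ∷ segTake p (p ∸ a ∸ suc (l ∸ l₂)) (rimCounts p μ)
      ≡⟨ cong₂ (λ x y → replicate a 1 ++ suc (l ∸ l₂) ∷ segTake p x y) left (rimCounts-block l₂ a₂ ν) ⟩
    replicate a 1 ++ suc (l ∸ l₂) ∷ segTake p (suc a₂) (replicate a₂ 1 ++ rimCount l₂ ν ∷ rimCounts p ν)
      ≡⟨ cong (λ x → replicate a 1 ++ suc (l ∸ l₂) ∷ x) tail-rows ⟩
    replicate a 1 ++ suc (l ∸ l₂) ∷ replicate (suc a₂) 1 ++ pRimRows p ν ∎
    where
    open ≡-Reasoning
    μ = replicate (suc a₂) l₂ ++ ν
    d = l ∸ l₂
    p≡ : p ≡ a + (suc d + suc a₂)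
    p≡ = +-cancelˡ-≡ l₂ _ _ (trans (sym eq)
      (trans (cong (λ x → x + suc a + suc a₂) (sym (m+[n∸m]≡n (<⇒≤ l₂<l)))) (shuffle l₂ d a a₂)))
      where
      shuffle : ∀ y d a b → y + d + suc a + suc b ≡ y + (a + (suc d + suc b))
      shuffle = solve-∀
    p∸a : p ∸ a ≡ suc (suc d + a₂)
    p∸a = trans (cong (_∸ a) p≡) (trans (m+n∸m≡n a _) (+-suc (suc d) a₂))
    left : p ∸ a ∸ suc d ≡ suc a₂
    left = trans (cong (_∸ suc d) (trans p∸a (sym (+-suc (suc d) a₂)))) (m+n∸m≡n (suc d) (suc a₂))
    count-pos : ∀ ν → 1 ≤ rimCount l₂ ν
    count-pos []      = l₂>0
    count-pos (y ∷ ν) = s≤s z≤n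
    replicate-snoc : ∀ a (xs : List ℕ) → replicate a 1 ++ 1 ∷ xs ≡ 1 ∷ replicate a 1 ++ xs
    replicate-snoc zero    xs = refl
    replicate-snoc (suc a) xs = cong (1 ∷_) (replicate-snoc a xs)
    tail-rows : segTake p (suc a₂) (replicate a₂ 1 ++ rimCount l₂ ν ∷ rimCounts p ν) ≡
                replicate (suc a₂) 1 ++ pRimRows p ν
    tail-rows = begin
      segTake p (suc a₂) (replicate a₂ 1 ++ rimCount l₂ ν ∷ rimCounts p ν)
        ≡⟨ segTake-ones a₂ _ ≤-refl ⟩
      replicate a₂ 1 ++ segTake p (suc a₂ ∸ a₂) (rimCount l₂ ν ∷ rimCounts p ν)
        ≡⟨ cong (λ b → replicate a₂ 1 ++ segTake p b (rimCount l₂ ν ∷ rimCounts p ν)) (m+n∸n≡m 1 a₂) ⟩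
      replicate a₂ 1 ++ segTake p 1 (rimCount l₂ ν ∷ rimCounts p ν)
        ≡⟨ cong (replicate a₂ 1 ++_) (segTake-≤ _ (count-pos ν)) ⟩
      replicate a₂ 1 ++ 1 ∷ pRimRows p ν
        ≡⟨ replicate-snoc a₂ _ ⟩
      replicate (suc a₂) 1 ++ pRimRows p ν ∎

  pRimRows-length : ∀ ν → length (pRimRows p ν) ≡ length ν
  pRimRows-length ν = trans (segTake-length p (rimCounts p ν)) (rimCounts-length ν)
    where
    segTake-length : ∀ b cs → length (segTake p b cs) ≡ length cs
    segTake-length b []       = refl
    segTake-length b (c ∷ cs) with b ≤? c
    ... | yes _ = cong suc (segTake-length p cs)
    ... | no _  = cong suc (segTake-length (b ∸ c) cs)
    rimCounts-length : ∀ ν → length (rimCounts p ν) ≡ length ν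
    rimCounts-length []          = refl
    rimCounts-length (_ ∷ [])    = refl
    rimCounts-length (_ ∷ y ∷ ν) = cong suc (rimCounts-length (y ∷ ν))

  -- A segment takes at least one node in each row that it enters, and the next one starts in the
  -- row below, so no row is skipped. Hence `pRimParts` is the number of parts.
  pRimRows-positive : ∀ {ν} → All (0 <_) ν → All (0 <_) (pRimRows p ν)
  pRimRows-positive pos = segTake-positive _ _ (>-nonZero⁻¹ p) (rimCounts-positive pos)
    where
    segTake-positive : ∀ b cs → 0 < b → All (0 <_) cs → All (0 <_) (segTake p b cs)
    segTake-positive b []       b>0 _           = []
    segTake-positive b (c ∷ cs) b>0 (c>0 ∷ pos) with b ≤? c
    ... | yes _  = b>0 ∷ segTake-positive p cs (>-nonZero⁻¹ p) pos
    ... | no b≰c = c>0 ∷ segTake-positive (b ∸ c) cs (m<n⇒0<n∸m (≰⇒> b≰c)) pos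
    rimCounts-positive : ∀ {ν} → All (0 <_) ν → All (0 <_) (rimCounts p ν)
    rimCounts-positive []                = []
    rimCounts-positive (x>0 ∷ [])        = x>0 ∷ []
    rimCounts-positive (_ ∷ pos@(_ ∷ _)) = z<s ∷ rimCounts-positive pos

  pRimParts≡length : ∀ {ν} → All (0 <_) ν → pRimParts p ν ≡ length ν
  pRimParts≡length {ν} pos =
    trans (cong length (filter-all (0 <?_) (pRimRows-positive pos))) (pRimRows-length ν)

  -- What a segment leaves of the rows above its foot; a group without rows is omitted, since `JS`
  -- demands positive multiplicities.
  block : ℕ → ℕ → Groups → Groups
  block l zero    gs = gs
  block l (suc a) gs = (l , suc a) ∷ gs

  -- Removal of the p-rim.  A p-segment starts in the last column of a group (l , a); its last node
  -- either lies below the following group as well (hook, merge) or above it (split), unless the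
  -- segment is cut short by the end of the rim (column, last).  The index counts the lost parts.
  data Rim : Groups → Groups → ℕ → Set where
    []     : Rim [] [] 0
    column : ∀ {a} → Rim ((1 , suc a) ∷ []) [] (suc a)
    last   : ∀ {l a} → 2 + l + a ≤ p →
             Rim ((2 + l , suc a) ∷ []) (block (suc l) a []) 1
    hook   : ∀ {l a a₂} → 3 + l + a + a₂ ≡ p →
             Rim ((2 + l , suc a) ∷ (1 , suc a₂) ∷ []) (block (suc l) a []) (2 + a₂)
    merge  : ∀ {l a l₂ a₂ gs gs′ z} → 2 + l + a + a₂ ≡ l₂ + p → Rim gs gs′ z →
             Rim ((2 + l , suc a) ∷ (2 + l₂ , suc a₂) ∷ gs)
                 (block (suc l) a ((suc l₂ , 2 + a₂) ∷ gs′)) z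
    split  : ∀ {l a b gs gs′ z} → 2 + l + a ≡ p + suc b → head₁ (expand gs) ≤ suc b → Rim gs gs′ z →
             Rim ((2 + l , suc a) ∷ gs) (block (suc l) a ((suc b , 1) ∷ gs′)) z

  private
    chain : ∀ {l a l₂ a₂} → suc l + suc a + suc a₂ ≈ suc l₂ → suc l₂ < suc l →
      ∃ λ q → l + a + a₂ + 2 ≡ l₂ + suc q * p
    chain {l} {a} {l₂} {a₂} eq q with ≈-> eq (<-≤-trans q (≤-trans (m≤m+n _ _) (m≤m+n _ _)))
    ... | k , e = k , suc-injective (trans (shuffle l a a₂) e)
      where
      shuffle : ∀ l a b → suc (l + a + b + 2) ≡ suc l + suc a + suc b
      shuffle = solve-∀

  -- By the JS congruence, the two parts and multiplicities of adjacent groups determine a positive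
  -- multiple `suc q * p`. If it is `p`, the segment ends in the last row of the second group
  -- (`merge`, or `hook` if the part there is 1); if it is larger, the segment ends inside the first
  -- group (`split`).
  JS-rim : ∀ {u c gs} → JS u c gs → ∃₂ λ gs′ z → Rim gs gs′ z
  JS-rim [] = _ , _ , []
  JS-rim (cons {l = zero} _ a<p _ []) = _ , _ , column
  JS-rim (cons {l = zero} _ a<p _ (cons (s≤s ()) _ _ _))
  JS-rim (cons {l = suc l} {a} _ a<p _ []) with 2 + l + a ≤? p
  ... | yes q = _ , _ , last q
  ... | no ¬q = _ , _ , split {b = b} (sym (m+[n∸m]≡n′ (≰⇒> ¬q))) (s≤s z≤n) []
    where
    b = 2 + l + a ∸ suc p
    m+[n∸m]≡n′ : p < 2 + l + a → p + suc b ≡ 2 + l + a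
    m+[n∸m]≡n′ q = trans (+-suc p b) (m+[n∸m]≡n q)
  JS-rim (cons {l = suc l} {a} _ a<p _ js@(cons {l = l₂} {a₂} l₂<l a₂<p eq js₂)) =
    attach l₂<l a₂<p js₂ (chain {suc l} {a} {l₂} {a₂} eq l₂<l) (JS-rim js) (JS-rim js₂)
    where
    attach : ∀ {l a l₂ a₂ c gs} → suc l₂ < 2 + l → suc a₂ < p → JS (suc l₂) c gs →
      (∃ λ q → suc l + a + a₂ + 2 ≡ l₂ + suc q * p) →
      (∃₂ λ gs′ z → Rim ((suc l₂ , suc a₂) ∷ gs) gs′ z) → (∃₂ λ gs′ z → Rim gs gs′ z) →
      ∃₂ λ gs′ z → Rim ((2 + l , suc a) ∷ (suc l₂ , suc a₂) ∷ gs) gs′ z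
    attach {l} {a} {zero} {a₂} _ _ [] (zero , e) _ _ =
      _ , _ , hook (trans (shuffle l a a₂) (trans e (+-identityʳ p)))
      where
      shuffle : ∀ l a b → 3 + l + a + b ≡ suc l + a + b + 2
      shuffle = solve-∀
    attach {l₂ = zero} _ _ (cons (s≤s ()) _ _ _) (zero , e) _ _
    attach {l} {a} {suc l₂} {a₂} _ _ _ (zero , e) _ (_ , _ , rim) = _ , _ , merge
      (suc-injective (trans (shuffle l a a₂) (trans e (cong (suc l₂ +_) (+-identityʳ p))))) rim
      where
      shuffle : ∀ l a b → suc (2 + l + a + b) ≡ suc l + a + b + 2
      shuffle = solve-∀
    attach {l} {a} {l₂} {a₂} l₂<l a₂<p _ (suc q , e) (_ , _ , rim) _ =
      _ , _ , split {b = b} split-eq (s≤s (m≤m+n _ _)) rim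
      where
      -- Found by solving `split-eq` for `b`. Regularity makes `x` a true difference, and writing
      -- `b` as `l₂` plus something gives the bound on the next part at once.
      x = p ∸ (2 + a₂)
      b = l₂ + (x + q * p)
      split-eq : 2 + l + a ≡ p + suc b
      split-eq = +-cancelʳ-≡ (suc a₂) _ _ (begin
        2 + l + a + suc a₂
          ≡⟨ shuffle₁ l a a₂ ⟩
        suc l + a + a₂ + 2
          ≡⟨ e ⟩
        l₂ + (p + (p + q * p))
          ≡⟨ cong (λ y → l₂ + (p + (y + q * p))) (m∸n+n≡m a₂<p) ⟨
        l₂ + (p + (x + (2 + a₂) + q * p))
          ≡⟨ shuffle₂ l₂ p x a₂ (q * p) ⟩
        p + suc b + suc a₂ ∎)
        where
        open ≡-Reasoning
        shuffle₁ : ∀ l a b → 2 + l + a + suc b ≡ suc l + a + b + 2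
        shuffle₁ = solve-∀
        shuffle₂ : ∀ l p x a y → l + (p + (x + (2 + a) + y)) ≡ p + suc (l + (x + y)) + suc a
        shuffle₂ = solve-∀

  module _ {l a l₂ a₂ : ℕ} (eq : 2 + l + a + a₂ ≡ l₂ + p) where

    merge-≈ : suc l + a + (2 + a₂) ≈ suc l₂
    merge-≈ = trans (cong (_% p) (trans (shuffle l a a₂) (cong suc eq))) ([m+n]%n≡m%n (suc l₂) p)
      where
      shuffle : ∀ l a b → suc l + a + (2 + b) ≡ suc (2 + l + a + b)
      shuffle = solve-∀

    -- The lower group gains the foot row of the group above. There is room for it because the
    -- segment also descends from `l` to `l₂`, which costs at least one more of its `p` nodes.
    merge-regular : l₂ < l → 2 + a₂ < p
    merge-regular q = +-cancelˡ-≤ l₂ _ _ (≤-trans (≤-trans (≤-reflexive (shuffle l₂ a₂))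
      (≤-trans (+-monoˡ-≤ (2 + a₂) q) (≤-trans (≤-reflexive (shuffle′ l a₂)) (+-monoˡ-≤ a₂ (m≤m+n (2 + l) a)))))
      (≤-reflexive eq))
      where
      shuffle : ∀ l a → l + (3 + a) ≡ suc l + (2 + a)
      shuffle = solve-∀
      shuffle′ : ∀ l a → l + (2 + a) ≡ 2 + l + a
      shuffle′ = solve-∀

  split-≈ : ∀ {l a b} → 2 + l + a ≡ p + suc b → suc l + a + 1 ≈ suc b
  split-≈ {l} {a} {b} eq = trans (cong (_% p) (trans (+-comm _ 1) (trans eq (+-comm p (suc b)))))
    ([m+n]%n≡m%n (suc b) p)

  split-below : ∀ {l a b} → suc a < p → 2 + l + a ≡ p + suc b → b < l
  split-below {l} {a} {b} a<p eq = +-cancelʳ-≤ (2 + a) (suc b) l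
    (≤-trans (+-monoʳ-≤ (suc b) a<p)
      (≤-reflexive (trans (+-comm (suc b) p) (trans (sym eq) (shuffle l a)))))
    where
    shuffle : ∀ l a → 2 + l + a ≡ l + (2 + a)
    shuffle = solve-∀

  module _ {l a u c : ℕ} (l<u : 2 + l < suc u) (a<p : suc a < p) (c≈l : c + suc a ≈ 2 + l) where

    -- Part and multiplicity both drop by one, which preserves their difference, the type. If no row
    -- is left, `c ≈ suc l` and the tail itself has type `c`.
    JS-block : ∀ {gs} → JS (suc l) (suc l + a) gs → JS u c (block (suc l) a gs)
    JS-block = go a a<p c≈l
      where
      go : ∀ {gs} a → suc a < p → c + suc a ≈ 2 + l → JS (suc l) (suc l + a) gs → JS u c (block (suc l) a gs)
      go zero    _   c≈l js = JS-weaken (≤-trans (n≤1+n _) (s≤s⁻¹ l<u))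
        (trans (cong (_% p) (+-identityʳ (suc l)))
          (sym (≈-cancelʳ 1 (trans c≈l (cong (_% p) (+-comm 1 (suc l))))))) js
      go (suc a) a<p c≈l js = cons (s≤s⁻¹ l<u) (<-trans (n<1+n _) a<p)
        (≈-cancelʳ 1 (trans (cong (_% p) (shuffle c a)) (trans c≈l (cong (_% p) (+-comm 1 (suc l)))))) js
        where
        shuffle : ∀ c a → c + suc a + 1 ≡ c + suc (suc a)
        shuffle = solve-∀

  JS-tail-merge : ∀ {l₂ a₂ gs} → JS (2 + l₂) (2 + l₂ + suc a₂) gs → JS (2 + l₂) (suc l₂ + (2 + a₂)) gs
  JS-tail-merge {l₂} {a₂} = JS-weaken ≤-refl (cong (_% p) (sym (+-suc (suc l₂) (suc a₂))))

  JS-tail-split : ∀ {l a b gs} → 2 + l + a ≡ p + suc b → head₁ (expand gs) ≤ suc b →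
    JS (2 + l) (2 + l + suc a) gs → JS (2 + b) (suc b + 1) gs
  JS-tail-split {l} {a} {b} eq h js = JS-rebound (s≤s h) (JS-weaken ≤-refl
    (trans (cong (_% p) (shuffle l a)) (≈-+ʳ 1 (split-≈ {l} {a} eq))) js)
    where
    shuffle : ∀ l a → 2 + l + suc a ≡ suc l + a + 1 + 1
    shuffle = solve-∀

  -- The bound falls because every part loses a node. The foot left by `split` is a group with a
  -- single row, which is regular as `2 ≤ p`.
  JS-removed : 2 ≤ p → ∀ {u c gs gs′ z} → JS (suc u) c gs → Rim gs gs′ z → JS u c gs′
  JS-removed 2≤p js [] = []
  JS-removed 2≤p js column = []
  JS-removed 2≤p (cons l<u a<p c≈l _) (last _) = JS-block l<u a<p c≈l []
  JS-removed 2≤p (cons l<u a<p c≈l _) (hook _) = JS-block l<u a<p c≈l []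
  JS-removed 2≤p (cons l<u a<p c≈l (cons l₂<l _ _ js)) (merge {l} {a} {l₂} {a₂} eq rim) =
    JS-block l<u a<p c≈l (cons (s≤s⁻¹ l₂<l) (merge-regular {l} {a} eq (s≤s⁻¹ (s≤s⁻¹ l₂<l)))
      (merge-≈ {l} {a} eq) (JS-removed 2≤p (JS-tail-merge js) rim))
  JS-removed 2≤p (cons l<u a<p c≈l js) (split {l} {a} {b} eq h rim) =
    JS-block l<u a<p c≈l (cons (s<s (split-below {l} {a} a<p eq)) 2≤p (split-≈ {l} {a} eq)
      (JS-removed 2≤p (JS-tail-split eq h js) rim))

-- Rim sizes

part-head₁ : ∀ ν → part ν 0 ≤ head₁ ν
part-head₁ []      = z≤n
part-head₁ (_ ∷ _) = ≤-refl

module Rims (p : ℕ) .{{_ : NonZero p}} (2≤p : 2 ≤ p) where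

  open Abacus p using (divMod-unique)
  open Residues p
  open Chains p

  rim : Groups → ℕ
  rim gs = pRimSize p (expand gs)

  sum-rows : ∀ a xs → sum (replicate a 1 ++ xs) ≡ a + sum xs
  sum-rows a xs = trans (size-replicate-++ a xs) (cong (_+ sum xs) (*-identityʳ a))

  rim-split : ∀ {l a gs} → suc a < p → p + head₁ (expand gs) ≤ l + suc a →
    rim ((l , suc a) ∷ gs) ≡ p + rim gs
  rim-split {l} {a} {gs} a<p q = begin
    rim ((l , suc a) ∷ gs)       ≡⟨ cong sum (rows-split {l} a<p q) ⟩
    _                            ≡⟨ sum-rows a _ ⟩
    a + (p ∸ a + rim gs)         ≡⟨ +-assoc a (p ∸ a) _ ⟨
    a + (p ∸ a) + rim gs         ≡⟨ cong (_+ rim gs) (m+[n∸m]≡n (<⇒≤ (<-trans (n<1+n a) a<p))) ⟩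
    p + rim gs                   ∎
    where open ≡-Reasoning

  rim-last : ∀ {l a} → suc a < p → l + a < p → rim ((l , suc a) ∷ []) ≡ l + a
  rim-last {l} {a} a<p q = begin
    rim ((l , suc a) ∷ [])       ≡⟨ cong sum (rows-last {l} a<p q) ⟩
    _                            ≡⟨ sum-rows a _ ⟩
    a + (l + 0)                  ≡⟨ cong (a +_) (+-identityʳ l) ⟩
    a + l                        ≡⟨ +-comm a l ⟩
    l + a                        ∎
    where open ≡-Reasoning

  rim-merge : ∀ {l a l₂ a₂ gs} → suc a < p → l₂ < l → 0 < l₂ → l + suc a + suc a₂ ≡ l₂ + p →
    part (expand gs) 0 ≤ l₂ → rim ((l , suc a) ∷ (l₂ , suc a₂) ∷ gs) ≡ p + rim gs
  rim-merge {l} {a} {l₂} {a₂} {gs} a<p l₂<l l₂>0 eq h = begin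
    rim ((l , suc a) ∷ (l₂ , suc a₂) ∷ gs)
      ≡⟨ cong sum (rows-merge {l} a<p l₂<l l₂>0 eq h) ⟩
    _
      ≡⟨ sum-rows a _ ⟩
    a + (suc d + sum (replicate (suc a₂) 1 ++ pRimRows p (expand gs)))
      ≡⟨ cong (λ x → a + (suc d + x)) (sum-rows (suc a₂) _) ⟩
    a + (suc d + (suc a₂ + rim gs))
      ≡⟨ shuffle a (suc d) (suc a₂) (rim gs) ⟩
    a + suc d + suc a₂ + rim gs
      ≡⟨ cong (_+ rim gs) (+-cancelˡ-≡ l₂ _ _ (trans (shuffle′ l₂ a d (suc a₂))
           (trans (cong (λ x → x + suc a + suc a₂) (m+[n∸m]≡n (<⇒≤ l₂<l))) eq))) ⟩
    p + rim gs ∎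
    where
    open ≡-Reasoning
    d = l ∸ l₂
    shuffle : ∀ a b c d → a + (b + (c + d)) ≡ a + b + c + d
    shuffle = solve-∀
    shuffle′ : ∀ l a d b → l + (a + suc d + b) ≡ l + d + suc a + b
    shuffle′ = solve-∀

  -- With t′ ≡ x′ − y′ + 1 and t ≡ x − y + 1, this is the number dᵢ of the theorem.
  d : ℕ → ℕ → ℕ → ℕ
  d zero     s t       = (p ∸ 1 + s ∸ t) / p
  d (suc t′) s zero    = (suc t′ + s + p) / p
  d (suc t′) s (suc t) = (suc t′ + 2 * s) / p

  -- Rim sizes A and A′ of λ and λ⁽²⁾, where λ⁽²⁾ has z fewer parts than λ.
  Rel : ℕ → ℕ → ℕ → Set
  Rel A A′ z = A / p ≡ A′ / p + d (A′ % p) z (A % p)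

  quotient : ∀ {x r} k → r < p → x ≡ r + k * p → x / p ≡ k
  quotient k r<p refl = proj₂ (divMod-unique k r<p)

  private
    full : p ≡ 0 + 1 * p
    full = sym (+-identityʳ p)

  Rel-intro : ∀ {t t′ z} D D′ → t < p → t′ < p → D ≡ D′ + d t′ z t → Rel (t + D * p) (t′ + D′ * p) z
  Rel-intro D D′ t<p t′<p eq
    rewrite proj₁ (divMod-unique D t<p) | proj₂ (divMod-unique D t<p)
          | proj₁ (divMod-unique D′ t′<p) | proj₂ (divMod-unique D′ t′<p) = eq

  Rel-+p : ∀ {A A′ z} → Rel A A′ z → Rel (p + A) (p + A′) z
  Rel-+p {A} {A′} {z} eq = trans (/-suc A) (trans (cong suc eq)
    (sym (cong₂ _+_ (/-suc A′) (cong₂ (λ x y → d x z y) (%-+p A′) (%-+p A)))))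
    where
    /-suc : ∀ x → (p + x) / p ≡ suc (x / p)
    /-suc x = trans (m/n≡1+[m∸n]/n (m≤m+n p x)) (cong (λ y → suc (y / p)) (m+n∸m≡n p x))
    %-+p : ∀ x → (p + x) % p ≡ x % p
    %-+p x = trans (cong (_% p) (+-comm p x)) ([m+n]%n≡m%n x p)

  private
    p-positive : 0 < p
    p-positive = >-nonZero⁻¹ p

    full-Rel : ∀ {t′ z} → t′ < p → d t′ z 0 ≡ 1 → Rel p t′ z
    full-Rel {t′} {z} q eq = subst₂ (λ A A′ → Rel A A′ z) (sym full) (+-identityʳ t′)
      (Rel-intro 1 0 p-positive q (sym eq))

    small-Rel : ∀ {t t′ z} → t < p → t′ < p → d t′ z t ≡ 0 → Rel t t′ z
    small-Rel {t} {t′} {z} q q′ eq = subst₂ (λ A A′ → Rel A A′ z) (+-identityʳ t) (+-identityʳ t′)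
      (Rel-intro 0 0 q q′ (sym eq))

  -- Values of d at the end of the rim

  Rel-empty : Rel 0 0 0
  Rel-empty = small-Rel p-positive p-positive
    (m<n⇒m/n≡0 (≤-trans (s≤s (≤-reflexive (+-identityʳ (p ∸ 1)))) (≤-reflexive (suc-pred p))))

  Rel-shorten : ∀ {t′} → suc t′ < p → Rel p (suc t′) 0
  Rel-shorten {t′} q = full-Rel q (quotient 1 q (shuffle (suc t′) p))
    where
    shuffle : ∀ t p → t + 0 + p ≡ t + 1 * p
    shuffle = solve-∀

  Rel-column : ∀ {B} → suc B < p → Rel (suc B) 0 (suc B)
  Rel-column {B} q = small-Rel q p-positive
    (m<n⇒m/n≡0 (≤-trans (s≤s (≤-reflexive (m+n∸n≡m (p ∸ 1) (suc B)))) (≤-reflexive (suc-pred p))))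

  Rel-last : ∀ {B} → suc B ≤ p → Rel (suc B) 0 1
  Rel-last {B} q with m≤n⇒m<n∨m≡n q
  ... | inj₁ B<p = small-Rel B<p p-positive (m<n⇒m/n≡0 (≤-<-trans
    (≤-reflexive (cong (_∸ suc B) (+-comm (p ∸ 1) 1)))
    (≤-<-trans (m∸n≤m (p ∸ 1) B) (≤-reflexive (suc-pred p)))))
  ... | inj₂ B≡p = subst (λ A → Rel A 0 1) (sym B≡p) (full-Rel p-positive (quotient 1 p-positive
    (trans (+-comm (p ∸ 1) 1) (trans (suc-pred p) full))))

  -- An unfinished last segment loses two nodes, one with its row and one with its column, while one
  -- part is lost: hence the term `2 * s` in `d`.
  Rel-last′ : ∀ {t′} → 3 + t′ ≤ p → Rel (3 + t′) (suc t′) 1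
  Rel-last′ {t′} q with m≤n⇒m<n∨m≡n q
  ... | inj₁ q′ = small-Rel q′ (≤-trans (n≤1+n _) q) (m<n⇒m/n≡0 (subst (_< p) (+-comm 2 (suc t′)) q′))
  ... | inj₂ B≡p = subst (λ A → Rel A (suc t′) 1) (sym B≡p) (full-Rel (≤-trans (n≤1+n _) q)
    (quotient {r = 2 + t′} 1 q (shuffle t′ p)))
    where
    shuffle : ∀ t p → suc t + 1 + p ≡ 2 + t + 1 * p
    shuffle = solve-∀

  Rel-hook : ∀ {z} → 0 < z → z ≤ p → Rel p 0 z
  Rel-hook {suc z} _ q = full-Rel p-positive (quotient {r = z} 1 q
    (trans (+-suc (p ∸ 1) z) (trans (cong (_+ z) (suc-pred p)) (shuffle p z))))
    where
    shuffle : ∀ p z → p + z ≡ z + 1 * p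
    shuffle = solve-∀

  Rel-hook′ : ∀ {t′ z} → suc (suc t′ + z) ≡ p → Rel p (suc t′) z
  Rel-hook′ {t′} {z} eq = full-Rel (≤-trans (s≤s (s≤s (m≤m+n t′ z))) (≤-reflexive eq))
    (quotient {r = suc t′ + z} 1 (≤-reflexive eq) (cong (suc t′ + z +_) full))

  -- Here the remainder of `A` equals the number of lost parts, so `t′ + 2 * s` is `p + s`, with
  -- quotient 1.
  Rel-column′ : ∀ {t′ B} → suc t′ + suc B ≡ p → Rel (p + suc B) (suc t′) (suc B)
  Rel-column′ {t′} {B} eq = subst₂ (λ A A′ → Rel A A′ (suc B))
    (shuffle (suc B) p) (+-identityʳ (suc t′))
    (Rel-intro 1 0 B<p (≤-trans (m<m+n (suc t′) z<s) (≤-reflexive eq))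
      (sym (quotient {r = suc B} 1 B<p (trans (shuffle′ t′ B) (cong (λ x → suc B + (x + 0)) eq)))))
    where
    B<p : suc B < p
    B<p = ≤-trans (m<n+m (suc B) z<s) (≤-reflexive eq)
    shuffle : ∀ B p → B + 1 * p ≡ p + B
    shuffle = solve-∀
    shuffle′ : ∀ t B → suc t + 2 * suc B ≡ suc B + (suc t + suc B + 0)
    shuffle′ = solve-∀

  -- The group (l₁ , 1 + a₁) becomes the head of a p-segment above what is left of a list of groups
  -- starting with (2 + l , 1 + a).
  Rel-segment : ∀ {l₁ a₁ l a A z} inner → suc a₁ < p → suc a < p → 2 + l ≤ l₁ →
    l₁ + suc a₁ + suc a ≈ 2 + l → head₁ (expand inner) ≤ suc l →
    Rel A (rim inner) z → Rel A (rim (block (suc l) a inner)) z →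
    Rel (p + A) (rim ((l₁ , suc a₁) ∷ block (suc l) a inner)) z
  Rel-segment {l₁} {a₁} {l} {a} {A} {z} inner a₁<p a<p l<l₁ eq h rel rel′ =
    go a a<p (≈-> eq (≤-<-trans l<l₁ (≤-trans (m<m+n l₁ z<s) (m≤m+n _ _)))) rel′
    where
    go : ∀ a → suc a < p → (∃ λ q → l₁ + suc a₁ + suc a ≡ 2 + l + suc q * p) →
      Rel A (rim (block (suc l) a inner)) z → Rel (p + A) (rim ((l₁ , suc a₁) ∷ block (suc l) a inner)) z
    go zero _ (q , e) rel′ = subst (λ x → Rel (p + A) x z)
      (sym (rim-split {l₁} {gs = inner} a₁<p (≤-trans (+-monoʳ-≤ p h)
        (≤-trans (m≤m+n (p + suc l) (q * p)) (≤-reflexive (sym (suc-injective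
          (trans (trans (+-comm 1 _) e) (shuffle l p (q * p)))))))))) (Rel-+p {A} rel)
      where
      shuffle : ∀ l p y → 2 + l + (p + y) ≡ suc (p + suc l + y)
      shuffle = solve-∀
    go (suc a) a<p (zero , e) rel′ = subst (λ x → Rel (p + A) x z)
      (sym (rim-merge {l₁} {gs = inner} a₁<p l<l₁ z<s
        (suc-injective (trans (sym (+-suc _ (suc a))) (trans e (cong (2 + l +_) (+-identityʳ p)))))
        (≤-trans (part-head₁ (expand inner)) h)))
      (Rel-+p {A} rel)
    go (suc a) a<p (suc q , e) rel′ = subst (λ x → Rel (p + A) x z)
      (sym (rim-split {l₁} {gs = (suc l , suc a) ∷ inner} a₁<p (+-cancelʳ-≤ (2 + a) _ _
        (≤-trans (+-monoʳ-≤ (p + suc l) (<⇒≤ a<p))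
          (≤-trans (m≤m+n (p + suc l + p) (suc (q * p))) (≤-reflexive (trans (shuffle l p (q * p)) (sym e))))))))
      (Rel-+p {A} rel′)
      where
      shuffle : ∀ l p y → p + suc l + p + suc y ≡ 2 + l + (p + (p + y))
      shuffle = solve-∀

  rim-of-last : ∀ {l a} → suc a < p → 2 + l + a ≤ p → rim ((2 + l , suc a) ∷ []) ≡ 2 + l + a
  rim-of-last {l} {a} a<p q = begin
    rim ((2 + l , suc a) ∷ [])   ≡⟨ cong sum (rows-of-last {l} a<p q) ⟩
    _                            ≡⟨ sum-rows a _ ⟩
    a + (2 + l + 0)              ≡⟨ shuffle a l ⟩
    2 + l + a                    ∎
    where
    open ≡-Reasoning
    shuffle : ∀ a l → a + (2 + l + 0) ≡ 2 + l + a
    shuffle = solve-∀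

  rim-of-hook : ∀ {l a a₂} → suc a < p → 3 + l + a + a₂ ≡ p →
    rim ((2 + l , suc a) ∷ (1 , suc a₂) ∷ []) ≡ p
  rim-of-hook {l} {a} {a₂} a<p eq = trans
    (rim-merge {2 + l} {gs = []} a<p (s≤s (s≤s z≤n)) z<s (trans (shuffle l a a₂) (cong suc eq)) z≤n)
    (+-identityʳ p)
    where
    shuffle : ∀ l a b → 2 + l + suc a + suc b ≡ suc (3 + l + a + b)
    shuffle = solve-∀

  rim-of-merge : ∀ {l a l₂ a₂ gs} → suc a < p → l₂ < l → part (expand gs) 0 ≤ 2 + l₂ →
    2 + l + a + a₂ ≡ l₂ + p → rim ((2 + l , suc a) ∷ (2 + l₂ , suc a₂) ∷ gs) ≡ p + rim gs
  rim-of-merge {l} {a} {l₂} {a₂} {gs} a<p q h eq =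
    rim-merge {2 + l} {gs = gs} a<p (s≤s (s≤s q)) z<s (trans (shuffle l a a₂) (cong (2 +_) eq)) h
    where
    shuffle : ∀ l a b → 2 + l + suc a + suc b ≡ 2 + (2 + l + a + b)
    shuffle = solve-∀

  rim-of-split : ∀ {l a b gs} → suc a < p → 2 + l + a ≡ p + suc b → head₁ (expand gs) ≤ suc b →
    rim ((2 + l , suc a) ∷ gs) ≡ p + rim gs
  rim-of-split {l} {a} {b} {gs} a<p eq h = rim-split {2 + l} {gs = gs} a<p
    (≤-trans (+-monoʳ-≤ p h) (≤-trans (≤-reflexive (sym eq)) (+-monoʳ-≤ (2 + l) (n≤1+n a))))

  mutual
    -- If the top group keeps a row, λ and λ⁽²⁾ both start with a full segment and `p` cancels. If
    -- it vanishes, λ⁽²⁾ starts with the group made from the foot of the segment, and `Rel-below`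
    -- applies.
    Rel-rim : ∀ {u c gs gs′ z} → JS u c gs → Rim gs gs′ z → Rel (rim gs) (rim gs′) z
    Rel-rim js [] = Rel-empty
    Rel-rim (cons _ a<p _ _) (column {a}) =
      subst (λ A → Rel A 0 (suc a)) (sym (rim-last {1} a<p a<p)) (Rel-column a<p)
    Rel-rim (cons _ a<p _ _) (last {l} {zero} q) =
      subst (λ A → Rel A 0 1) (sym (rim-of-last {l} a<p q)) (Rel-last q)
    Rel-rim (cons _ a<p _ _) (last {l} {suc a} q) = subst₂ (λ A A′ → Rel A A′ 1)
      (trans (cong (2 +_) (sym (+-suc l a))) (sym (rim-of-last {l} a<p q)))
      (sym (rim-last {suc l} (<-trans (n<1+n _) a<p) (≤-trans (n≤1+n _) q′)))
      (Rel-last′ q′)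
      where
      q′ : 3 + (l + a) ≤ p
      q′ = ≤-trans (≤-reflexive (cong (2 +_) (sym (+-suc l a)))) q
    Rel-rim (cons _ a<p _ _) (hook {l} {zero} {a₂} eq) =
      subst (λ A → Rel A 0 (2 + a₂)) (sym (rim-of-hook {l} a<p eq)) (Rel-hook z<s (hook-bound l 0 a₂ eq))
    Rel-rim (cons _ a<p _ _) (hook {l} {suc a} {a₂} eq) = subst₂ (λ A A′ → Rel A A′ (2 + a₂))
      (sym (rim-of-hook {l} a<p eq))
      (sym (rim-last {suc l} (<-trans (n<1+n _) a<p)
        (≤-trans (≤-trans (m≤m+n (2 + l + a) (2 + a₂)) (≤-reflexive (shuffle l a a₂))) (≤-reflexive eq))))
      (Rel-hook′ (trans (shuffle l a a₂) eq))
      where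
      shuffle : ∀ l a b → 2 + l + a + (2 + b) ≡ 3 + l + suc a + b
      shuffle = solve-∀
    Rel-rim (cons _ a<p _ (cons l₂<l a₂<p eq₂ js)) (merge {l} {zero} {l₂} {a₂} {gs} eq r) =
      subst (λ A → Rel A _ _)
        (sym (rim-of-merge {l} {gs = gs} a<p (s≤s⁻¹ (s≤s⁻¹ l₂<l)) (m≤n⇒m≤1+n (JS-bound js)) eq))
        (Rel-below (merge-regular {l} eq (s≤s⁻¹ (s≤s⁻¹ l₂<l))) z<s (JS-tail-merge js) r)
    Rel-rim (cons _ a<p _ (cons l₂<l a₂<p eq₂ js)) (merge {l} {suc a} {l₂} {a₂} {gs} {gs′} eq r) =
      subst₂ (λ A A′ → Rel A A′ _)
        (sym (rim-of-merge {l} {gs = gs} a<p (s≤s⁻¹ (s≤s⁻¹ l₂<l)) (m≤n⇒m≤1+n (JS-bound js)) eq))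
        (sym (rim-merge {suc l} {gs = gs′} (<-trans (n<1+n _) a<p) (s≤s⁻¹ l₂<l) z<s
          (trans (shuffle l a a₂) (cong suc eq)) (m≤n⇒m≤1+n (JS-bound (JS-removed 2≤p js r)))))
        (Rel-+p {rim gs} (Rel-rim js r))
      where
      shuffle : ∀ l a b → suc l + suc a + (2 + b) ≡ suc (2 + l + suc a + b)
      shuffle = solve-∀
    Rel-rim (cons _ a<p _ js) (split {l} {zero} {b} {gs} eq h r) =
      subst (λ A → Rel A _ _) (sym (rim-of-split {l} {gs = gs} a<p eq h))
        (Rel-below 2≤p z<s (JS-tail-split eq h js) r)
    Rel-rim (cons _ a<p _ js) (split {l} {suc a} {b} {gs} {gs′} eq h r) =
      subst₂ (λ A A′ → Rel A A′ _)
        (sym (rim-of-split {l} {gs = gs} a<p eq h))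
        (sym (rim-merge {suc l} {gs = gs′} (<-trans (n<1+n _) a<p) (s≤s (split-below {l} {suc a} a<p eq)) z<s
          (trans (shuffle l a) (trans eq (+-comm p (suc b))))
          (m≤n⇒m≤1+n (JS-bound (JS-removed 2≤p (JS-tail-split {a = suc a} eq h js) r)))))
        (Rel-+p {rim gs} (Rel-rim js r))
      where
      shuffle : ∀ l a → suc l + suc a + 1 ≡ 2 + l + suc a
      shuffle = solve-∀

    -- The `p` on the left is the segment of λ that left the group `(l₁ , suc a₁)` behind. Either
    -- the segment starting at this group is full again and the comparison moves down, or it is cut
    -- short by the end of the rim and `d` is 1.
    Rel-below : ∀ {l₁ a₁ gs gs′ z} → suc a₁ < p → 0 < l₁ → JS (suc l₁) (l₁ + suc a₁) gs →
      Rim gs gs′ z → Rel (p + rim gs) (rim ((l₁ , suc a₁) ∷ gs′)) z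
    Rel-below {suc l₁} {a₁} a₁<p _ js [] with suc l₁ + a₁ <? p
    ... | yes q = subst₂ (λ A A′ → Rel A A′ 0) (sym (+-identityʳ p)) (sym (rim-last {suc l₁} a₁<p q)) (Rel-shorten q)
    ... | no ¬q = subst (λ A′ → Rel (p + 0) A′ 0)
      (sym (rim-split {suc l₁} {gs = []} a₁<p (≤-trans (+-monoˡ-≤ 1 (≮⇒≥ ¬q)) (≤-reflexive (shuffle l₁ a₁)))))
      (Rel-+p {0} Rel-empty)
      where
      shuffle : ∀ l a → suc l + a + 1 ≡ suc l + suc a
      shuffle = solve-∀
    Rel-below {suc l₁} {a₁} a₁<p _ (cons _ a<p eq _) (column {a})
      with ≈-> eq (s≤s (≤-trans (s≤s z≤n) (m≤n+m (suc a) (l₁ + suc a₁))))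
    -- The column disappears with the rim, so the segment that would have run into it stops short of
    -- `p`.
    ... | zero , e = subst₂ (λ A A′ → Rel A A′ (suc a)) (cong (p +_) (sym (rim-last {1} a<p a<p)))
      (sym (rim-last {suc l₁} a₁<p (≤-trans (m<m+n (suc l₁ + a₁) z<s) (≤-reflexive e′))))
      (Rel-column′ e′)
      where
      e′ : suc (l₁ + a₁) + suc a ≡ p
      e′ = suc-injective (trans (shuffle l₁ a₁ a) (trans e (cong suc (+-identityʳ p))))
        where
        shuffle : ∀ l b a → suc (suc (l + b) + suc a) ≡ suc l + suc b + suc a
        shuffle = solve-∀
    ... | suc q , e = subst₂ (λ A A′ → Rel (p + A) A′ (suc a)) (sym (rim-last {1} a<p a<p))
      (sym (rim-split {suc l₁} {gs = []} a₁<p (+-cancelʳ-≤ (suc a) _ _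
        (≤-trans (+-monoʳ-≤ (p + 1) (<⇒≤ a<p)) (≤-trans (m≤m+n (p + 1 + p) (q * p))
          (≤-reflexive (trans (shuffle p (q * p)) (sym e))))))))
      (Rel-+p {suc a} (Rel-column a<p))
      where
      shuffle : ∀ p y → p + 1 + p + y ≡ 1 + (p + (p + y))
      shuffle = solve-∀
    Rel-below a₁<p l₁>0 js₀@(cons l<l₁ a<p eq _) r@(last {l} {a} q) =
      Rel-segment {l = l} {a} [] a₁<p a<p (s≤s⁻¹ l<l₁) eq (s≤s z≤n)
        (subst (λ A → Rel A 0 1) (sym (rim-of-last {l} a<p q)) (Rel-last q)) (Rel-rim js₀ r)
    Rel-below a₁<p l₁>0 js₀@(cons l<l₁ a<p eq _) r@(hook {l} {a} {a₂} e) =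
      Rel-segment {l = l} {a} [] a₁<p a<p (s≤s⁻¹ l<l₁) eq (s≤s z≤n)
        (subst (λ A → Rel A 0 (2 + a₂)) (sym (rim-of-hook {l} a<p e)) (Rel-hook z<s (hook-bound l a a₂ e)))
        (Rel-rim js₀ r)
    Rel-below a₁<p l₁>0 js₀@(cons l<l₁ a<p eq (cons l₂<l a₂<p eq₂ js)) r₀@(merge {l} {a} {l₂} {a₂} {gs} {gs′} e r) =
      Rel-segment {l = l} {a} ((suc l₂ , 2 + a₂) ∷ gs′) a₁<p a<p (s≤s⁻¹ l<l₁) eq
        (s≤s (<⇒≤ (s≤s⁻¹ (s≤s⁻¹ l₂<l))))
        (subst (λ A → Rel A _ _)
          (sym (rim-of-merge {l} {gs = gs} a<p (s≤s⁻¹ (s≤s⁻¹ l₂<l)) (m≤n⇒m≤1+n (JS-bound js)) e))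
          (Rel-below (merge-regular {l} e (s≤s⁻¹ (s≤s⁻¹ l₂<l))) z<s (JS-tail-merge js) r))
        (Rel-rim js₀ r₀)
    Rel-below a₁<p l₁>0 js₀@(cons l<l₁ a<p eq js) r₀@(split {l} {a} {b} {gs} {gs′} e h r) =
      Rel-segment {l = l} {a} ((suc b , 1) ∷ gs′) a₁<p a<p (s≤s⁻¹ l<l₁) eq
        (s≤s (<⇒≤ (split-below {l} a<p e)))
        (subst (λ A → Rel A _ _) (sym (rim-of-split {l} {gs = gs} a<p e h))
          (Rel-below 2≤p z<s (JS-tail-split e h js) r))
        (Rel-rim js₀ r₀)

    private
      hook-bound : ∀ l a a₂ → 3 + l + a + a₂ ≡ p → 2 + a₂ ≤ p
      hook-bound l a a₂ eq = ≤-trans (s≤s (s≤s (≤-trans (m≤n+m a₂ (l + a)) (n≤1+n _)))) (≤-reflexive eq)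

-- Removing the p-rim

module Steps (p : ℕ) .{{_ : NonZero p}} (2≤p : 2 ≤ p) where

  open Core p
  open Residues p
  open Chains p
  open Rims p 2≤p

  expand-block : ∀ l a gs → expand (block l a gs) ≡ replicate a l ++ expand gs
  expand-block l zero    gs = refl
  expand-block l (suc a) gs = refl

  private
    strip-head : ∀ {l r rs} a ν →
      dropZeros (zipWith _∸_ (replicate (suc a) (2 + l) ++ ν) (replicate a 1 ++ r ∷ rs)) ≡
      replicate a (suc l) ++ dropZeros ((2 + l ∸ r) ∷ zipWith _∸_ ν rs)
    strip-head zero    ν = refl
    strip-head {l} (suc a) ν = cong (suc l ∷_) (strip-head a ν)

    strip : ∀ {l rs} a ν → dropZeros (zipWith _∸_ (replicate a (2 + l) ++ ν) (replicate a 1 ++ rs)) ≡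
                           replicate a (suc l) ++ dropZeros (zipWith _∸_ ν rs)
    strip zero    ν = refl
    strip {l} (suc a) ν = cong (suc l ∷_) (strip a ν)

    strip-ones : ∀ {rs} a ν → dropZeros (zipWith _∸_ (replicate a 1 ++ ν) (replicate a 1 ++ rs)) ≡
                              dropZeros (zipWith _∸_ ν rs)
    strip-ones zero    ν = refl
    strip-ones (suc a) ν = strip-ones a ν

  removePRim-expand : ∀ {u c gs gs′ z} → JS u c gs → Rim gs gs′ z → removePRim p (expand gs) ≡ expand gs′
  removePRim-expand js [] = refl
  removePRim-expand (cons _ a<p _ _) (column {a}) =
    trans (cong (dropZeros ∘ zipWith _∸_ (replicate (suc a) 1 ++ [])) (trans (rows-last {1} a<p a<p) (sym (ones a))))
      (strip-ones (suc a) [])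
    where
    ones : ∀ a → replicate (suc a) 1 ++ [] ≡ replicate a 1 ++ 1 ∷ []
    ones zero    = refl
    ones (suc a) = cong (1 ∷_) (ones a)
  removePRim-expand (cons _ a<p _ _) (last {l} {a} q) = begin
    _ ≡⟨ cong (dropZeros ∘ zipWith _∸_ (replicate (suc a) (2 + l) ++ [])) (rows-of-last {l} a<p q) ⟩
    _ ≡⟨ strip-head a [] ⟩
    replicate a (suc l) ++ dropZeros ((l ∸ l) ∷ [])
      ≡⟨ cong (λ x → replicate a (suc l) ++ dropZeros (x ∷ [])) (n∸n≡0 l) ⟩
    replicate a (suc l) ++ [] ≡⟨ expand-block (suc l) a [] ⟨
    _ ∎
    where open ≡-Reasoning
  removePRim-expand (cons _ a<p _ _) (hook {l} {a} {a₂} eq) = begin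
    _ ≡⟨ cong (dropZeros ∘ zipWith _∸_ (replicate (suc a) (2 + l) ++ replicate (suc a₂) 1 ++ []))
           (rows-merge {2 + l} {a} {1} {a₂} {[]} a<p (s≤s (s≤s z≤n)) z<s (trans (shuffle l a a₂) (cong suc eq)) z≤n) ⟩
    _ ≡⟨ strip-head a _ ⟩
    replicate a (suc l) ++ dropZeros ((l ∸ l) ∷ rest)
      ≡⟨ cong (λ x → replicate a (suc l) ++ dropZeros (x ∷ rest)) (n∸n≡0 l) ⟩
    replicate a (suc l) ++ dropZeros rest
      ≡⟨ cong (replicate a (suc l) ++_) (strip-ones (suc a₂) []) ⟩
    replicate a (suc l) ++ [] ≡⟨ expand-block (suc l) a [] ⟨
    _ ∎
    where
    open ≡-Reasoning
    rest = zipWith _∸_ (replicate (suc a₂) 1 ++ []) (replicate (suc a₂) 1 ++ [])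
    shuffle : ∀ l a b → 2 + l + suc a + suc b ≡ suc (3 + l + a + b)
    shuffle = solve-∀
  removePRim-expand (cons _ a<p _ (cons l₂<l _ _ js)) (merge {l} {a} {l₂} {a₂} {gs} {gs′} eq r) = begin
    _ ≡⟨ cong (dropZeros ∘ zipWith _∸_ (replicate (suc a) (2 + l) ++ replicate (suc a₂) (2 + l₂) ++ expand gs))
           (rows-merge {2 + l} {a} {2 + l₂} {a₂} a<p l₂<l z<s (trans (shuffle l a a₂) (cong (2 +_) eq))
             (m≤n⇒m≤1+n (JS-bound js))) ⟩
    _ ≡⟨ strip-head a _ ⟩
    replicate a (suc l) ++ dropZeros ((suc l ∸ (l ∸ l₂)) ∷ rest)
      ≡⟨ cong (λ x → replicate a (suc l) ++ dropZeros (x ∷ rest)) new ⟩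
    replicate a (suc l) ++ suc l₂ ∷ dropZeros rest
      ≡⟨ cong (λ x → replicate a (suc l) ++ suc l₂ ∷ x) (strip (suc a₂) (expand gs)) ⟩
    replicate a (suc l) ++ replicate (2 + a₂) (suc l₂) ++ removePRim p (expand gs)
      ≡⟨ cong (λ x → replicate a (suc l) ++ replicate (2 + a₂) (suc l₂) ++ x) (removePRim-expand js r) ⟩
    replicate a (suc l) ++ replicate (2 + a₂) (suc l₂) ++ expand gs′
      ≡⟨ expand-block (suc l) a ((suc l₂ , 2 + a₂) ∷ gs′) ⟨
    _ ∎
    where
    open ≡-Reasoning
    rest = zipWith _∸_ (replicate (suc a₂) (2 + l₂) ++ expand gs) (replicate (suc a₂) 1 ++ pRimRows p (expand gs))
    shuffle : ∀ l a b → 2 + l + suc a + suc b ≡ 2 + (2 + l + a + b)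
    shuffle = solve-∀
    new : suc l ∸ (l ∸ l₂) ≡ suc l₂
    new = trans (+-∸-assoc 1 (m∸n≤m l l₂)) (cong suc (m∸[m∸n]≡n (<⇒≤ (s≤s⁻¹ (s≤s⁻¹ l₂<l)))))
  removePRim-expand (cons _ a<p _ js) (split {l} {a} {b} {gs} {gs′} eq h r) = begin
    _ ≡⟨ cong (dropZeros ∘ zipWith _∸_ (replicate (suc a) (2 + l) ++ expand gs))
           (rows-split {2 + l} {a} {expand gs} a<p
             (≤-trans (+-monoʳ-≤ p h) (≤-trans (≤-reflexive (sym eq)) (+-monoʳ-≤ (2 + l) (n≤1+n a))))) ⟩
    _ ≡⟨ strip-head a _ ⟩
    replicate a (suc l) ++ dropZeros ((2 + l ∸ (p ∸ a)) ∷ _)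
      ≡⟨ cong (λ x → replicate a (suc l) ++ dropZeros (x ∷ zipWith _∸_ (expand gs) (pRimRows p (expand gs)))) new ⟩
    replicate a (suc l) ++ suc b ∷ removePRim p (expand gs)
      ≡⟨ cong (λ x → replicate a (suc l) ++ suc b ∷ x) (removePRim-expand js r) ⟩
    replicate a (suc l) ++ suc b ∷ expand gs′
      ≡⟨ expand-block (suc l) a ((suc b , 1) ∷ gs′) ⟨
    _ ∎
    where
    open ≡-Reasoning
    a≤p : a ≤ p
    a≤p = <⇒≤ (<-trans (n<1+n a) a<p)
    new : 2 + l ∸ (p ∸ a) ≡ suc b
    new = trans (cong (_∸ (p ∸ a)) (+-cancelʳ-≡ a (2 + l) (p ∸ a + suc b)
      (trans eq (trans (cong (_+ suc b) (sym (m∸n+n≡m a≤p))) (shuffle (p ∸ a) a (suc b))))))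
      (m+n∸m≡n (p ∸ a) (suc b))
      where
      shuffle : ∀ x a b → x + a + b ≡ x + b + a
      shuffle = solve-∀

  private
    size-block : ∀ l a gs → size (expand (block l a gs)) ≡ a * l + size (expand gs)
    size-block l a gs = trans (cong size (expand-block l a gs)) (size-replicate-++ a (expand gs))

    length-block : ∀ l a gs → length (expand (block l a gs)) ≡ a + length (expand gs)
    length-block l a gs = trans (cong length (expand-block l a gs)) (length-replicate-++ a (expand gs))

  size-removed : ∀ {u c gs gs′ z} → JS u c gs → Rim gs gs′ z →
    size (expand gs) ≡ size (expand gs′) + rim gs
  size-removed js [] = refl
  size-removed (cons _ a<p _ _) (column {a}) = trans (size-replicate-++ (suc a) [])
    (trans (shuffle a) (sym (rim-last {1} a<p a<p)))
    where
    shuffle : ∀ a → suc a * 1 + 0 ≡ suc a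
    shuffle = solve-∀
  size-removed (cons _ a<p _ _) (last {l} {a} q) = trans (size-replicate-++ (suc a) [])
    (trans (shuffle l a) (sym (cong₂ _+_ (size-block (suc l) a []) (rim-of-last {l} a<p q))))
    where
    shuffle : ∀ l a → suc a * (2 + l) + 0 ≡ a * suc l + 0 + (2 + l + a)
    shuffle = solve-∀
  size-removed (cons _ a<p _ _) (hook {l} {a} {a₂} eq) =
    trans (trans (size-replicate-++ (suc a) _) (cong (suc a * (2 + l) +_) (size-replicate-++ (suc a₂) [])))
    (trans (shuffle l a a₂) (sym (cong₂ _+_ (size-block (suc l) a []) (trans (rim-of-hook {l} a<p eq) (sym eq)))))
    where
    shuffle : ∀ l a b → suc a * (2 + l) + (suc b * 1 + 0) ≡ a * suc l + 0 + (3 + l + a + b)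
    shuffle = solve-∀
  size-removed (cons _ a<p _ (cons l₂<l _ _ js)) (merge {l} {a} {l₂} {a₂} {gs} {gs′} eq r) = begin
    size (expand ((2 + l , suc a) ∷ (2 + l₂ , suc a₂) ∷ gs))
      ≡⟨ trans (size-replicate-++ (suc a) _) (cong (suc a * (2 + l) +_) (size-replicate-++ (suc a₂) _)) ⟩
    suc a * (2 + l) + (suc a₂ * (2 + l₂) + size (expand gs))
      ≡⟨ cong (λ x → suc a * (2 + l) + (suc a₂ * (2 + l₂) + x)) (size-removed js r) ⟩
    suc a * (2 + l) + (suc a₂ * (2 + l₂) + (s′ + rim gs))
      ≡⟨ shuffle₁ l a l₂ a₂ s′ (rim gs) ⟩
    a * suc l + (suc a₂ * suc l₂ + s′) + suc (2 + l + a + a₂) + rim gs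
      ≡⟨ cong (λ x → a * suc l + (suc a₂ * suc l₂ + s′) + suc x + rim gs) eq ⟩
    a * suc l + (suc a₂ * suc l₂ + s′) + suc (l₂ + p) + rim gs
      ≡⟨ shuffle₂ (a * suc l) l₂ a₂ s′ p (rim gs) ⟩
    a * suc l + ((2 + a₂) * suc l₂ + s′) + (p + rim gs)
      ≡⟨ cong₂ (λ x y → a * suc l + x + y) (size-replicate-++ {suc l₂} (2 + a₂) (expand gs′))
           (rim-of-merge {l} {gs = gs} a<p (s≤s⁻¹ (s≤s⁻¹ l₂<l)) (m≤n⇒m≤1+n (JS-bound js)) eq) ⟨
    a * suc l + size (expand inner) + rim whole
      ≡⟨ cong (_+ rim whole) (size-block (suc l) a inner) ⟨
    size (expand (block (suc l) a inner)) + rim whole ∎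
    where
    open ≡-Reasoning
    s′ = size (expand gs′)
    inner = (suc l₂ , 2 + a₂) ∷ gs′
    whole = (2 + l , suc a) ∷ (2 + l₂ , suc a₂) ∷ gs
    shuffle₁ : ∀ l a l₂ a₂ s r → suc a * (2 + l) + (suc a₂ * (2 + l₂) + (s + r)) ≡
      a * suc l + (suc a₂ * suc l₂ + s) + suc (2 + l + a + a₂) + r
    shuffle₁ = solve-∀
    shuffle₂ : ∀ x l₂ a₂ s p r → x + (suc a₂ * suc l₂ + s) + suc (l₂ + p) + r ≡
      x + ((2 + a₂) * suc l₂ + s) + (p + r)
    shuffle₂ = solve-∀
  size-removed (cons _ a<p _ js) (split {l} {a} {b} {gs} {gs′} eq h r) = begin
    size (expand ((2 + l , suc a) ∷ gs))
      ≡⟨ size-replicate-++ (suc a) _ ⟩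
    suc a * (2 + l) + size (expand gs)
      ≡⟨ cong (suc a * (2 + l) +_) (size-removed js r) ⟩
    suc a * (2 + l) + (s′ + rim gs)
      ≡⟨ shuffle₁ l a s′ (rim gs) ⟩
    a * suc l + s′ + (2 + l + a) + rim gs
      ≡⟨ cong (λ x → a * suc l + s′ + x + rim gs) eq ⟩
    a * suc l + s′ + (p + suc b) + rim gs
      ≡⟨ shuffle₂ (a * suc l) s′ p (suc b) (rim gs) ⟩
    a * suc l + (suc b + s′) + (p + rim gs)
      ≡⟨ cong₂ _+_ (size-block (suc l) a ((suc b , 1) ∷ gs′)) (rim-of-split {l} {gs = gs} a<p eq h) ⟨
    size (expand (block (suc l) a ((suc b , 1) ∷ gs′))) + rim ((2 + l , suc a) ∷ gs) ∎
    where
    open ≡-Reasoning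
    s′ = size (expand gs′)
    shuffle₁ : ∀ l a s r → suc a * (2 + l) + (s + r) ≡ a * suc l + s + (2 + l + a) + r
    shuffle₁ = solve-∀
    shuffle₂ : ∀ x s p b r → x + s + (p + b) + r ≡ x + (b + s) + (p + r)
    shuffle₂ = solve-∀

  length-removed : ∀ {gs gs′ z} → Rim gs gs′ z → length (expand gs) ≡ length (expand gs′) + z
  length-removed [] = refl
  length-removed (column {a}) = trans (length-replicate-++ (suc a) []) (+-identityʳ (suc a))
  length-removed (last {l} {a} _) = trans (length-replicate-++ (suc a) [])
    (trans (shuffle a) (cong (_+ 1) (sym (length-block (suc l) a []))))
    where
    shuffle : ∀ a → suc a + 0 ≡ a + 0 + 1
    shuffle = solve-∀
  length-removed (hook {l} {a} {a₂} _) =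
    trans (trans (length-replicate-++ (suc a) _) (cong (suc a +_) (length-replicate-++ (suc a₂) [])))
    (trans (shuffle a a₂) (cong (_+ (2 + a₂)) (sym (length-block (suc l) a []))))
    where
    shuffle : ∀ a b → suc a + (suc b + 0) ≡ a + 0 + (2 + b)
    shuffle = solve-∀
  length-removed (merge {l} {a} {l₂} {a₂} {gs} {gs′} {z} _ r) =
    trans (trans (length-replicate-++ (suc a) _) (cong (suc a +_) (length-replicate-++ (suc a₂) _)))
    (trans (cong (λ x → suc a + (suc a₂ + x)) (length-removed r))
    (trans (shuffle a a₂ _ z) (cong (_+ z) (sym (trans (length-block (suc l) a _)
      (cong (a +_) (length-replicate-++ (2 + a₂) (expand gs′))))))))
    where
    shuffle : ∀ a b n z → suc a + (suc b + (n + z)) ≡ a + (2 + b + n) + z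
    shuffle = solve-∀
  length-removed (split {l} {a} {b} {gs} {gs′} {z} _ _ r) =
    trans (length-replicate-++ (suc a) _) (trans (cong (suc a +_) (length-removed r))
    (trans (shuffle a _ z) (cong (_+ z) (sym (length-block (suc l) a ((suc b , 1) ∷ gs′))))))
    where
    shuffle : ∀ a n z → suc a + (n + z) ≡ a + (1 + n) + z
    shuffle = solve-∀

  -- How the p-rim, of size A, of a JS-partition of type c with n parts ends; z parts are lost.
  data End (c n A : ℕ) : ℕ → Set where
    stay   : A ≈ 0 → End c n A 0
    last   : suc A ≈ c + n + n → End c n A 1
    column : ∀ {z} → suc z < p → A ≈ suc z → suc (suc z) ≈ c + n + n → End c n A (suc z)
    hook   : ∀ {z} → suc z < p → A ≈ 0 → suc z ≈ c + n + n → End c n A (suc z)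

  End-cong : ∀ {c c′ n n′ A A′ z} → A ≈ A′ → c + n + n ≈ c′ + n′ + n′ → End c n A z → End c′ n′ A′ z
  End-cong A≈ eq (stay e)         = stay (trans (sym A≈) e)
  End-cong A≈ eq (last e)         = last (trans (≈-+ˡ 1 (sym A≈)) (trans e eq))
  End-cong A≈ eq (column z<p e f) = column z<p (trans (sym A≈) e) (trans f eq)
  End-cong A≈ eq (hook z<p e f)   = hook z<p (trans (sym A≈) e) (trans f eq)

  private
    -- Dropping the top group raises the type by twice its multiplicity modulo `p` and lowers the
    -- number of parts by the multiplicity. So `c + n + n` is an invariant that carries the data of
    -- the last segment up to the whole partition.
    shift : ∀ c l a gs → c + suc a ≈ suc l →
      let n = length (expand gs); N = length (expand ((suc l , suc a) ∷ gs)) in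
      suc l + suc a + n + n ≈ c + N + N
    shift c l a gs eq = trans (≈-+ʳ n (≈-+ʳ n (≈-+ʳ (suc a) (sym eq))))
      (cong (_% p) (trans (shuffle c (suc a) n)
        (cong (λ N → c + N + N) (sym (length-replicate-++ (suc a) (expand gs))))))
      where
      n = length (expand gs)
      shuffle : ∀ c a n → c + a + a + n + n ≡ c + (a + n) + (a + n)
      shuffle = solve-∀

    drop-p : ∀ {A B} → A ≡ p + B → B ≈ A
    drop-p {A} {B} eq = trans (sym ([m+n]%n≡m%n B p)) (cong (_% p) (trans (+-comm B p) (sym eq)))

    p≈0 : p ≈ 0
    p≈0 = [m+n]%n≡m%n 0 p

  rim-end : ∀ {u c gs gs′ z} → JS u c gs → Rim gs gs′ z → End c (length (expand gs)) (rim gs) z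
  rim-end js [] = stay refl
  rim-end (cons _ a<p eq _) (column {a}) = column a<p (cong (_% p) (rim-last {1} a<p a<p))
    (trans (cong (_% p) (shuffle a)) (shift _ 0 a [] eq))
    where
    shuffle : ∀ a → suc (suc a) ≡ 1 + suc a + 0 + 0
    shuffle = solve-∀
  rim-end (cons _ a<p eq _) (last {l} {a} q) = last
    (trans (cong (_% p) (trans (cong suc (rim-of-last {l} a<p q)) (shuffle l a))) (shift _ (suc l) a [] eq))
    where
    shuffle : ∀ l a → suc (2 + l + a) ≡ 2 + l + suc a + 0 + 0
    shuffle = solve-∀
  rim-end (cons _ a<p eq (cons _ _ eq₂ [])) (hook {l} {a} {a₂} e) =
    hook (≤-trans (s≤s (s≤s (s≤s (m≤n+m a₂ (l + a))))) (≤-reflexive e))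
      (trans (cong (_% p) (rim-of-hook {l} a<p e)) p≈0)
      (trans (cong (_% p) (shuffle a₂)) (trans (shift (2 + l + suc a) 0 a₂ [] eq₂)
        (shift _ (suc l) a ((1 , suc a₂) ∷ []) eq)))
    where
    shuffle : ∀ a → 2 + a ≡ 1 + suc a + 0 + 0
    shuffle = solve-∀
  rim-end (cons _ a<p eq (cons l₂<l _ eq₂ js)) (merge {l} {a} {l₂} {a₂} {gs} e r) =
    End-cong (drop-p (rim-of-merge {l} {gs = gs} a<p (s≤s⁻¹ (s≤s⁻¹ l₂<l)) (m≤n⇒m≤1+n (JS-bound js)) e))
      (trans (shift (2 + l + suc a) (suc l₂) a₂ gs eq₂) (shift _ (suc l) a ((2 + l₂ , suc a₂) ∷ gs) eq))
      (rim-end js r)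
  rim-end (cons _ a<p eq js) (split {l} {a} {b} {gs} e h r) =
    End-cong (drop-p (rim-of-split {l} {gs = gs} a<p e h)) (shift _ (suc l) a gs eq) (rim-end js r)

-- Change of the p-core and of the weight

module Weights (p : ℕ) .{{_ : NonZero p}} (2≤p : 2 ≤ p) where

  open Core p
  open Residues p
  open Chains p
  open Rims p 2≤p
  open Steps p 2≤p

  private
    ≈0⇒multiple : ∀ {x} → x ≈ 0 → x ≡ x / p * p
    ≈0⇒multiple {x} e = trans (m≡m%n+[m/n]*n x p) (cong (_+ x / p * p) (trans e 0%p))

  -- The ends `stay` and `hook` keep the core size, the latter by reflection, and `last` is one
  -- `CoreSize-step`. A lost column of `suc z` parts acts like a single lost part: one step removes
  -- the first, and a reflection shows that the other `z` have no effect.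
  core-change : ∀ {c n C C′ A z} n′ → n ≡ n′ + z → End c n A z →
    CoreSize C n (c + n) → CoreSize C′ n′ (c + n′) → ∃ λ δ → δ ≤ 1 × A % p + C′ ≡ C + δ * p
  core-change {c} {C = C} {C′} n′ refl (stay e) cs cs′
    rewrite +-identityʳ n′ | CoreSize-unique {C} {C′} {n′} {c + n′} cs cs′ =
    0 , z≤n , trans (cong (_+ C′) (trans e 0%p)) (+-comm 0 C′)
  core-change {c} {C = C} {C′} {A} n′ refl (last e) cs cs′
    with CoreSize-step {C} {C′} {n′} {c + n′} (subst₂ (CoreSize C) (+-comm n′ 1) (shuffle c n′) cs) cs′
    where
    shuffle : ∀ c n → c + (n + 1) ≡ suc (c + n)
    shuffle = solve-∀
  ... | δ , δ≤1 , eq = δ , δ≤1 , trans (cong (_+ C′) (≈-pred (trans e (cong (_% p) (shuffle c n′))))) eq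
    where
    shuffle : ∀ c n → c + (n + 1) + (n + 1) ≡ suc (suc (n + (c + n)))
    shuffle = solve-∀
  core-change {c} {C = C} {C′} {A} n′ refl (column {z} z<p A≈ e) cs cs′
    with CoreSize-step {C} {C′} {m} {c + m}
           (subst₂ (CoreSize C) (+-suc n′ z) (trans (cong (c +_) (+-suc n′ z)) (+-suc c m)) cs)
           (CoreSize-reflect {C′} {n′} {c + n′} {m} {c + m} k
             (trans (shuffle c n′ m) n′+s≡kp) (trans (shuffle′ c n′ m) n′+s≡kp) cs′)
    where
    m = n′ + z
    z≈ : z ≈ c + m + m
    z≈ = ≈-pred (≈-pred (trans e (cong (_% p) (shuffle c n′ z))))
      where
      shuffle : ∀ c n z → c + (n + suc z) + (n + suc z) ≡ suc (suc (c + (n + z) + (n + z)))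
      shuffle = solve-∀
    k = (n′ + (c + m)) / p
    n′+s≡kp : n′ + (c + m) ≡ k * p
    n′+s≡kp = ≈0⇒multiple (sym (≈-cancelʳ z (trans z≈ (cong (_% p) (shuffle c n′ z)))))
      where
      shuffle : ∀ c n z → c + (n + z) + (n + z) ≡ n + (c + (n + z)) + z
      shuffle = solve-∀
    shuffle : ∀ c n m → m + (c + n) ≡ n + (c + m)
    shuffle = solve-∀
    shuffle′ : ∀ c n m → c + m + n ≡ n + (c + m)
    shuffle′ = solve-∀
  ... | δ , δ≤1 , eq = δ , δ≤1 , trans (cong (_+ C′) (trans A≈ (≈-pred (trans e (cong (_% p) (shuffle c n′ z)))))) eq
    where
    shuffle : ∀ c n z → c + (n + suc z) + (n + suc z) ≡ suc (suc (n + z + (c + (n + z))))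
    shuffle = solve-∀
  core-change {c} {C = C} {C′} {A} n′ refl (hook {z} z<p A≈0 e) cs cs′ =
    0 , z≤n , trans (cong (_+ C′) (trans A≈0 0%p)) (trans (sym C≡C′) (+-comm 0 C))
    where
    n = n′ + suc z
    k = (n′ + (c + n)) / p
    n′+s≡kp : n′ + (c + n) ≡ k * p
    n′+s≡kp = ≈0⇒multiple (sym (≈-cancelʳ (suc z) (trans e (cong (_% p) (shuffle c n′ (suc z))))))
      where
      shuffle : ∀ c n z → c + (n + z) + (n + z) ≡ n + (c + (n + z)) + z
      shuffle = solve-∀
    C≡C′ : C ≡ C′
    C≡C′ = CoreSize-unique {C} {C′} {n} {c + n} cs (CoreSize-reflect {C′} {n′} {c + n′} {n} {c + n} k
      (trans (shuffle c n′ n) n′+s≡kp) (trans (shuffle′ c n′ n) n′+s≡kp) cs′)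
      where
      shuffle : ∀ c n m → m + (c + n) ≡ n + (c + m)
      shuffle = solve-∀
      shuffle′ : ∀ c n m → c + m + n ≡ n + (c + m)
      shuffle′ = solve-∀

  size-by-weight : ∀ {ν} → IsPartition ν → size ν ≡ weight p ν * p + size (core p ν)
  size-by-weight {ν} pt with CoreOf.hooks (core-spec pt)
  ... | w , eq = trans eq (cong (λ x → x * p + size (core p ν)) (sym (trans
    (cong (λ s → (s ∸ size (core p ν)) / p) eq)
    (trans (cong (_/ p) (m+n∸n≡m (w * p) (size (core p ν)))) (m*n/n≡m w p)))))

  drop? : ℕ → ℕ → ℕ
  drop? C C′ = if ⌊ C <? C′ ⌋ then 1 else 0

  private
    drop?-yes : ∀ {C C′} → C < C′ → drop? C C′ ≡ 1
    drop?-yes {C} {C′} q with C <? C′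
    ... | yes _ = refl
    ... | no ¬q = contradiction q ¬q

    drop?-no : ∀ {C C′} → C ≮ C′ → drop? C C′ ≡ 0
    drop?-no {C} {C′} ¬q with C <? C′
    ... | yes q = contradiction q ¬q
    ... | no _  = refl

  -- Since `A % p < p`, a carry forces `C < C′`; without a carry `C′ ≤ C`.
  drop?-δ : ∀ {C C′ A} δ → δ ≤ 1 → A % p + C′ ≡ C + δ * p → δ ≡ drop? C C′
  drop?-δ {C} {C′} {A} zero _ eq = sym (drop?-no (≤⇒≯ (≤-trans (m≤n+m C′ (A % p))
    (≤-reflexive (trans eq (+-identityʳ C))))))
  drop?-δ {C} {C′} {A} (suc zero) _ eq = sym (drop?-yes (+-cancelʳ-< p C C′
    (≤-<-trans (≤-reflexive (trans (cong (C +_) (sym (+-identityʳ p))) (trans (sym eq) (+-comm (A % p) C′))))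
      (+-monoʳ-< C′ (m%n<n A p)))))
  drop?-δ (suc (suc _)) (s≤s ()) _

  -- Both sizes are split into weight times `p` plus core size. After `core-change` the two sides
  -- differ by multiples of `p` only, and `p` is cancelled.
  weight-step : ∀ {u c gs gs′ z} → JS (suc u) c gs → Rim gs gs′ z →
    weight p (expand gs) ≡ weight p (expand gs′) + rim gs / p
      + drop? (size (core p (expand gs))) (size (core p (expand gs′)))
  weight-step {c = c} {gs} {gs′} {z} js r
    with core-change {c} {C = size (core p (expand gs))} {size (core p (expand gs′))}
           (length (expand gs′)) (length-removed r)
           (rim-end js r) (JS-core-size js) (JS-core-size (JS-removed 2≤p js r))
  ... | δ , δ≤1 , eq = trans
    (*-cancelʳ-≡ w (w′ + A / p + δ) p (+-cancelʳ-≡ C _ _ (begin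
      w * p + C
        ≡⟨ size-by-weight (JS-isPartition js) ⟨
      size (expand gs)
        ≡⟨ size-removed js r ⟩
      size (expand gs′) + A
        ≡⟨ cong₂ _+_ (size-by-weight (JS-isPartition (JS-removed 2≤p js r))) (m≡m%n+[m/n]*n A p) ⟩
      w′ * p + C′ + (A % p + A / p * p)
        ≡⟨ shuffle₁ (w′ * p) C′ (A % p) (A / p * p) ⟩
      w′ * p + A / p * p + (A % p + C′)
        ≡⟨ cong (w′ * p + A / p * p +_) eq ⟩
      w′ * p + A / p * p + (C + δ * p)
        ≡⟨ shuffle₂ w′ p (A / p) C δ ⟩
      (w′ + A / p + δ) * p + C ∎)))
    (cong (w′ + A / p +_) (drop?-δ {C} {C′} {A} δ δ≤1 eq))
    where
    open ≡-Reasoning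
    A = rim gs
    C = size (core p (expand gs))
    C′ = size (core p (expand gs′))
    w = weight p (expand gs)
    w′ = weight p (expand gs′)
    shuffle₁ : ∀ w c a b → w + c + (a + b) ≡ w + b + (a + c)
    shuffle₁ = solve-∀
    shuffle₂ : ∀ w p b c d → w * p + b * p + (c + d * p) ≡ (w + b + d) * p + c
    shuffle₂ = solve-∀

  -- Residues of integers

  private
    ℤ-≈ : ∀ {x y} m → int x ≡ int y ℤ.+ m ℤ.* int p → x ≈ y
    ℤ-≈ {x} {y} (int k) eq = ≈-intro 0 k (trans (+-identityʳ x) (ℤ.+-injective
      (trans eq (trans (cong (λ i → int y ℤ.+ i) (sym (ℤ.pos-* k p))) (sym (ℤ.pos-+ y (k * p)))))))
    ℤ-≈ {x} {y} (-[1+ k ]) eq = ≈-intro (suc k) 0 (trans (ℤ.+-injective (begin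
      int (x + suc k * p)
        ≡⟨ ℤ.pos-+ x (suc k * p) ⟩
      int x ℤ.+ int (suc k * p)
        ≡⟨ cong₂ ℤ._+_ eq (ℤ.pos-* (suc k) p) ⟩
      int y ℤ.+ ℤ.- (int (suc k)) ℤ.* int p ℤ.+ int (suc k) ℤ.* int p
        ≡⟨ cancel (int y) (int (suc k)) (int p) ⟩
      int y ∎)) (sym (+-identityʳ y)))
      where
      open ≡-Reasoning
      cancel : ∀ y k p → y ℤ.+ ℤ.- k ℤ.* p ℤ.+ k ℤ.* p ≡ y
      cancel = ℤ-Solver.solve-∀

  modp-≈ : ∀ z a b → z ℤ.+ int b ≡ int a → modp p z + b ≈ a
  modp-≈ z a b eq = ℤ-≈ (ℤ.- q) (begin
    int (modp p z + b)
      ≡⟨ ℤ.pos-+ (modp p z) b ⟩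
    int (modp p z) ℤ.+ int b
      ≡⟨ shuffle (int (modp p z)) (int b) q (int p) ⟩
    int (modp p z) ℤ.+ q ℤ.* int p ℤ.+ int b ℤ.+ ℤ.- q ℤ.* int p
      ≡⟨ cong (λ x → x ℤ.+ int b ℤ.+ ℤ.- q ℤ.* int p) (a≡a%ℕn+[a/ℕn]*n z p) ⟨
    z ℤ.+ int b ℤ.+ ℤ.- q ℤ.* int p
      ≡⟨ cong (ℤ._+ ℤ.- q ℤ.* int p) eq ⟩
    int a ℤ.+ ℤ.- q ℤ.* int p ∎)
    where
    open ≡-Reasoning
    q = z /ℕ p
    shuffle : ∀ m b q p → m ℤ.+ b ≡ m ℤ.+ q ℤ.* p ℤ.+ b ℤ.+ ℤ.- q ℤ.* p
    shuffle = ℤ-Solver.solve-∀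

  modp-sub : ∀ a b → modp p (int a ℤ.- int b) + b ≈ a
  modp-sub a b = modp-≈ (int a ℤ.- int b) a b (cancel (int a) (int b))
    where
    cancel : ∀ a b → a ℤ.- b ℤ.+ b ≡ a
    cancel = ℤ-Solver.solve-∀

  modp-sub-suc : ∀ a b → modp p ((int a ℤ.- int b) ℤ.+ int 1) + b ≈ suc a
  modp-sub-suc a b = modp-≈ ((int a ℤ.- int b) ℤ.+ int 1) (suc a) b
    (trans (cancel (int a) (int b)) (ℤ.+-comm (int a) (int 1)))
    where
    cancel : ∀ a b → a ℤ.- b ℤ.+ int 1 ℤ.+ b ≡ a ℤ.+ int 1
    cancel = ℤ-Solver.solve-∀

  modp-chain : ∀ l l′ a a′ → modp p ((int l ℤ.- int l′) ℤ.+ int a ℤ.+ int a′) + l′ ≈ l + a + a′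
  modp-chain l l′ a a′ = modp-≈ ((int l ℤ.- int l′) ℤ.+ int a ℤ.+ int a′) (l + a + a′) l′
    (trans (cancel (int l) (int l′) (int a) (int a′))
    (sym (trans (ℤ.pos-+ (l + a) a′) (cong (ℤ._+ int a′) (ℤ.pos-+ l a)))))
    where
    cancel : ∀ l m a b → l ℤ.- m ℤ.+ a ℤ.+ b ℤ.+ m ≡ l ℤ.+ a ℤ.+ b
    cancel = ℤ-Solver.solve-∀

  modp< : ∀ z → modp p z < p
  modp< z = n%ℕd<d z p

  <-≈⇒≡ : ∀ {x y} → x < p → y < p → x ≈ y → x ≡ y
  <-≈⇒≡ q q′ e = trans (sym (m<n⇒m%n≡m q)) (trans e (m<n⇒m%n≡m q′))

  column-of : ℕ → ℕ → ℕ × ℕ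
  column-of A n = modp p (int A ℤ.- int n) , modp p (int 1 ℤ.- int n)

  -- The number of parts cancels: `(A − n) − (1 − n) + 1` is `A`.
  column-t : ∀ A n → let x , y = column-of A n in modp p ((int x ℤ.- int y) ℤ.+ int 1) ≡ A % p
  column-t A n = trans (sym (m<n⇒m%n≡m (modp< ((int x ℤ.- int y) ℤ.+ int 1)))) (≈-cancelʳ 1 (trans
    (sym (≈-+ˡ t (modp-sub 1 n)))
    (trans (cong (_% p) (sym (+-assoc t y n)))
      (trans (≈-+ʳ n (modp-sub-suc x y)) (trans (cong (_% p) (+-comm 1 (x + n))) (≈-+ʳ 1 (modp-sub A n)))))))
    where
    x = modp p (int A ℤ.- int n)
    y = modp p (int 1 ℤ.- int n)
    t = modp p ((int x ℤ.- int y) ℤ.+ int 1)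

  -- The difference of `1 − n′` and `1 − n` is `z`; the bound `z < p` turns the congruence into an
  -- equality.
  column-s : ∀ {z n} A A′ n′ → z < p → n ≡ n′ + z →
    modp p (int (proj₂ (column-of A′ n′)) ℤ.- int (proj₂ (column-of A n))) ≡ z
  column-s {z} A A′ n′ z<p refl = <-≈⇒≡ (modp< (int y′ ℤ.- int y)) z<p (≈-cancelʳ 1 (trans
    (sym (≈-+ˡ s (modp-sub 1 (n′ + z))))
    (trans (cong (_% p) (shuffle s y n′ z)) (trans (≈-+ʳ z (≈-+ʳ n′ (modp-sub y′ y)))
      (trans (≈-+ʳ z (modp-sub 1 n′)) (cong (_% p) (+-comm 1 z)))))))
    where
    y′ = proj₂ (column-of A′ n′)
    y = proj₂ (column-of A (n′ + z))
    s = modp p (int y′ ℤ.- int y)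
    shuffle : ∀ s y n z → s + (y + (n + z)) ≡ s + y + n + z
    shuffle = solve-∀

  dPair-d : ∀ (c′ c : ℕ × ℕ) → let x′ , y′ = c′; x , y = c in
    dPair p c′ c ≡ d (modp p ((int x′ ℤ.- int y′) ℤ.+ int 1)) (modp p (int y′ ℤ.- int y))
                     (modp p ((int x ℤ.- int y) ℤ.+ int 1))
  dPair-d (x′ , y′) (x , y)
    with modp p ((int x′ ℤ.- int y′) ℤ.+ int 1) ≟ 0 | modp p ((int x ℤ.- int y) ℤ.+ int 1) ≟ 0
  ... | no t′≢0 | no t≢0 = d-nonzero t′≢0 t≢0
    where
    d-nonzero : ∀ {t′ s t} → t′ ≢ 0 → t ≢ 0 → (t′ + 2 * s) / p ≡ d t′ s t
    d-nonzero {zero}           ne _  = contradiction refl ne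
    d-nonzero {suc t′} {t = zero}  _ ne = contradiction refl ne
    d-nonzero {suc t′} {t = suc t} _ _  = refl
  ... | no t′≢0 | yes t≡0 =
    trans (d-zero t′≢0) (cong (d (modp p ((int x′ ℤ.- int y′) ℤ.+ int 1)) (modp p (int y′ ℤ.- int y))) (sym t≡0))
    where
    d-zero : ∀ {t′ s} → t′ ≢ 0 → (t′ + s + p) / p ≡ d t′ s 0
    d-zero {zero}   ne = contradiction refl ne
    d-zero {suc t′} _  = refl
  ... | yes t′≡0 | _ =
    cong (λ t′ → d t′ (modp p (int y′ ℤ.- int y)) (modp p ((int x ℤ.- int y) ℤ.+ int 1))) (sym t′≡0)

-- Residue symbols and the weight formula

module Formula (p : ℕ) .{{_ : NonZero p}} (2≤p : 2 ≤ p) where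

  open Core p
  open Residues p
  open Chains p
  open Rims p 2≤p
  open Steps p 2≤p
  open Weights p 2≤p

  rim-positive : ∀ {u c g gs} → JS u c (g ∷ gs) → 0 < rim (g ∷ gs)
  rim-positive {gs = gs} js@(cons {l = l} {a} _ _ _ _) =
    sum-positive (pRimRows-positive (proj₁ (JS-isPartition js)))
      (≤-trans (s≤s z≤n) (≤-reflexive (sym (pRimRows-length (expand ((suc l , suc a) ∷ gs))))))
    where
    sum-positive : ∀ {xs} → All (0 <_) xs → 0 < length xs → 0 < sum xs
    sum-positive (x>0 ∷ _) _ = ≤-trans x>0 (m≤m+n _ _)

  JS-next : ∀ {u c gs gs′ z} → JS (suc u) c gs → Rim gs gs′ z → JS (suc u) c gs′
  JS-next js r = JS-weaken (n≤1+n _) refl (JS-removed 2≤p js r)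

  size-decreases : ∀ {u c g gs gs′ z} → JS u c (g ∷ gs) → Rim (g ∷ gs) gs′ z →
    size (expand gs′) < size (expand (g ∷ gs))
  size-decreases js r = <-≤-trans (m<m+n _ (rim-positive js)) (≤-reflexive (sym (size-removed js r)))

  -- The recursion for λ reaches λ⁽²⁾ with more fuel than the symbol of λ⁽²⁾ may start with; sizes
  -- decrease strictly, so the surplus changes nothing.
  rimData-fuel : ∀ f f′ {u c gs} → JS (suc u) c gs → size (expand gs) ≤ f → size (expand gs) ≤ f′ →
    rimData p f (expand gs) ≡ rimData p f′ (expand gs)
  rimData-fuel f f′ [] _ _ = refl
  rimData-fuel (suc f) (suc f′) js@(cons {l = l} {a} {gs} _ _ _ _) q q′ with JS-rim js
  ... | gs′ , z , r = cong (_ ∷_) (subst (λ ν → rimData p f ν ≡ rimData p f′ ν)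
    (sym (removePRim-expand js r))
    (rimData-fuel f f′ (JS-next js r) (s≤s⁻¹ (<-≤-trans (size-decreases js r) q))
                                      (s≤s⁻¹ (<-≤-trans (size-decreases js r) q′))))

  column-of-groups : Groups → ℕ × ℕ
  column-of-groups gs = column-of (rim gs) (length (expand gs))

  symbol : Groups → List (ℕ × ℕ)
  symbol gs = residueSymbol p (expand gs)

  symbol-snoc : ∀ {u c g gs gs′ z} → JS (suc u) c (g ∷ gs) → Rim (g ∷ gs) gs′ z →
    symbol (g ∷ gs) ≡ symbol gs′ ++ column-of-groups (g ∷ gs) ∷ []
  symbol-snoc {gs = gs} {gs′} js@(cons {l = l} {a} _ _ _ _) r = begin
    map toColumn (reverse (now ∷ rimData p fuel (removePRim p ν)))
      ≡⟨ cong (λ xs → map toColumn (reverse (now ∷ xs))) later ⟩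
    map toColumn (reverse (now ∷ rimData p (size ν′) ν′))
      ≡⟨ cong (map toColumn) (unfold-reverse now (rimData p (size ν′) ν′)) ⟩
    map toColumn (reverse (rimData p (size ν′) ν′) ++ now ∷ [])
      ≡⟨ map-++ toColumn (reverse (rimData p (size ν′) ν′)) (now ∷ []) ⟩
    symbol gs′ ++ toColumn now ∷ []
      ≡⟨ cong (λ n → symbol gs′ ++ column-of (pRimSize p ν) n ∷ []) (pRimParts≡length (proj₁ (JS-isPartition js))) ⟩
    symbol gs′ ++ column-of (pRimSize p ν) (length ν) ∷ [] ∎
    where
    open ≡-Reasoning
    ν = expand ((suc l , suc a) ∷ gs)
    ν′ = expand gs′
    -- One less than the size: the first step has consumed one unit.
    fuel = l + size (replicate a (suc l) ++ expand gs)
    now = pRimSize p ν , pRimParts p ν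
    toColumn : ℕ × ℕ → ℕ × ℕ
    toColumn (A , n) = column-of A n
    later : rimData p fuel (removePRim p ν) ≡ rimData p (size ν′) ν′
    later = trans (cong (rimData p fuel) (removePRim-expand js r))
      (rimData-fuel fuel (size ν′) (JS-next js r) (s≤s⁻¹ (size-decreases js r)) ≤-refl)

  symbol-length : ∀ {u c g gs gs′ z} → JS (suc u) c (g ∷ gs) → Rim (g ∷ gs) gs′ z →
    length (symbol (g ∷ gs)) ≡ suc (length (symbol gs′))
  symbol-length {gs′ = gs′} js r = trans (cong length (symbol-snoc js r))
    (trans (length-++ (symbol gs′)) (+-comm _ 1))

  col-++ˡ : ∀ R x i → i < length R → col p (R ++ x ∷ []) (suc i) ≡ col p R (suc i)
  col-++ˡ (y ∷ R) x zero    _       = refl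
  col-++ˡ (y ∷ R) x (suc i) (s<s q) = col-++ˡ R x i q

  col-++ʳ : ∀ R x → col p (R ++ x ∷ []) (suc (length R)) ≡ x
  col-++ʳ []      x = refl
  col-++ʳ (y ∷ R) x = col-++ʳ R x

  d₀-col : ∀ α R → d₀ p α R ≡ d₀ p α (col p R 1 ∷ [])
  d₀-col α R with proj₁ (col p R 1) ≟ α | proj₂ (col p R 1) ≟ (α + 1) % p
  ... | yes _ | yes _ = refl
  ... | yes _ | no _  = refl
  ... | no _  | yes _ = refl
  ... | no _  | no _  = refl

  d₀-yes : ∀ {α x y} → x ≡ α → y ≡ (α + 1) % p → d₀ p α ((x , y) ∷ []) ≡ 1
  d₀-yes {α} {x} {y} eq eq′ with x ≟ α | y ≟ (α + 1) % p
  ... | yes _ | yes _ = refl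
  ... | yes _ | no ne = contradiction eq′ ne
  ... | no ne | _     = contradiction eq ne

  d₀-no : ∀ {α x y} → y ≢ (α + 1) % p → d₀ p α ((x , y) ∷ []) ≡ 0
  d₀-no {α} {x} {y} ne with x ≟ α | y ≟ (α + 1) % p
  ... | yes _ | yes e = contradiction e ne
  ... | yes _ | no _  = refl
  ... | no _  | yes e = contradiction e ne
  ... | no _  | no _  = refl

  End-bound : ∀ {c n A z} → End c n A z → z < p
  End-bound (stay _)         = >-nonZero⁻¹ p
  End-bound (last _)         = 2≤p
  End-bound (column z<p _ _) = z<p
  End-bound (hook z<p _ _)   = z<p

  private
    1≉0 : ¬ 1 ≈ 0
    1≉0 e = 1+n≢0 (<-≈⇒≡ 2≤p (>-nonZero⁻¹ p) e)

  -- λ⁽²⁾ = ∅, so that the numbers of parts n and of lost parts agree.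
  d₀-single : ∀ {c n A} → c < p → 0 < n → End c n A n → Rel A 0 n → A / p ≡ d₀ p c (column-of A n ∷ [])
  d₀-single {c} {n} {A} c<p n>0 end rel =
    trans (trans rel (cong₂ (λ x y → x + d y n (A % p)) (0/n≡0 p) 0%p)) (by-end n>0 end)
    where
    x+n≈A : ∀ n → modp p (int A ℤ.- int n) + n ≈ A
    x+n≈A n = modp-sub A n
    y+n≈1 : ∀ n → modp p (int 1 ℤ.- int n) + n ≈ 1
    y+n≈1 n = modp-sub 1 n
    by-end : ∀ {n} → 0 < n → End c n A n → d 0 n (A % p) ≡ d₀ p c (column-of A n ∷ [])
    by-end () (stay _)
    -- One part is lost: `x ≡ c` and `y` is 0, so the condition in `d₀` becomes `c + 1 ≈ 0`, that is
    -- `A ≈ 0`.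
    by-end _ (last e) = by-remainder (A % p) refl
      where
      A≈ : A ≈ c + 1
      A≈ = ≈-pred (trans e (cong (_% p) (+-comm (c + 1) 1)))
      x≡c : modp p (int A ℤ.- int 1) ≡ c
      x≡c = <-≈⇒≡ (modp< (int A ℤ.- int 1)) c<p (≈-cancelʳ 1 (trans (x+n≈A 1) A≈))
      y≡0 : modp p (int 1 ℤ.- int 1) ≡ 0
      y≡0 = <-≈⇒≡ (modp< (int 1 ℤ.- int 1)) (>-nonZero⁻¹ p) (≈-cancelʳ 1 (y+n≈1 1))
      by-remainder : ∀ t → A % p ≡ t → d 0 1 t ≡ d₀ p c (column-of A 1 ∷ [])
      by-remainder zero eq = trans
        (quotient 1 (>-nonZero⁻¹ p) (trans (m∸n+n≡m (>-nonZero⁻¹ p)) (sym (+-identityʳ p))))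
        (sym (d₀-yes x≡c (trans y≡0 (trans (sym eq) A≈))))
      by-remainder (suc t) eq = trans
        (m<n⇒m/n≡0 (≤-<-trans (≤-reflexive (cong (_∸ suc t) (+-comm (p ∸ 1) 1)))
          (≤-<-trans (m∸n≤m (p ∸ 1) t) (≤-reflexive (suc-pred p)))))
        (sym (d₀-no λ e′ → 1+n≢0 (trans (sym eq) (trans A≈ (trans (sym e′) y≡0)))))
    -- Here `c + n ≈ 1`, so `y` is congruent to `c` and not to `c + 1`.
    by-end {n} _ (column z<p A≈ e) = trans
      (trans (cong (λ t → (p ∸ 1 + n ∸ t) / p) (trans A≈ (m<n⇒m%n≡m z<p)))
        (m<n⇒m/n≡0 (≤-trans (s≤s (≤-reflexive (m+n∸n≡m (p ∸ 1) n))) (≤-reflexive (suc-pred p)))))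
      (sym (d₀-no λ e′ → 1≉0 (≈-cancelʳ (c + n) (trans (cong (_% p) (shuffle c n))
        (trans (≈-+ʳ n (trans (sym (m%n%n≡m%n (c + 1) p)) (cong (_% p) (sym e′))))
          (trans (y+n≈1 n) 1≈))))))
      where
      1≈ : 1 ≈ c + n
      1≈ = ≈-cancelʳ n e
      shuffle : ∀ c n → 1 + (c + n) ≡ c + 1 + n
      shuffle = solve-∀
    -- Here `A` and `c + n` are both 0 modulo `p`, so the column `(−n , 1 − n)` is `(c , c + 1)`.
    by-end {suc z} _ (hook z<p A≈0 e) = trans
      (trans (cong (λ t → (p ∸ 1 + suc z ∸ t) / p) (trans A≈0 0%p))
        (quotient {r = z} 1 (<-trans (n<1+n z) z<p)
          (trans (+-suc (p ∸ 1) z) (trans (cong (_+ z) (suc-pred p)) (shuffle p z)))))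
      (sym (d₀-yes
        (<-≈⇒≡ (modp< (int A ℤ.- int n′)) c<p (≈-cancelʳ n′ (trans (x+n≈A n′) (trans A≈0 0≈))))
        (trans (sym (m<n⇒m%n≡m (modp< (int 1 ℤ.- int n′))))
          (≈-cancelʳ n′ (trans (y+n≈1 n′) (trans (≈-+ʳ 1 0≈) (cong (_% p) (shuffle′ c n′))))))))
      where
      n′ = suc z
      0≈ : 0 ≈ c + n′
      0≈ = ≈-cancelʳ n′ e
      shuffle : ∀ p z → p + z ≡ z + 1 * p
      shuffle = solve-∀
      shuffle′ : ∀ c n → c + n + 1 ≡ c + 1 + n
      shuffle′ = solve-∀

  dTerm : ℕ → List (ℕ × ℕ) → ℕ → ℕ
  dTerm c R zero    = d₀ p c R
  dTerm c R (suc i) = dPair p (col p R (suc i)) (col p R (suc (suc i)))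

  dTerm-++ : ∀ c R x {i} → i < length R → dTerm c (R ++ x ∷ []) i ≡ dTerm c R i
  dTerm-++ c R x {zero} q = trans (d₀-col c (R ++ x ∷ []))
    (trans (cong (λ y → d₀ p c (y ∷ [])) (col-++ˡ R x 0 q)) (sym (d₀-col c R)))
  dTerm-++ c R x {suc i} q = cong₂ (dPair p) (col-++ˡ R x i (<-trans (n<1+n i) q)) (col-++ˡ R x (suc i) q)

  -- Each coefficient grows by one, which adds the plain sum of `f`. In the formula that sum is the
  -- quotient of the rim size, the contribution of one more rim.
  weighted-sum-suc : ∀ f k → sumTo (λ i → (suc k ∸ i) * f i) (suc k) ≡
    sumTo (λ i → (k ∸ i) * f i) k + sumTo f (suc k)
  weighted-sum-suc f k = begin
    sumTo (λ i → (suc k ∸ i) * f i) (suc k)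
      ≡⟨ sumTo-cong (suc k) (λ {i} q → trans (cong (_* f i) (+-∸-assoc 1 (s≤s⁻¹ q))) (+-comm (f i) _)) ⟩
    sumTo (λ i → (k ∸ i) * f i + f i) (suc k)
      ≡⟨ sumTo-+ (λ i → (k ∸ i) * f i) f (suc k) ⟩
    sumTo (λ i → (k ∸ i) * f i) (suc k) + sumTo f (suc k)
      ≡⟨ cong (_+ sumTo f (suc k)) (sumTo-snoc (λ i → (k ∸ i) * f i) k) ⟩
    sumTo (λ i → (k ∸ i) * f i) k + (k ∸ k) * f k + sumTo f (suc k)
      ≡⟨ cong (λ x → sumTo (λ i → (k ∸ i) * f i) k + x * f k + sumTo f (suc k)) (n∸n≡0 k) ⟩
    sumTo (λ i → (k ∸ i) * f i) k + 0 + sumTo f (suc k)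
      ≡⟨ cong (_+ sumTo f (suc k)) (+-identityʳ (sumTo (λ i → (k ∸ i) * f i) k)) ⟩
    sumTo (λ i → (k ∸ i) * f i) k + sumTo f (suc k) ∎
    where open ≡-Reasoning

  symbol-empty : ∀ {u c gs} → JS (suc u) c gs → length (symbol gs) ≡ 0 → gs ≡ []
  symbol-empty [] _ = refl
  symbol-empty js@(cons _ _ _ _) eq =
    contradiction (trans (sym (symbol-length js (proj₂ (proj₂ (JS-rim js))))) eq) 1+n≢0

  -- Columns are counted from the start of the symbol, so λ needs one removal more than λ⁽²⁾ to
  -- reach the same partition, and its first removal gives λ⁽²⁾.
  truncP-≤ : ∀ {u c g gs gs′ z} → JS (suc u) c (g ∷ gs) → Rim (g ∷ gs) gs′ z →
    ∀ {j} → j ≤ length (symbol gs′) → truncP p (expand (g ∷ gs)) j ≡ truncP p (expand gs′) j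
  truncP-≤ {g = g} {gs} {gs′} js r {j} q = trans
    (cong (λ m → iter p m (expand (g ∷ gs))) (trans (cong (_∸ j) (symbol-length js r)) (+-∸-assoc 1 q)))
    (cong (iter p (length (symbol gs′) ∸ j)) (removePRim-expand js r))

  truncP-all : ∀ gs {j} → j ≡ length (symbol gs) → truncP p (expand gs) j ≡ expand gs
  truncP-all gs refl = cong (λ m → iter p m (expand gs)) (n∸n≡0 (length (symbol gs)))

  eTerm-++ : ∀ {u c g gs gs′ z} → JS (suc u) c (g ∷ gs) → Rim (g ∷ gs) gs′ z →
    ∀ {i} → i < length (symbol gs′) → eCoef p (expand (g ∷ gs)) i ≡ eCoef p (expand gs′) i
  eTerm-++ js r q = cong₂ (λ ν ν′ → drop? (size (core p ν)) (size (core p ν′)))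
    (truncP-≤ js r q) (truncP-≤ js r (<⇒≤ q))

  eTerm-last : ∀ {u c g gs gs′ z i} → JS (suc u) c (g ∷ gs) → Rim (g ∷ gs) gs′ z →
    i ≡ length (symbol gs′) →
    eCoef p (expand (g ∷ gs)) i ≡ drop? (size (core p (expand (g ∷ gs)))) (size (core p (expand gs′)))
  eTerm-last {g = g} {gs} {gs′} js r i≡ = cong₂ (λ ν ν′ → drop? (size (core p ν)) (size (core p ν′)))
    (truncP-all (g ∷ gs) (trans (cong suc i≡) (sym (symbol-length js r))))
    (trans (truncP-≤ js r (≤-reflexive i≡)) (truncP-all gs′ i≡))

  -- The statement about the rim is carried along because a step adds to the weight the sum of all
  -- `d` so far, not only the newest one.
  WeightIs : ℕ → ℕ → Groups → Set
  WeightIs k c gs =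
    rim gs / p ≡ sumTo (dTerm c R) (suc k) ×
    weight p (expand gs) ≡ sumTo (λ i → (suc k ∸ i) * dTerm c R i) (suc k)
                         + sumTo (λ i → eCoef p (expand gs) (suc i)) k
    where R = symbol gs

  formula : ∀ k {u c gs} → c < p → JS (suc u) c gs → length (symbol gs) ≡ suc k → WeightIs k c gs
  formula zero {c = c} {gs = g ∷ gs} c<p js@(cons _ _ _ _) len with JS-rim js
  ... | gs′ , z , r with symbol-empty (JS-next js r) (suc-injective (trans (sym (symbol-length js r)) len))
  ...   | refl = A/p≡ , (begin
      weight p (expand (g ∷ gs))
        ≡⟨ weight-step js r ⟩
      0 / p + A / p + drop? (size (core p (expand (g ∷ gs)))) 0
        -- The empty partition has weight `0 / p`, and no core is smaller than the empty one, so no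
        -- e-term arises.
        ≡⟨ cong₂ (λ x y → x + A / p + y) (0/n≡0 p) refl ⟩
      A / p + 0
        ≡⟨ cong (_+ 0) A/p≡ ⟩
      dTerm c R 0 + 0 + 0
        ≡⟨ cong (λ x → x + 0 + 0) (+-identityʳ (dTerm c R 0)) ⟨
      dTerm c R 0 + 0 + 0 + 0 ∎)
    where
    open ≡-Reasoning
    A = rim (g ∷ gs)
    n = length (expand (g ∷ gs))
    R = symbol (g ∷ gs)
    n≡z : z ≡ n
    n≡z = sym (length-removed r)
    A/p≡ : A / p ≡ dTerm c R 0 + 0
    A/p≡ = trans
      (d₀-single c<p z<s (subst (End c n A) n≡z (rim-end js r)) (subst (Rel A 0) n≡z (Rel-rim js r)))
      (trans (cong (d₀ p c) (sym (symbol-snoc js r))) (sym (+-identityʳ _)))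
  formula (suc k) {u} {c} {gs = g ∷ gs} c<p js@(cons _ _ _ _) len with JS-rim js
  ... | gs′ , z , r = A/p≡ , (begin
      weight p (expand (g ∷ gs))
        ≡⟨ weight-step js r ⟩
      weight p (expand gs′) + A / p + drop? (size (core p (expand (g ∷ gs)))) (size (core p (expand gs′)))
        ≡⟨ cong (weight p (expand gs′) + A / p +_) (eTerm-last js r (sym len′)) ⟨
      weight p (expand gs′) + A / p + e (suc k)
        ≡⟨ cong₂ (λ x y → x + y + e (suc k)) (proj₂ ih) A/p≡ ⟩
      sumTo (λ i → (suc k ∸ i) * dTerm c R′ i) (suc k) + sumTo e′ k + sumTo D (suc (suc k)) + e (suc k)
        ≡⟨ cong₂ (λ x y → x + y + sumTo D (suc (suc k)) + e (suc k))
             (sumTo-cong (suc k) λ {i} q → cong ((suc k ∸ i) *_) (sym (D≡ q)))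
             (sumTo-cong k λ q → sym (e≡ q)) ⟩
      sumTo (λ i → (suc k ∸ i) * D i) (suc k) + sumTo (e ∘ suc) k + sumTo D (suc (suc k)) + e (suc k)
        ≡⟨ shuffle (sumTo (λ i → (suc k ∸ i) * D i) (suc k)) _ _ _ ⟩
      sumTo (λ i → (suc k ∸ i) * D i) (suc k) + sumTo D (suc (suc k)) + (sumTo (e ∘ suc) k + e (suc k))
        ≡⟨ cong₂ _+_ (weighted-sum-suc D (suc k)) (sumTo-snoc (e ∘ suc) k) ⟨
      sumTo (λ i → (suc (suc k) ∸ i) * D i) (suc (suc k)) + sumTo (e ∘ suc) (suc k) ∎)
    where
    open ≡-Reasoning
    A = rim (g ∷ gs)
    R = symbol (g ∷ gs)
    R′ = symbol gs′
    D = dTerm c R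
    js′ = JS-next js r
    len′ : length R′ ≡ suc k
    len′ = suc-injective (trans (sym (symbol-length js r)) len)
    ih = formula k c<p js′ len′
    e = eCoef p (expand (g ∷ gs))
    e′ = λ i → eCoef p (expand gs′) (suc i)
    shuffle : ∀ a b c d → a + b + c + d ≡ a + c + (b + d)
    shuffle = solve-∀
    R≡ : R ≡ R′ ++ column-of-groups (g ∷ gs) ∷ []
    R≡ = symbol-snoc js r
    D≡ : ∀ {i} → i < suc k → D i ≡ dTerm c R′ i
    D≡ {i} q = trans (cong (λ R → dTerm c R i) R≡) (dTerm-++ c R′ _ (subst (i <_) (sym len′) q))
    e≡ : ∀ {i} → i < k → e (suc i) ≡ e′ i
    e≡ {i} q = eTerm-++ js r (subst (suc i <_) (sym len′) (s<s q))
    last-column : ∀ {gs′} → JS (suc u) c gs′ → length (symbol gs′) ≡ suc k →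
      col p (symbol gs′) (suc k) ≡ column-of-groups gs′
    last-column [] ()
    last-column {g′ ∷ gs′} js′@(cons _ _ _ _) len′ with JS-rim js′
    ... | gs″ , _ , r′ = trans (cong₂ (col p) (symbol-snoc js′ r′)
      (trans (sym len′) (symbol-length js′ r′))) (col-++ʳ (symbol gs″) (column-of-groups (g′ ∷ gs′)))
    now : col p R (suc (suc k)) ≡ column-of-groups (g ∷ gs)
    now = trans (cong₂ (col p) R≡ (cong suc (sym len′))) (col-++ʳ R′ _)
    before : col p R (suc k) ≡ column-of-groups gs′
    before = trans (cong (λ R → col p R (suc k)) R≡)
      (trans (col-++ˡ R′ _ k (≤-reflexive (sym len′))) (last-column js′ len′))
    D-last : D (suc k) ≡ d (rim gs′ % p) z (A % p)
    D-last = trans (cong₂ (dPair p) before now)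
      (trans (dPair-d (column-of-groups gs′) (column-of-groups (g ∷ gs)))
      (trans (cong₂ (λ t′ t → d t′ (modp p (int y′ ℤ.- int y)) t)
               (column-t (rim gs′) (length (expand gs′))) (column-t A (length (expand (g ∷ gs)))))
        (cong (λ s → d (rim gs′ % p) s (A % p))
          (column-s A (rim gs′) (length (expand gs′)) (End-bound (rim-end js r)) (length-removed r)))))
      where
      y = proj₂ (column-of-groups (g ∷ gs))
      y′ = proj₂ (column-of-groups gs′)
    A/p≡ : A / p ≡ sumTo D (suc (suc k))
    A/p≡ = begin
      A / p
        ≡⟨ Rel-rim js r ⟩
      rim gs′ / p + d (rim gs′ % p) z (A % p)
        ≡⟨ cong₂ _+_ (trans (proj₁ ih) (sumTo-cong (suc k) λ q → sym (D≡ q))) (sym D-last) ⟩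
      sumTo D (suc k) + D (suc k)
        ≡⟨ sumTo-snoc D (suc k) ⟨
      sumTo D (suc (suc k)) ∎

-- From partitions to lists of groups

data Sorted : ℕ → Groups → Set where
  []   : ∀ {u} → Sorted u []
  cons : ∀ {u l a gs} → suc l < u → Sorted (suc l) gs → Sorted u ((suc l , suc a) ∷ gs)

groups-expand : ∀ {ν u} → IsPartition ν → part ν 0 < u → expand (groups ν) ≡ ν × Sorted u (groups ν)
groups-expand {[]} _ _ = refl , []
groups-expand {suc x ∷ ν} (_ ∷ positive , lk) x<u
  with groups ν | groups-expand {ν} {suc (suc x)} (positive , linked-tail lk) (s≤s (part-descending lk 0))
... | [] | eq , [] = cong (suc x ∷_) eq , cons x<u []
... | (suc l , suc a) ∷ gs | eq , cons l<u srt with suc x ≟ suc l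
...   | yes refl = cong (suc x ∷_) eq , cons x<u srt
...   | no ne    = cong (suc x ∷_) eq , cons x<u (cons (≤∧≢⇒< (s≤s⁻¹ l<u) (ne ∘ sym)) srt)

module Groups→JS (p : ℕ) .{{_ : NonZero p}} (2≤p : 2 ≤ p) where

  open Residues p
  open Chains p
  open Weights p 2≤p

  -- The condition on the type is guarded by an equation for `gs`, so it is vacuous for the empty
  -- list; for the tail it is supplied by the first link of the chain.
  sorted-JS : ∀ {u c gs} → Sorted u gs → All (λ g → proj₂ g ≤ p ∸ 1) gs → JSChain p gs →
    (∀ {l a gs′} → gs ≡ (l , a) ∷ gs′ → c + a ≈ l) → JS u c gs
  sorted-JS [] _ _ _ = []
  sorted-JS (cons {l = l} {a} l<u srt) (a≤ ∷ reg) chain top =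
    cons l<u (regular a≤) (top refl) (sorted-JS srt reg (chain-tail srt chain) (next srt chain))
    where
    regular : ∀ {a} → a ≤ p ∸ 1 → a < p
    regular q = ≤-trans (s≤s q) (≤-reflexive (suc-pred p))
    chain-tail : ∀ {u g gs} → Sorted u gs → JSChain p (g ∷ gs) → JSChain p gs
    chain-tail []         _       = _
    chain-tail (cons _ _) (_ , c) = c
    next : ∀ {u gs} → Sorted u gs → JSChain p ((suc l , suc a) ∷ gs) →
      ∀ {l′ a′ gs′} → gs ≡ (l′ , a′) ∷ gs′ → suc l + suc a + a′ ≈ l′
    next (cons {l = l′} {a′} _ _) (eq , _) refl =
      trans (sym (modp-chain (suc l) (suc l′) (suc a) (suc a′))) (cong (λ x → (x + suc l′) % p) eq)

  jsType< : ∀ ν → jsType p ν < p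
  jsType< ν with groups ν
  ... | []          = >-nonZero⁻¹ p
  ... | (l , a) ∷ _ = modp< (int l ℤ.- int a)

  jsType-top : ∀ ν {l a gs} → groups ν ≡ (l , a) ∷ gs → jsType p ν + a ≈ l
  jsType-top ν {l} {a} eq with groups ν
  jsType-top ν {l} {a} refl | _ = modp-sub l a

theorem3p9 : (p : ℕ) .{{_ : NonZero p}} → 2 ≤ p →
    (lam : Partition) → IsPartition lam → IsJS p lam →
    (k : ℕ) → length (residueSymbol p lam) ≡ suc k →
    weight p lam ≡ weightFormula p lam k
theorem3p9 p 2≤p lam pt (reg , chain) k len with groups-expand {lam} {suc (part lam 0)} pt ≤-refl
... | eq , srt = begin
    weight p lam
      ≡⟨ cong (weight p) eq ⟨
    weight p (expand (groups lam))
      ≡⟨ proj₂ (formula k (jsType< lam) js (trans (cong (λ ν → length (residueSymbol p ν)) eq) len)) ⟩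
    sumTo (λ i → (suc k ∸ i) * dTerm (jsType p lam) (residueSymbol p (expand (groups lam))) i) (suc k)
      + sumTo (λ i → eCoef p (expand (groups lam)) (suc i)) k
      ≡⟨ cong (λ ν → sumTo (λ i → (suc k ∸ i) * dTerm (jsType p lam) (residueSymbol p ν) i) (suc k)
                     + sumTo (λ i → eCoef p ν (suc i)) k) eq ⟩
    sumTo (λ i → (suc k ∸ i) * dTerm (jsType p lam) (residueSymbol p lam) i) (suc k)
      + sumTo (λ i → eCoef p lam (suc i)) k
      ≡⟨ cong₂ _+_ (sumTo-cong (suc k) λ {i} _ → cong ((suc k ∸ i) *_) (dTerm-dCoef i)) refl ⟩
    sumTo (λ i → (suc k ∸ i) * dCoef p lam i) (suc k) + sumTo (λ i → eCoef p lam (suc i)) k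
      ≡⟨ cong₂ (λ xs ys → sum xs + sum ys) (map-upTo _ (suc k)) (map-upTo _ k) ⟨
    weightFormula p lam k ∎
  where
  open ≡-Reasoning
  open Chains p
  open Formula p 2≤p
  open Groups→JS p 2≤p
  js : JS (suc (part lam 0)) (jsType p lam) (groups lam)
  js = sorted-JS srt reg chain (jsType-top lam)
  dTerm-dCoef : ∀ i → dTerm (jsType p lam) (residueSymbol p lam) i ≡ dCoef p lam i
  dTerm-dCoef zero    = refl
  dTerm-dCoef (suc i) = refl
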